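{- Given a weighted sequence $T$ of length $n$ and a threshold probability $\frac1z$ for preprocessing, there exists an $O(nz)$-space data structure that can answer Heaviest $z$-Occurrence queries or Average $z$-Occurrence Probability queries in $O(m)$ time, where $m$ is the length of the queried pattern.
   Context: A weighted sequence $T$ of length $n$ over an alphabet $\Sigma$ assigns to every position $i \in \{1,\dots,n\}$ and every letter $c \in \Sigma$ an occurrence probability $p^{(T)}_i(c)$ such that the probabilities at each position sum to $1$. For a string $P$ of length $m$ over $\Sigma$, with letters indexed as $P[0],\dots,P[m-1]$ in this formula, the occurrence probability of $P$ at position $i$ is $\mathrm{Prob}(P,i) = \prod_{j=0}^{m-1} p^{(T)}_{i+j}(P[j])$. For a threshold probability $\frac1z \in (0,1]$, $\mathrm{Occ}^z_T(P)$ is the set of positions $i$ of $T$ with $\mathrm{Prob}(P,i) \ge \frac1z$. Heaviest $z$-Occurrence query: given a pattern $P$ of length $m$, return $\max\{\mathrm{Prob}(P,i) \mid i \in \mathrm{Occ}^z_T(P)\}$. Average $z$-Occurrence Probability query: given a pattern $P$ of length $m$, return $\sum_{i \in \mathrm{Occ}^z_T(P)} \mathrm{Prob}(P,i) / |\mathrm{Occ}^z_T(P)|$. Space is measured in machine words in the standard word-RAM model; a probability occupies one word and arithmetic operations on probabilities take $O(1)$ time. -}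

module Defs where

open import Level using (suc; _⊔_)
open import Algebra.Core using (Op₁; Op₂)
open import Algebra.Bundles using (CommutativeRing; Semiring)
open import Algebra.Structures using (IsCommutativeRing)
import Algebra.Definitions.RawSemiring as RawSemiringDefs
open import Data.Bool.Base using (Bool; true; false) renaming (if_then_else_ to ifᵇ_then_else_)
open import Data.Fin.Base using (Fin; toℕ; fromℕ<)
open import Data.List.Base as List using (List; []; _∷_; allFin; filter; length)
open import Data.List.Relation.Unary.All using (All)
open import Data.List.Membership.Propositional using (_∈_)
open import Data.Maybe.Base using (Maybe; just; nothing)
open import Data.Nat.Base as ℕ using (ℕ; zero)
open import Data.Nat.DivMod using (_/_; _%_)
import Data.Nat.Properties as ℕ
open import Data.Product.Base using (_×_; ∃-syntax)
open import Data.Vec.Base using (Vec; lookup; toList)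
open import Relation.Binary.Core using (Rel)
open import Relation.Binary.PropositionalEquality.Core using (_≡_; _≢_)
open import Relation.Binary.Structures using (IsDecTotalOrder)
open import Relation.Nullary.Decidable using (yes; no; ⌊_⌋)
open import Relation.Nullary.Negation using (¬_)

-- The real numbers enter only through this interface: classically its models
-- are, up to isomorphism, the ordered subfields of ℝ, including ℚ and ℝ itself.
-- Inversion is total; x ⁻¹ is unconstrained (up to congruence) at 0.
record ArchimedeanField c ℓ₁ ℓ₂ : Set (suc (c ⊔ ℓ₁ ⊔ ℓ₂)) where
  infix  8 _⁻¹
  infixl 7 _*_
  infixl 6 _+_
  infix  4 _≈_ _≤_
  field
    Carrier           : Set c
    _≈_               : Rel Carrier ℓ₁
    _≤_               : Rel Carrier ℓ₂
    _+_ _*_           : Op₂ Carrier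
    -_ _⁻¹            : Op₁ Carrier
    0# 1#             : Carrier
    isCommutativeRing : IsCommutativeRing _≈_ _+_ _*_ -_ 0# 1#
    isDecTotalOrder   : IsDecTotalOrder _≈_ _≤_
    0≉1               : ¬ (0# ≈ 1#)
    ⁻¹-cong           : ∀ {x y} → x ≈ y → x ⁻¹ ≈ y ⁻¹
    *-inverseʳ        : ∀ x → ¬ (x ≈ 0#) → x * x ⁻¹ ≈ 1#
    +-monoʳ-≤         : ∀ z {x y} → x ≤ y → z + x ≤ z + y
    *-nonNegative     : ∀ {x y} → 0# ≤ x → 0# ≤ y → 0# ≤ x * y

  commutativeRing : CommutativeRing c ℓ₁
  commutativeRing = record { isCommutativeRing = isCommutativeRing }

  open CommutativeRing commutativeRing public using (_-_; semiring)
  open Semiring semiring public using (rawSemiring)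
  open IsDecTotalOrder isDecTotalOrder public using (_≤?_; _≟_)
  open RawSemiringDefs rawSemiring public using (sum; product)

  fromℕ : ℕ → Carrier
  fromℕ n = RawSemiringDefs._×_ rawSemiring n 1#

  field
    archimedean : ∀ x → ∃[ n ] x ≤ fromℕ n

data Query : Set where
  heaviest average : Query

module WeightedSequences {c ℓ₁ ℓ₂} (F : ArchimedeanField c ℓ₁ ℓ₂) where
  open ArchimedeanField F

  -- The alphabet is Fin σ; positions are numbered from 0 instead of 1.
  record WeightedSequence (n σ : ℕ) : Set (c ⊔ ℓ₁ ⊔ ℓ₂) where
    field
      p        : Fin n → Fin σ → Carrier
      p-nonNeg : ∀ i a → 0# ≤ p i a
      p-sum    : ∀ i → sum (p i) ≈ 1#

  module _ {n σ : ℕ} (T : WeightedSequence n σ) where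
    open WeightedSequence T

    -- A pattern that overruns the end of T has probability 0.
    letterProb : ℕ → Fin σ → Carrier
    letterProb k a with k ℕ.<? n
    ... | yes k<n = p (fromℕ< k<n) a
    ... | no  _   = 0#

    Prob : ∀ {m} → Vec (Fin σ) m → Fin n → Carrier
    Prob P i = product (λ j → letterProb (toℕ i ℕ.+ toℕ j) (lookup P j))

    Occ : Carrier → ∀ {m} → Vec (Fin σ) m → List (Fin n)
    Occ z P = filter (λ i → z ⁻¹ ≤? Prob P i) (allFin n)

    IsHeaviest : Carrier → ∀ {m} → Vec (Fin σ) m → Carrier → Set (ℓ₁ ⊔ ℓ₂)
    IsHeaviest z P r = (∃[ i ] i ∈ Occ z P × r ≈ Prob P i)
                     × (∀ i → i ∈ Occ z P → Prob P i ≤ r)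

    averageProb : Carrier → ∀ {m} → Vec (Fin σ) m → Carrier
    averageProb z P =
      List.foldr _+_ 0# (List.map (Prob P) (Occ z P)) * fromℕ (length (Occ z P)) ⁻¹

    -- Both quantities are undefined when Occ z P is empty; `nothing` reports
    -- exactly that case.
    data IsAnswer (z : Carrier) {m} (P : Vec (Fin σ) m)
                  : Query → Maybe Carrier → Set (c ⊔ ℓ₁ ⊔ ℓ₂) where
      none         : ∀ {q} → Occ z P ≡ [] → IsAnswer z P q nothing
      heaviest-is  : ∀ {r} → IsHeaviest z P r → IsAnswer z P heaviest (just r)
      average-is   : ∀ {r} → Occ z P ≢ [] → r ≈ averageProb z P →
                     IsAnswer z P average (just r)

-- Programs for a word RAM whose words hold either a w-bit integer or a
-- probability.  The two kinds of word live in separate register files and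
-- separate memories.  Programs mention neither w nor the input, so a program is
-- one algorithm for all word lengths, weighted sequences and thresholds.

IntReg ProbReg : Set
IntReg  = ℕ
ProbReg = ℕ

data IntOp : Set where
  add sub mul div mod shl shr and or xor : IntOp

data ProbOp : Set where
  add sub mul div : ProbOp

-- The first register of an instruction is its target, except for the stores,
-- whose first register holds the target address.
data Instr : Set where
  constI           : IntReg → ℕ → Instr
  opI              : IntOp → IntReg → IntReg → IntReg → Instr
  zeroP oneP       : ProbReg → Instr
  opP              : ProbOp → ProbReg → ProbReg → ProbReg → Instr
  dataI            : IntReg → IntReg → Instr
  dataP            : ProbReg → IntReg → Instr
  patternLength    : IntReg → Instr
  patternLetter    : IntReg → IntReg → Instr
  loadI            : IntReg → IntReg → Instr
  loadP            : ProbReg → IntReg → Instr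
  storeI           : IntReg → IntReg → Instr
  storeP           : IntReg → ProbReg → Instr

data Test : Set where
  eqI ltI : IntReg → IntReg → Test
  leP     : ProbReg → ProbReg → Test

infixr 5 _⨾_
data Program : Set where
  instr         : Instr → Program
  _⨾_           : Program → Program → Program
  if_then_else_ : Test → Program → Program → Program
  while_loop_     : Test → Program → Program

module WordArithmetic (w : ℕ) where

  truncate : ℕ → ℕ
  truncate x = (x % (2 ℕ.^ w)) {{ℕ.m^n≢0 2 w}}

  bitwise : (ℕ → ℕ → ℕ) → ℕ → ℕ → ℕ → ℕ
  bitwise f zero      x y = 0
  bitwise f (ℕ.suc k) x y = f (x % 2) (y % 2) ℕ.+ 2 ℕ.* bitwise f k (x / 2) (y / 2)

  -- Division by zero and the remainder modulo zero are set to 0.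
  divide modulo : ℕ → ℕ → ℕ
  divide x zero        = 0
  divide x y@(ℕ.suc _) = x / y
  modulo x zero        = 0
  modulo x y@(ℕ.suc _) = x % y

  -- On words x, y < 2 ^ w every result is again below 2 ^ w.
  ⟦_⟧ᴵ : IntOp → ℕ → ℕ → ℕ
  ⟦ add ⟧ᴵ x y = truncate (x ℕ.+ y)
  ⟦ sub ⟧ᴵ x y = truncate (x ℕ.+ (2 ℕ.^ w ℕ.∸ y))
  ⟦ mul ⟧ᴵ x y = truncate (x ℕ.* y)
  ⟦ div ⟧ᴵ x y = divide x y
  ⟦ mod ⟧ᴵ x y = modulo x y
  ⟦ shl ⟧ᴵ x y = truncate (x ℕ.* 2 ℕ.^ y)
  ⟦ shr ⟧ᴵ x y = (x / (2 ℕ.^ y)) {{ℕ.m^n≢0 2 y}}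
  ⟦ and ⟧ᴵ x y = bitwise ℕ._*_ w x y
  ⟦ or  ⟧ᴵ x y = bitwise ℕ._⊔_ w x y
  ⟦ xor ⟧ᴵ x y = bitwise ℕ.∣_-_∣ w x y

module WordRAM {c ℓ₁ ℓ₂} (F : ArchimedeanField c ℓ₁ ℓ₂) where
  open ArchimedeanField F

  ⟦_⟧ᴾ : ProbOp → Carrier → Carrier → Carrier
  ⟦ add ⟧ᴾ x y = x + y
  ⟦ sub ⟧ᴾ x y = x - y
  ⟦ mul ⟧ᴾ x y = x * y
  ⟦ div ⟧ᴾ x y = x * y ⁻¹

  -- The result of preprocessing: read-only during queries.
  record DataStructure (w : ℕ) : Set (c ⊔ ℓ₂) where
    field
      ints         : List (Fin (2 ℕ.^ w))
      probs        : List Carrier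
      probs-∈[0,1] : All (λ x → 0# ≤ x × x ≤ 1#) probs

    space : ℕ
    space = length ints ℕ.+ length probs

  -- The working storage of a query.
  record State : Set c where
    field
      intReg  : IntReg → ℕ
      probReg : ProbReg → Carrier
      intMem  : ℕ → ℕ
      probMem : ℕ → Carrier

  open State

  initial : State
  initial = record
    { intReg = λ _ → 0 ; probReg = λ _ → 0# ; intMem = λ _ → 0 ; probMem = λ _ → 0# }

  -- Integer register 0 says whether there is an answer, probability register 0
  -- holds it.
  output : State → Maybe Carrier
  output s with intReg s 0
  ... | zero    = nothing
  ... | ℕ.suc _ = just (probReg s 0)

  update : ∀ {a} {A : Set a} → (ℕ → A) → ℕ → A → ℕ → A
  update f k x j = ifᵇ j ℕ.≡ᵇ k then x else f j

  -- Reading past the end yields the default value.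
  read : ∀ {a} {A : Set a} → A → List A → ℕ → A
  read d []       _         = d
  read d (x ∷ _)  zero      = x
  read d (_ ∷ xs) (ℕ.suc k) = read d xs k

  test : Test → State → Bool
  test (eqI a b) s = intReg s a ℕ.≡ᵇ intReg s b
  test (ltI a b) s = intReg s a ℕ.<ᵇ intReg s b
  test (leP a b) s = ⌊ probReg s a ≤? probReg s b ⌋

  module _ {w σ m : ℕ} (D : DataStructure w) (P : Vec (Fin σ) m) where
    open DataStructure D
    open WordArithmetic w

    setI : IntReg → ℕ → State → State
    setI r x s = record s { intReg = update (intReg s) r x }

    setP : ProbReg → Carrier → State → State
    setP r x s = record s { probReg = update (probReg s) r x }

    exec : Instr → State → State
    exec (constI r k)        s = setI r (truncate k) s
    exec (opI o r a b)       s = setI r (⟦ o ⟧ᴵ (intReg s a) (intReg s b)) s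
    exec (zeroP r)           s = setP r 0# s
    exec (oneP r)            s = setP r 1# s
    exec (opP o r a b)       s = setP r (⟦ o ⟧ᴾ (probReg s a) (probReg s b)) s
    exec (dataI r a)         s = setI r (read 0 (List.map toℕ ints) (intReg s a)) s
    exec (dataP r a)         s = setP r (read 0# probs (intReg s a)) s
    exec (patternLength r)   s = setI r (truncate m) s
    exec (patternLetter r a) s =
      setI r (truncate (read 0 (List.map toℕ (toList P)) (intReg s a))) s
    exec (loadI r a)         s = setI r (intMem s (intReg s a)) s
    exec (loadP r a)         s = setP r (probMem s (intReg s a)) s
    exec (storeI a r)        s =
      record s { intMem = update (intMem s) (intReg s a) (intReg s r) }
    exec (storeP a r)        s =
      record s { probMem = update (probMem s) (intReg s a) (probReg s r) }

  -- D , P ⊢⟨ p , s ⟩⇓[ t ] s′ : with data structure D and input pattern P, the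
  -- program p started in state s halts in state s′ after t steps, where every
  -- instruction and every evaluation of a test counts as one step.
  data _,_⊢⟨_,_⟩⇓[_]_ {w σ m : ℕ} (D : DataStructure w) (P : Vec (Fin σ) m) :
       Program → State → ℕ → State → Set c where
    instr       : ∀ {ι s} → D , P ⊢⟨ instr ι , s ⟩⇓[ 1 ] exec D P ι s
    seq         : ∀ {p q s s′ s″ t u} →
                  D , P ⊢⟨ p , s ⟩⇓[ t ] s′ → D , P ⊢⟨ q , s′ ⟩⇓[ u ] s″ →
                  D , P ⊢⟨ p ⨾ q , s ⟩⇓[ t ℕ.+ u ] s″
    if-true     : ∀ {b p q s s′ t} → test b s ≡ true →
                  D , P ⊢⟨ p , s ⟩⇓[ t ] s′ →
                  D , P ⊢⟨ if b then p else q , s ⟩⇓[ ℕ.suc t ] s′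
    if-false    : ∀ {b p q s s′ t} → test b s ≡ false →
                  D , P ⊢⟨ q , s ⟩⇓[ t ] s′ →
                  D , P ⊢⟨ if b then p else q , s ⟩⇓[ ℕ.suc t ] s′
    while-true  : ∀ {b p s s′ s″ t u} → test b s ≡ true →
                  D , P ⊢⟨ p , s ⟩⇓[ t ] s′ →
                  D , P ⊢⟨ while b loop p , s′ ⟩⇓[ u ] s″ →
                  D , P ⊢⟨ while b loop p , s ⟩⇓[ ℕ.suc (t ℕ.+ u) ] s″
    while-false : ∀ {b p s} → test b s ≡ false →
                  D , P ⊢⟨ while b loop p , s ⟩⇓[ 1 ] s

{-# OPTIONS --safe #-}
module Submission where

-- Every window of T of probability at least 1/z occurs in one of ⌊z⌋ strings
-- S j, which are built from right to left by colouring the trie of the suffixes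
-- obtained so far.  Occurrences of P thus become leaves (j , i), at most n z in
-- all, whose string has P as a prefix, and the probability of such a window is
-- a quotient of two prefix products along S j.
--
-- Call a node of the trie of the leaf strings fat if its number k of leaves is
-- at least its depth d.  The subtree of a fat node has at most 1 + k ∸ d fat
-- nodes, so the fat nodes can be stored one by one in O(n z) words, with their
-- answers and with perfectly hashed dictionaries of their children.  A pattern
-- of length m that leaves the fat part has at most m candidate leaves left.  A
-- binary decision tree over them finds, in O(m) steps, a set of leaves agreeing
-- on their first m letters; comparing P with one of them decides whether all or
-- none match, and if all do, their probabilities are collected one by one.

-- A compacted trie would need edge labels and a way to stop inside an edge. Leaving the fat nodes
-- uncompacted costs one dictionary lookup per letter. Below them the pattern is at least as long as
-- the list of candidates, so even an unbalanced binary tree can be afforded. Such a tree looks only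
-- at branching depths, as a Patricia trie does, whence the final comparison with one string.
--
-- The strings `S j` contain every solid window but may contain light windows too, so each leaf is
-- cut to its longest solid factor; a match then certifies an occurrence. Conversely, one occurrence
-- can match several leaves `(j , i)` with the same `i`. Answers at fat nodes are therefore computed
-- from `Occ` itself, and the thin case marks positions in the zeroed working memory to count each
-- of them once.
--
-- Programs do not know the word length. Hashing relies on multiplication modulo 2 ^ w, which the
-- machine provides, and on a shift stored with every table. Suitable multipliers exist by averaging
-- over the odd ones, so nothing is random.

-- Finite sums of natural numbers and counting arguments.

module Counting where

  open import Data.Empty using (⊥-elim)
  open import Data.Fin.Base using (Fin; zero; suc; fromℕ<)
  import Data.Fin.Properties as Fin
  open import Data.List.Base using (List; []; _∷_; filter; length; lookup; map)
  open import Data.List.Membership.Propositional using (_∈_)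
  open import Data.List.Membership.Propositional.Properties using (∈-lookup)
  open import Data.List.Relation.Unary.All as All using (All; []; _∷_)
  open import Data.List.Relation.Unary.AllPairs using ([]; _∷_)
  open import Data.List.Relation.Unary.Any using (here; there)
  open import Data.List.Relation.Unary.Unique.Propositional using (Unique)
  open import Data.Nat.Base
  open import Data.Nat.Properties
  open import Data.Product.Base using (_×_; _,_; ∃-syntax)
  open import Data.Sum.Base using (inj₁; inj₂)
  open import Function.Base using (_∘_; _∘′_)
  open import Relation.Binary.PropositionalEquality
  open import Relation.Nullary using (Dec; yes; no; ¬_)
  open import Relation.Unary using (Pred; Decidable)

  greatest : ∀ {p} {Q : ℕ → Set p} (Q? : ∀ k → Dec (Q k)) n → Q 0 →
             ∃[ k ] Q k × (∀ {j} → Q j → j ≤ n → j ≤ k)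
  greatest Q? zero    q₀ = 0 , q₀ , λ _ j≤0 → j≤0
  greatest Q? (suc n) q₀ with Q? (suc n)
  ... | yes q = suc n , q , λ _ j≤n → j≤n
  ... | no ¬q with greatest Q? n q₀
  ...   | k , qk , max = k , qk , λ {j} qj j≤1+n → max qj (≤-pred (≤∧≢⇒< j≤1+n λ { refl → ¬q qj }))

  ∑ : ∀ {a} {A : Set a} → List A → (A → ℕ) → ℕ
  ∑ []       f = 0
  ∑ (x ∷ xs) f = f x + ∑ xs f

  ind : ∀ {p} {P : Set p} → Dec P → ℕ
  ind (yes _) = 1
  ind (no _)  = 0

  ind-mono : ∀ {p q} {P : Set p} {Q : Set q} (P? : Dec P) (Q? : Dec Q) → (P → Q) → ind P? ≤ ind Q?
  ind-mono (no _)  _       _ = z≤n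
  ind-mono (yes p) (yes _) _ = ≤-refl
  ind-mono (yes p) (no ¬q) f = ⊥-elim (¬q (f p))

  ind≤1 : ∀ {p} {P : Set p} (P? : Dec P) → ind P? ≤ 1
  ind≤1 (yes _) = ≤-refl
  ind≤1 (no _)  = z≤n

  ind-yes : ∀ {p} {P : Set p} (P? : Dec P) → P → ind P? ≡ 1
  ind-yes (yes _) _ = refl
  ind-yes (no ¬p) p = ⊥-elim (¬p p)

  ind-no : ∀ {p} {P : Set p} (P? : Dec P) → ¬ P → ind P? ≡ 0
  ind-no (yes p) ¬p = ⊥-elim (¬p p)
  ind-no (no _)  _  = refl

  +-interchange : ∀ a b c d → (a + b) + (c + d) ≡ (a + c) + (b + d)
  +-interchange a b c d = begin
    (a + b) + (c + d) ≡⟨ +-assoc a b (c + d) ⟩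
    a + (b + (c + d)) ≡⟨ cong (a +_) (sym (+-assoc b c d)) ⟩
    a + (b + c + d)   ≡⟨ cong (λ e → a + (e + d)) (+-comm b c) ⟩
    a + (c + b + d)   ≡⟨ cong (a +_) (+-assoc c b d) ⟩
    a + (c + (b + d)) ≡⟨ sym (+-assoc a c (b + d)) ⟩
    (a + c) + (b + d) ∎
    where open ≡-Reasoning

  module _ {a} {A : Set a} where

    ∑-mono : ∀ (xs : List A) {f g} → (∀ {x} → x ∈ xs → f x ≤ g x) → ∑ xs f ≤ ∑ xs g
    ∑-mono []       _  = z≤n
    ∑-mono (x ∷ xs) le = +-mono-≤ (le (here refl)) (∑-mono xs (le ∘′ there))

    ∑-cong : ∀ (xs : List A) {f g} → (∀ {x} → x ∈ xs → f x ≡ g x) → ∑ xs f ≡ ∑ xs g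
    ∑-cong []       _  = refl
    ∑-cong (x ∷ xs) eq = cong₂ _+_ (eq (here refl)) (∑-cong xs (eq ∘′ there))

    ∑-+ : ∀ (xs : List A) f g → ∑ xs (λ x → f x + g x) ≡ ∑ xs f + ∑ xs g
    ∑-+ []       f g = refl
    ∑-+ (x ∷ xs) f g =
      trans (cong (f x + g x +_) (∑-+ xs f g)) (+-interchange (f x) (g x) (∑ xs f) (∑ xs g))

    ∑-const : ∀ (xs : List A) k → ∑ xs (λ _ → k) ≡ length xs * k
    ∑-const []       k = refl
    ∑-const (x ∷ xs) k = cong (k +_) (∑-const xs k)

    ∑-*ˡ : ∀ (xs : List A) k f → ∑ xs (λ x → k * f x) ≡ k * ∑ xs f
    ∑-*ˡ []       k f = sym (*-zeroʳ k)
    ∑-*ˡ (x ∷ xs) k f =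
      trans (cong (k * f x +_) (∑-*ˡ xs k f)) (sym (*-distribˡ-+ k (f x) (∑ xs f)))

    ∑-*ʳ : ∀ (xs : List A) f k → ∑ xs (λ x → f x * k) ≡ ∑ xs f * k
    ∑-*ʳ []       f k = refl
    ∑-*ʳ (x ∷ xs) f k =
      trans (cong (f x * k +_) (∑-*ʳ xs f k)) (sym (*-distribʳ-+ k (f x) (∑ xs f)))

    ∑-map : ∀ {b} {B : Set b} (g : B → A) (ys : List B) f → ∑ (map g ys) f ≡ ∑ ys (f ∘ g)
    ∑-map g []       f = refl
    ∑-map g (y ∷ ys) f = cong (f (g y) +_) (∑-map g ys f)

  module _ {a} {A : Set a} where

    ∈⇒≤∑ : ∀ {xs : List A} {x} f → x ∈ xs → f x ≤ ∑ xs f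
    ∈⇒≤∑ f (here refl) = m≤m+n _ _
    ∈⇒≤∑ f (there x∈)  = ≤-trans (∈⇒≤∑ f x∈) (m≤n+m _ _)

    length-filter≡∑ : ∀ {p} {P : Pred A p} (P? : Decidable P) xs →
                      length (filter P? xs) ≡ ∑ xs (λ x → ind (P? x))
    length-filter≡∑ P? []       = refl
    length-filter≡∑ P? (x ∷ xs) with P? x
    ... | yes p = cong suc (length-filter≡∑ P? xs)
    ... | no ¬p = length-filter≡∑ P? xs

    ∑-ind-unique≤1 : ∀ {p} {P : Pred A p} (P? : Decidable P) {xs} → Unique xs →
                     (∀ {x y} → P x → P y → x ≡ y) → ∑ xs (λ x → ind (P? x)) ≤ 1
    ∑-ind-unique≤1 P? {[]}     _            _  = z≤n
    ∑-ind-unique≤1 P? {x ∷ xs} (x∉xs ∷ xs!) eq with P? x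
    ... | no  _  = ∑-ind-unique≤1 P? xs! eq
    ... | yes px = ≤-reflexive (cong suc (trans (∑-cong xs none) (trans (∑-const xs 0) (*-zeroʳ (length xs)))))
      where
      none : ∀ {y} → y ∈ xs → ind (P? y) ≡ 0
      none {y} y∈ = ind-no (P? y) (λ py → All.lookup x∉xs y∈ (eq px py))

    -- The first-moment method with the division multiplied out: it replaces the random choice of a
    -- hash function.
    ∃≤average : ∀ (xs : List A) → 0 < length xs → ∀ f → ∃[ x ] x ∈ xs × length xs * f x ≤ ∑ xs f
    ∃≤average (x ∷ [])         _ f = x , here refl , ≤-refl
    ∃≤average (x ∷ xs@(_ ∷ _)) _ f with ∃≤average xs z<s f
    ... | y , y∈ , le with ≤-total (f x) (f y)
    ...   | inj₁ fx≤fy = x , here refl , +-monoʳ-≤ (f x) (≤-trans (*-monoʳ-≤ (length xs) fx≤fy) le)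
    ...   | inj₂ fy≤fx = y , there y∈ , +-mono-≤ fy≤fx le

    lookup-injective : ∀ {xs : List A} → Unique xs → ∀ i j → lookup xs i ≡ lookup xs j → i ≡ j
    lookup-injective (_ ∷ _)     zero    zero    _  = refl
    lookup-injective (x∉xs ∷ _)  zero    (suc j) eq = ⊥-elim (All.lookup x∉xs (∈-lookup j) eq)
    lookup-injective (x∉xs ∷ _)  (suc i) zero    eq = ⊥-elim (All.lookup x∉xs (∈-lookup i) (sym eq))
    lookup-injective (_ ∷ xs!)   (suc i) (suc j) eq = cong suc (lookup-injective xs! i j eq)

    unique-injects⇒length≤ : ∀ {xs : List A} {q} (f : A → ℕ) → Unique xs → (∀ {x} → x ∈ xs → f x < q) →
                             (∀ {x y} → x ∈ xs → y ∈ xs → f x ≡ f y → x ≡ y) → length xs ≤ q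
    unique-injects⇒length≤ {xs} f xs! below inj = Fin.injective⇒≤ {f = g} g-injective
      where
      g : Fin (length xs) → Fin _
      g i = fromℕ< (below (∈-lookup {xs = xs} i))
      g-injective : ∀ {i j} → g i ≡ g j → i ≡ j
      g-injective {i} {j} eq = lookup-injective xs! i j
        (inj (∈-lookup {xs = xs} i) (∈-lookup {xs = xs} j) (Fin.fromℕ<-injective _ _ _ _ eq))

  module _ {a} {A : Set a} where

    ∑-swap : ∀ {b} {B : Set b} (xs : List A) (ys : List B) (f : A → B → ℕ) →
             ∑ xs (λ x → ∑ ys (f x)) ≡ ∑ ys (λ y → ∑ xs (λ x → f x y))
    ∑-swap []       ys f = sym (trans (∑-const ys 0) (*-zeroʳ (length ys)))
    ∑-swap (x ∷ xs) ys f =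
      trans (cong (∑ ys (f x) +_) (∑-swap xs ys f)) (sym (∑-+ ys (f x) (λ y → ∑ xs (λ x′ → f x′ y))))

  module _ {a} {A : Set a} where

    -- Exchanging the sums counts, for each member of `xs`, the `y` whose fibre contains it, and
    -- functionality leaves at most one. Applied to the children of a trie node, which divide its
    -- leaves among them.
    ∑-fibres≤ : ∀ {b p} {B : Set b} {P : B → Pred A p} (P? : ∀ y → Decidable (P y)) {ys : List B} →
                Unique ys → (∀ {x y y′} → P y x → P y′ x → y ≡ y′) → ∀ xs →
                ∑ ys (λ y → length (filter (P? y) xs)) ≤ length xs
    ∑-fibres≤ P? {ys} ys! functional xs = begin
      ∑ ys (λ y → length (filter (P? y) xs))   ≡⟨ ∑-cong ys (λ {y} _ → length-filter≡∑ (P? y) xs) ⟩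
      ∑ ys (λ y → ∑ xs (λ x → ind (P? y x)))   ≡⟨ ∑-swap ys xs (λ y x → ind (P? y x)) ⟩
      ∑ xs (λ x → ∑ ys (λ y → ind (P? y x)))   ≤⟨ ∑-mono xs (λ {x} _ → ∑-ind-unique≤1 (λ y → P? y x) ys! functional) ⟩
      ∑ xs (λ _ → 1)                           ≡⟨ trans (∑-const xs 1) (*-identityʳ _) ⟩
      length xs                                ∎
      where open ≤-Reasoning

-- Multiply-shift hashing and the number of its collisions.

module Hashing where

  open Counting
  open import Data.Empty using (⊥-elim)
  open import Data.List.Base using (List; filter; length; upTo)
  open import Data.List.Membership.Propositional using (_∈_)
  open import Data.List.Membership.Propositional.Properties using (∈-filter⁻; ∈-upTo⁻)
  open import Data.List.Properties using (length-upTo)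
  open import Data.List.Relation.Unary.Unique.Propositional.Properties using (upTo⁺) renaming (filter⁺ to Unique-filter⁺)
  open import Data.Nat.Base
  open import Data.Nat.Divisibility
  open import Data.Nat.DivMod
  open import Data.Nat.Primality using (prime[2]; euclidsLemma)
  open import Data.Nat.Properties
  open import Data.Nat.Solver using (module +-*-Solver)
  open import Data.Product.Base using (_×_; _,_; proj₁; proj₂; ∃-syntax)
  open import Data.Sum.Base using (_⊎_; inj₁; inj₂; [_,_]′)
  open import Defs
  open import Relation.Binary.Definitions using (tri<; tri≈; tri>)
  open import Relation.Binary.PropositionalEquality
  open import Relation.Nullary using (Dec; yes; no; ¬_)
  open import Relation.Nullary.Decidable using (_×-dec_; _⊎-dec_; ¬?)

  %-≡⇒∣∸ : ∀ {m n} o .{{_ : NonZero o}} → m ≤ n → m % o ≡ n % o → o ∣ n ∸ m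
  %-≡⇒∣∸ {m} {n} o m≤n eq = divides (n / o ∸ m / o) (begin
    n ∸ m                                         ≡⟨ cong₂ _∸_ (m≡m%n+[m/n]*n n o) (m≡m%n+[m/n]*n m o) ⟩
    (n % o + n / o * o) ∸ (m % o + m / o * o)     ≡⟨ cong (λ r → (n % o + n / o * o) ∸ (r + m / o * o)) eq ⟩
    (n % o + n / o * o) ∸ (n % o + m / o * o)     ≡⟨ [m+n]∸[m+o]≡n∸o (n % o) _ _ ⟩
    n / o * o ∸ m / o * o                         ≡⟨ sym (*-distribʳ-∸ o (n / o) (m / o)) ⟩
    (n / o ∸ m / o) * o                           ∎)
    where open ≡-Reasoning

  /-%-injective : ∀ {m n} o .{{_ : NonZero o}} → m / o ≡ n / o → m % o ≡ n % o → m ≡ n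
  /-%-injective {m} {n} o /≡ %≡ =
    trans (m≡m%n+[m/n]*n m o) (trans (cong₂ (λ r q → r + q * o) %≡ /≡) (sym (m≡m%n+[m/n]*n n o)))

  /-≡⇒<+ : ∀ {m n} o .{{_ : NonZero o}} → m / o ≡ n / o → n < m + o
  /-≡⇒<+ {m} {n} o eq = begin-strict
    n                   ≡⟨ m≡m%n+[m/n]*n n o ⟩
    n % o + n / o * o   <⟨ +-monoˡ-< (n / o * o) (m%n<n n o) ⟩
    o + n / o * o       ≡⟨ cong (λ k → o + k * o) (sym eq) ⟩
    o + m / o * o       ≤⟨ +-monoʳ-≤ o (m/n*n≤m m o) ⟩
    o + m               ≡⟨ +-comm o m ⟩
    m + o               ∎
    where open ≤-Reasoning

  code-% : ∀ q {r} g .{{_ : NonZero g}} → r < g → (q * g + r) % g ≡ r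
  code-% q {r} g r<g =
    trans (cong (_% g) (+-comm (q * g) r)) (trans ([m+kn]%n≡m%n r q g) (m<n⇒m%n≡m r<g))

  code-/ : ∀ q {r} g .{{_ : NonZero g}} → r < g → (q * g + r) / g ≡ q
  code-/ q {r} g r<g = begin
    (q * g + r) / g     ≡⟨ +-distrib-/-∣ˡ r (divides q refl) ⟩
    q * g / g + r / g   ≡⟨ cong₂ _+_ (m*n/n≡m q g) (m<n⇒m/n≡0 r<g) ⟩
    q + 0               ≡⟨ +-identityʳ q ⟩
    q                   ∎
    where open ≡-Reasoning

  Odd : ℕ → Set
  Odd u = ¬ 2 ∣ u

  odd-1+2* : ∀ b → Odd (2 * b + 1)
  odd-1+2* b 2∣ with ∣m+n∣m⇒∣n 2∣ (m∣m*n b)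
  ... | 2∣1 with ∣1⇒≡1 2∣1
  ...   | ()

  -- Odd numbers are units modulo a power of two. Instead of exhibiting an inverse, Euclid's lemma
  -- for the prime 2 strips one factor of two from `x` at a time.
  cancel-odd : ∀ k {u x} → Odd u → 2 ^ k ∣ u * x → 2 ^ k ∣ x
  cancel-odd zero    _     _  = 1∣ _
  cancel-odd (suc k) {u} {x} odd d with euclidsLemma u x prime[2] (∣-trans (m∣m*n (2 ^ k)) d)
  ... | inj₁ 2∣u = ⊥-elim (odd 2∣u)
  ... | inj₂ (divides x′ refl) =
    subst (2 * 2 ^ k ∣_) (*-comm 2 x′) (*-monoʳ-∣ 2 (cancel-odd k odd
      (*-cancelˡ-∣ 2 (subst (2 * 2 ^ k ∣_) shift d))))
    where
    shift : u * (x′ * 2) ≡ 2 * (u * x′)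
    shift = trans (sym (*-assoc u x′ 2)) (*-comm (u * x′) 2)

  -- Halving `d` also lowers the bound 2 ^ w by one exponent, which is why the power of two found
  -- stays below `w`.
  odd-part : ∀ w {d} → 0 < d → d < 2 ^ w → ∃[ t ] ∃[ u ] t < w × Odd u × d ≡ 2 ^ t * u
  odd-part zero    0<d d<1 = ⊥-elim (<⇒≱ d<1 0<d)
  odd-part (suc w) {d} 0<d d<N with 2 ∣? d
  ... | no odd = 0 , d , z<s , odd , sym (+-identityʳ d)
  ... | yes (divides d′ refl)
    with odd-part w (n≢0⇒n>0 λ { refl → <-irrefl refl 0<d })
                    (*-cancelˡ-< 2 d′ (2 ^ w) (subst (_< 2 * 2 ^ w) (*-comm d′ 2) d<N))
  ...   | t , u , t<w , odd , refl = suc t , u , s<s t<w , odd ,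
    trans (*-comm (2 ^ t * u) 2) (sym (*-assoc 2 (2 ^ t) u))

  2^-split : ∀ {s w} → s ≤ w → 2 ^ (w ∸ s) * 2 ^ s ≡ 2 ^ w
  2^-split {s} {w} s≤w = trans (sym (^-distribˡ-+-* 2 (w ∸ s) s)) (cong (2 ^_) (m∸n+n≡m s≤w))

  2^-∣ : ∀ {s w} → s ≤ w → 2 ^ s ∣ 2 ^ w
  2^-∣ {s} {w} s≤w = divides (2 ^ (w ∸ s)) (sym (2^-split s≤w))

  module MultiplyShift (w : ℕ) where
    open WordArithmetic w

    N : ℕ
    N = 2 ^ w

    private instance
      N-nonZero : NonZero N
      N-nonZero = m^n≢0 2 w

    -- The multiply-shift scheme of Dietzfelbinger et al.: the leading w ∸ s bits of the product
    -- modulo 2 ^ w, obtained by two machine instructions.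
    hash : ℕ → ℕ → ℕ → ℕ
    hash a s x = ⟦ shr ⟧ᴵ (⟦ mul ⟧ᴵ a x) s

    hash< : ∀ a {s} x → s ≤ w → hash a s x < 2 ^ (w ∸ s)
    hash< a {s} x s≤w = m<n*o⇒m/o<n {{m^n≢0 2 s}} (subst (a * x % N <_) (sym (2^-split s≤w)) (m%n<n (a * x) N))

    -- Of the odd multipliers 2b+1 at most q map a given nonzero difference d to
    -- a given block of length q: those b sharing a residue modulo q / 2^(t+1)
    -- also agree modulo N / 2^(t+1), where 2^t is the exact power of 2 in d.
    module _ {s d : ℕ} (s≤w : s ≤ w) (0<d : 0 < d) (d<N : d < N) where

      private
        q : ℕ
        q = 2 ^ s

        instance
          q-nonZero : NonZero q
          q-nonZero = m^n≢0 2 s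

        v : ℕ → ℕ
        v b = (2 * b + 1) * d % N

        q∣N : q ∣ N
        q∣N = 2^-∣ s≤w

      module _ {t u : ℕ} (t<s : t < s) (odd : Odd u) (d≡ : d ≡ 2 ^ t * u) where

        private
          g r : ℕ
          g = 2 ^ (s ∸ suc t)
          r = 2 ^ (w ∸ suc t)

          instance
            g-nonZero : NonZero g
            g-nonZero = m^n≢0 2 (s ∸ suc t)

            r-nonZero : NonZero r
            r-nonZero = m^n≢0 2 (w ∸ suc t)

          t<w : t < w
          t<w = <-≤-trans t<s s≤w

          -- Raising `b` by `g` raises (2b+1)d by 2 * g * d, which is a multiple of `q` because d
          -- contains 2 ^ t and g * 2 ^ (t+1) = q. So modulo `q` only the residue of `b` modulo `g`
          -- counts.
          v%q : ∀ b → v b % q ≡ (2 * (b % g) + 1) * d % q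
          v%q b = begin
            (2 * b + 1) * d % N % q                       ≡⟨ m∣n⇒o%n%m≡o%m q N _ q∣N ⟩
            (2 * b + 1) * d % q                           ≡⟨ cong (λ c → (2 * c + 1) * d % q) (m≡m%n+[m/n]*n b g) ⟩
            (2 * (b₀ + k * g) + 1) * d % q                ≡⟨ cong (_% q) expand ⟩
            ((2 * b₀ + 1) * d + (k * u) * q) % q          ≡⟨ [m+kn]%n≡m%n _ (k * u) q ⟩
            (2 * b₀ + 1) * d % q                          ∎
            where
            open ≡-Reasoning
            b₀ k : ℕ
            b₀ = b % g
            k = b / g
            expand : (2 * (b₀ + k * g) + 1) * d ≡ (2 * b₀ + 1) * d + (k * u) * q
            expand = begin
              (2 * (b₀ + k * g) + 1) * d
                ≡⟨ solve 4 (λ b k g d → (con 2 :* (b :+ k :* g) :+ con 1) :* d :=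
                                        (con 2 :* b :+ con 1) :* d :+ k :* (g :* (con 2 :* d))) refl b₀ k g d ⟩
              (2 * b₀ + 1) * d + k * (g * (2 * d))
                ≡⟨ cong (λ e → (2 * b₀ + 1) * d + k * (g * (2 * e))) d≡ ⟩
              (2 * b₀ + 1) * d + k * (g * (2 * (2 ^ t * u)))
                ≡⟨ cong ((2 * b₀ + 1) * d +_)
                     (solve 4 (λ k g T u → k :* (g :* (con 2 :* (T :* u))) := (k :* u) :* (g :* (con 2 :* T))) refl k g (2 ^ t) u) ⟩
              (2 * b₀ + 1) * d + (k * u) * (g * 2 ^ suc t)
                ≡⟨ cong (λ e → (2 * b₀ + 1) * d + (k * u) * e) (2^-split t<s) ⟩
              (2 * b₀ + 1) * d + (k * u) * q ∎
              where open +-*-Solver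

          -- Equal values mean that N divides 2 ^ (t+1) * u * (b′ ∸ b). Cancelling the power of two
          -- and then the odd `u` leaves `r` dividing b′ ∸ b, so the two residues modulo `r`
          -- coincide as well as the quotients.
          v-injective : ∀ {b b′} → b ≤ b′ → v b ≡ v b′ → b / r ≡ b′ / r → b ≡ b′
          v-injective {b} {b′} b≤b′ v≡ /≡ = /-%-injective r /≡ (sym (begin
            b′ % r                ≡⟨ cong (_% r) (sym (m+[n∸m]≡n b≤b′)) ⟩
            (b + (b′ ∸ b)) % r    ≡⟨ %-remove-+ʳ b (cancel-odd (w ∸ suc t) odd r∣) ⟩
            b % r                 ∎))
            where
            open ≡-Reasoning
            mono : (2 * b + 1) * d ≤ (2 * b′ + 1) * d
            mono = *-monoˡ-≤ d (+-monoˡ-≤ 1 (*-monoʳ-≤ 2 b≤b′))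
            diff : (2 * b′ + 1) * d ∸ (2 * b + 1) * d ≡ 2 ^ suc t * (u * (b′ ∸ b))
            diff = begin
              (2 * b′ + 1) * d ∸ (2 * b + 1) * d   ≡⟨ sym (*-distribʳ-∸ d (2 * b′ + 1) (2 * b + 1)) ⟩
              ((2 * b′ + 1) ∸ (2 * b + 1)) * d     ≡⟨ cong (_* d) ([m+n]∸[o+n]≡m∸o (2 * b′) 1 (2 * b)) ⟩
              (2 * b′ ∸ 2 * b) * d                 ≡⟨ cong₂ _*_ (sym (*-distribˡ-∸ 2 b′ b)) d≡ ⟩
              2 * (b′ ∸ b) * (2 ^ t * u)           ≡⟨ solve 3 (λ e T u → con 2 :* e :* (T :* u) := con 2 :* T :* (u :* e)) refl (b′ ∸ b) (2 ^ t) u ⟩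
              2 ^ suc t * (u * (b′ ∸ b))           ∎
              where
              open +-*-Solver
              [m+n]∸[o+n]≡m∸o : ∀ m n o → (m + n) ∸ (o + n) ≡ m ∸ o
              [m+n]∸[o+n]≡m∸o m n o = trans (cong₂ _∸_ (+-comm m n) (+-comm o n)) ([m+n]∸[m+o]≡n∸o n m o)
            r∣ : r ∣ u * (b′ ∸ b)
            r∣ = *-cancelˡ-∣ (2 ^ suc t) {{m^n≢0 2 (suc t)}}
                   (subst₂ _∣_ (trans (sym (2^-split t<w)) (*-comm r (2 ^ suc t))) diff (%-≡⇒∣∸ N mono v≡))

          -- For b below N the quotient by `r` is below 2 ^ (t+1), and the residue is below `g`.
          -- Packed in mixed radix, the pair fits below 2 ^ (t+1) * g = q, which is the bound wanted
          -- for a block.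
          code : ℕ → ℕ
          code b = b / r * g + b % g

          -- Equal residues modulo `g` give equal v modulo `q`; being in the same block of length
          -- `q`, the two v are then equal, and `v-injective` finishes with the quotients by `r`.
          code-injective : ∀ {b b′} τ → v b / q ≡ τ → v b′ / q ≡ τ → code b ≡ code b′ → b ≡ b′
          code-injective {b} {b′} τ vb vb′ eq with ≤-total b b′
          ... | inj₁ le = v-injective le v≡ r≡
            where
            g≡ : b % g ≡ b′ % g
            g≡ = trans (sym (code-% (b / r) g (m%n<n b g))) (trans (cong (_% g) eq) (code-% (b′ / r) g (m%n<n b′ g)))
            r≡ : b / r ≡ b′ / r
            r≡ = trans (sym (code-/ (b / r) g (m%n<n b g))) (trans (cong (_/ g) eq) (code-/ (b′ / r) g (m%n<n b′ g)))
            v≡ : v b ≡ v b′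
            v≡ = /-%-injective q (trans vb (sym vb′))
                   (trans (v%q b) (trans (cong (λ c → (2 * c + 1) * d % q) g≡) (sym (v%q b′))))
          ... | inj₂ le = sym (v-injective le v≡ r≡)
            where
            g≡ : b′ % g ≡ b % g
            g≡ = trans (sym (code-% (b′ / r) g (m%n<n b′ g))) (trans (cong (_% g) (sym eq)) (code-% (b / r) g (m%n<n b g)))
            r≡ : b′ / r ≡ b / r
            r≡ = trans (sym (code-/ (b′ / r) g (m%n<n b′ g))) (trans (cong (_/ g) (sym eq)) (code-/ (b / r) g (m%n<n b g)))
            v≡ : v b′ ≡ v b
            v≡ = /-%-injective q (trans vb′ (sym vb))
                   (trans (v%q b′) (trans (cong (λ c → (2 * c + 1) * d % q) g≡) (sym (v%q b))))

          code< : ∀ {b} → b < N → code b < q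
          code< {b} b<N = begin-strict
            b / r * g + b % g    <⟨ +-monoʳ-< (b / r * g) (m%n<n b g) ⟩
            b / r * g + g        ≡⟨ +-comm (b / r * g) g ⟩
            suc (b / r) * g      ≤⟨ *-monoˡ-≤ g (m<n*o⇒m/o<n {n = 2 ^ suc t} (subst (b <_) (trans (sym (2^-split t<w)) (*-comm r (2 ^ suc t))) b<N)) ⟩
            2 ^ suc t * g        ≡⟨ trans (*-comm (2 ^ suc t) g) (2^-split t<s) ⟩
            q                    ∎
            where open ≤-Reasoning

        block≤q : ∀ τ → length (filter (λ b → v b / q ≟ τ) (upTo N)) ≤ q
        block≤q τ = unique-injects⇒length≤ code (Unique-filter⁺ (λ b → v b / q ≟ τ) (upTo⁺ N))
          (λ b∈ → code< (∈-upTo⁻ (proj₁ (hit b∈))))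
          (λ b∈ b′∈ → code-injective τ (proj₂ (hit b∈)) (proj₂ (hit b′∈)))
          where
          hit : ∀ {b} → b ∈ filter (λ b → v b / q ≟ τ) (upTo N) → b ∈ upTo N × v b / q ≡ τ
          hit = ∈-filter⁻ (λ b → v b / q ≟ τ) {xs = upTo N}

      module _ {t u : ℕ} (s≤t : s ≤ t) (odd : Odd u) (d≡ : d ≡ 2 ^ t * u) where

        private
          q∣v : ∀ b → q ∣ v b
          q∣v b = %-presˡ-∣ (∣n⇒∣m*n (2 * b + 1) q∣d) q∣N
            where
            q∣d : q ∣ d
            q∣d = ∣-trans (2^-∣ s≤t) (subst (2 ^ t ∣_) (sym d≡) (m∣m*n u))

          v≢0 : ∀ b → v b ≢ 0
          v≢0 b v≡0 = <⇒≱ d<N (∣⇒≤ {{>-nonZero 0<d}} (cancel-odd w (odd-1+2* b) (m%n≡0⇒n∣m _ N v≡0)))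

        -- Once s ≤ t, every v b is a multiple of `q`, and a nonzero one, since an odd factor cannot
        -- make `d` divisible by N. Hence v b stays at distance at least `q` from both 0 and N.
        v≥q : ∀ b → q ≤ v b
        v≥q b = ∣⇒≤ {{≢-nonZero (v≢0 b)}} (q∣v b)

        v+q≤N : ∀ b → v b + q ≤ N
        v+q≤N b with q∣v b
        ... | divides k v≡ = begin
          v b + q               ≡⟨ trans (cong (_+ q) v≡) (+-comm (k * q) q) ⟩
          suc k * q             ≤⟨ *-monoˡ-≤ q (*-cancelʳ-< q k (2 ^ (w ∸ s)) (subst₂ _<_ v≡ (sym (2^-split s≤w)) (m%n<n _ N))) ⟩
          2 ^ (w ∸ s) * q       ≡⟨ 2^-split s≤w ⟩
          N                     ∎
          where open ≤-Reasoning

      -- On the cycle of residues modulo N, the multiple of `d` lies within distance less than `q`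
      -- of 0, on either side.
      Near : ℕ → Set
      Near b = v b < q ⊎ N < v b + q

      near? : ∀ b → Dec (Near b)
      near? b = (v b <? q) ⊎-dec (N <? v b + q)

      -- Near values lie in the first or in the last block of length `q`, and each block receives at
      -- most `q` of the b. If `d` is divisible by `q`, no value is near at all.
      near-count : ∑ (upTo N) (λ b → ind (near? b)) ≤ 2 * q
      near-count with odd-part w 0<d d<N
      ... | t , u , t<w , odd , d≡ with t <? s
      ...   | no t≮s = ≤-trans (≤-reflexive (trans (∑-cong (upTo N) (λ {b} _ → ind-no (near? b) (far b)))
                         (trans (∑-const (upTo N) 0) (*-zeroʳ (length (upTo N)))))) z≤n
        where
        s≤t : s ≤ t
        s≤t = ≮⇒≥ t≮s
        far : ∀ b → ¬ Near b
        far b = [ ≤⇒≯ (v≥q s≤t odd d≡ b) , ≤⇒≯ (v+q≤N s≤t odd d≡ b) ]′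
      ...   | yes t<s = begin
        ∑ (upTo N) (λ b → ind (near? b))
          ≤⟨ ∑-mono (upTo N) (λ {b} _ → split b) ⟩
        ∑ (upTo N) (λ b → ind (v b / q ≟ 0) + ind (v b / q ≟ last))
          ≡⟨ ∑-+ (upTo N) _ _ ⟩
        ∑ (upTo N) (λ b → ind (v b / q ≟ 0)) + ∑ (upTo N) (λ b → ind (v b / q ≟ last))
          ≡⟨ cong₂ _+_ (length-filter≡∑ (λ b → v b / q ≟ 0) (upTo N)) (length-filter≡∑ (λ b → v b / q ≟ last) (upTo N)) ⟨
        length (filter (λ b → v b / q ≟ 0) (upTo N)) + length (filter (λ b → v b / q ≟ last) (upTo N))
          ≤⟨ +-mono-≤ (block≤q t<s odd d≡ 0) (block≤q t<s odd d≡ last) ⟩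
        q + q
          ≡⟨ cong (q +_) (sym (+-identityʳ q)) ⟩
        2 * q ∎
        where
        open ≤-Reasoning
        last : ℕ
        last = 2 ^ (w ∸ s) ∸ 1
        N≡ : N ≡ last * q + q
        N≡ = trans (sym (2^-split s≤w)) (trans (cong (_* q) (sym (m∸n+n≡m (m^n>0 2 (w ∸ s)))))
               (trans (cong (_* q) (+-comm last 1)) (+-comm q (last * q))))
        top : ∀ {b} → N < v b + q → v b / q ≡ last
        top {b} N< = trans (cong (_/ q) (sym (m+[n∸m]≡n (<⇒≤ lq<v)))) (code-/ last q
          (+-cancelˡ-< (last * q) _ _ (subst₂ _<_ (sym (m+[n∸m]≡n (<⇒≤ lq<v))) N≡ (m%n<n _ N))))
          where
          lq<v : last * q < v b
          lq<v = +-cancelʳ-< q _ _ (subst (_< v b + q) N≡ N<)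
        split : ∀ b → ind (near? b) ≤ ind (v b / q ≟ 0) + ind (v b / q ≟ last)
        split b with near? b
        ... | no _ = z≤n
        ... | yes (inj₁ v<q) = ≤-trans (≤-reflexive (sym (ind-yes (v b / q ≟ 0) (m<n⇒m/n≡0 v<q)))) (m≤m+n _ _)
        ... | yes (inj₂ N<)  = ≤-trans (≤-reflexive (sym (ind-yes (v b / q ≟ last) (top {b} N<)))) (m≤n+m _ (ind (v b / q ≟ 0)))

    -- Write A and B for the products with x and y modulo N; they lie in the same block. Adding v to
    -- A either stays below N, and then v < q, or wraps around once, so that B + N = A + v with A <
    -- B + q.
    collision⇒near : ∀ {s x y} (s≤w : s ≤ w) (x<y : x < y) (y<N : y < N) b →
                     hash (2 * b + 1) s x ≡ hash (2 * b + 1) s y →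
                     Near s≤w (m<n⇒0<n∸m x<y) (≤-<-trans (m∸n≤m y x) y<N) b
    collision⇒near {s} {x} {y} s≤w x<y y<N b eq with A + v <? N
      where
      A v : ℕ
      A = (2 * b + 1) * x % N
      v = (2 * b + 1) * (y ∸ x) % N
    ... | yes A+v<N = inj₁ (+-cancelˡ-< A v q (subst (_< A + q) (trans B≡ (m<n⇒m%n≡m A+v<N)) (/-≡⇒<+ q {{m^n≢0 2 s}} eq)))
      where
      A v q : ℕ
      A = (2 * b + 1) * x % N
      v = (2 * b + 1) * (y ∸ x) % N
      q = 2 ^ s
      B≡ : (2 * b + 1) * y % N ≡ (A + v) % N
      B≡ = trans (cong (λ y′ → (2 * b + 1) * y′ % N) (sym (m+[n∸m]≡n (<⇒≤ x<y))))
             (trans (cong (_% N) (*-distribˡ-+ (2 * b + 1) x (y ∸ x))) (%-distribˡ-+ ((2 * b + 1) * x) _ N))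
    ... | no A+v≮N = inj₂ (+-cancelˡ-< B N (v + q) (begin-strict
        B + N                ≡⟨ B+N≡ ⟩
        A + v                <⟨ +-monoˡ-< v (/-≡⇒<+ q {{m^n≢0 2 s}} (sym eq)) ⟩
        B + q + v            ≡⟨ trans (+-assoc B q v) (cong (B +_) (+-comm q v)) ⟩
        B + (v + q)          ∎))
      where
      open ≤-Reasoning
      A v q B : ℕ
      A = (2 * b + 1) * x % N
      v = (2 * b + 1) * (y ∸ x) % N
      q = 2 ^ s
      B = (2 * b + 1) * y % N
      N≤A+v : N ≤ A + v
      N≤A+v = ≮⇒≥ A+v≮N
      B≡ : B ≡ (A + v) % N
      B≡ = trans (cong (λ y′ → (2 * b + 1) * y′ % N) (sym (m+[n∸m]≡n (<⇒≤ x<y))))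
             (trans (cong (_% N) (*-distribˡ-+ (2 * b + 1) x (y ∸ x))) (%-distribˡ-+ ((2 * b + 1) * x) _ N))
      A+v∸N<N : A + v ∸ N < N
      A+v∸N<N = +-cancelʳ-< N _ _ (subst (_< N + N) (sym (m∸n+n≡m N≤A+v)) (+-mono-< (m%n<n _ N) (m%n<n _ N)))
      B+N≡ : B + N ≡ A + v
      B+N≡ = trans (cong (_+ N) (trans B≡ (trans (sym (m≤n⇒[n∸m]%m≡n%m N≤A+v)) (m<n⇒m%n≡m A+v∸N<N)))) (m∸n+n≡m N≤A+v)

    Collide : ℕ → ℕ → ℕ → ℕ → Set
    Collide a s x y = x ≢ y × hash a s x ≡ hash a s y

    collide? : ∀ a s x y → Dec (Collide a s x y)
    collide? a s x y = ¬? (x ≟ y) ×-dec (hash a s x ≟ hash a s y)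

    collisions : ℕ → ℕ → List ℕ → ℕ
    collisions a s ks = ∑ ks (λ x → ∑ ks (λ y → ind (collide? a s x y)))

    -- Divided by N this is a collision probability of at most 2 / 2 ^ (w ∸ s), twice that of a
    -- truly random function. The smaller of two different keys is subtracted from the larger, so
    -- both orders have to be treated.
    universal : ∀ {s x y} → s ≤ w → x < N → y < N →
                ∑ (upTo N) (λ b → ind (collide? (2 * b + 1) s x y)) ≤ 2 * 2 ^ s
    universal {s} {x} {y} s≤w x<N y<N with <-cmp x y
    ... | tri≈ _ x≡y _ = ≤-trans (≤-reflexive (trans (∑-cong (upTo N)
            (λ {b} _ → ind-no (collide? (2 * b + 1) s x y) (λ c → proj₁ c x≡y)))
            (trans (∑-const (upTo N) 0) (*-zeroʳ (length (upTo N)))))) z≤n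
    ... | tri< x<y _ _ = ≤-trans (∑-mono (upTo N) (λ {b} _ → ind-mono (collide? (2 * b + 1) s x y) (near? s≤w (m<n⇒0<n∸m x<y) (≤-<-trans (m∸n≤m y x) y<N) b)
            (λ c → collision⇒near s≤w x<y y<N b (proj₂ c)))) (near-count s≤w (m<n⇒0<n∸m x<y) (≤-<-trans (m∸n≤m y x) y<N))
    ... | tri> _ _ y<x = ≤-trans (∑-mono (upTo N) (λ {b} _ → ind-mono (collide? (2 * b + 1) s x y) (near? s≤w (m<n⇒0<n∸m y<x) (≤-<-trans (m∸n≤m x y) x<N) b)
            (λ c → collision⇒near s≤w y<x x<N b (sym (proj₂ c))))) (near-count s≤w (m<n⇒0<n∸m y<x) (≤-<-trans (m∸n≤m x y) x<N))

    hash-% : ∀ a s x → hash (a % N) s x ≡ hash a s x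
    hash-% a s x = cong (λ e → (e / 2 ^ s) {{m^n≢0 2 s}}) (trans (%-distribˡ-* (a % N) x N)
      (trans (cong (λ e → e * (x % N) % N) (m%n%n≡m%n a N)) (sym (%-distribˡ-* a x N))))

    -- The b of at most average cost is taken; there are N of them and each of the ordered pairs of
    -- keys contributes at most 2 * 2 ^ s. Reducing the multiplier modulo N makes it fit into a word
    -- and does not change the hash values.
    ∃few-collisions : ∀ {s} ks → s ≤ w → (∀ {x} → x ∈ ks → x < N) →
      ∃[ a ] a < N × collisions a s ks * 2 ^ (w ∸ s) ≤ 2 * (length ks * length ks)
    ∃few-collisions {s} ks s≤w ks<N
      with ∃≤average (upTo N) (subst (0 <_) (sym (length-upTo N)) (m^n>0 2 w)) (λ b → collisions (2 * b + 1) s ks)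
    ... | b , _ , le = (2 * b + 1) % N , m%n<n (2 * b + 1) N , *-cancelʳ-≤ _ _ (2 ^ s) {{m^n≢0 2 s}} (begin
        collisions a s ks * 2 ^ (w ∸ s) * 2 ^ s     ≡⟨ trans (*-assoc (collisions a s ks) _ _) (cong₂ _*_ same (2^-split s≤w)) ⟩
        collisions (2 * b + 1) s ks * N             ≡⟨ trans (*-comm _ N) (cong (_* collisions (2 * b + 1) s ks) (sym (length-upTo N))) ⟩
        length (upTo N) * collisions (2 * b + 1) s ks ≤⟨ le ⟩
        ∑ (upTo N) (λ b → collisions (2 * b + 1) s ks)
          ≡⟨ ∑-swap (upTo N) ks _ ⟩
        ∑ ks (λ x → ∑ (upTo N) (λ b → ∑ ks (λ y → ind (collide? (2 * b + 1) s x y))))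
          ≡⟨ ∑-cong ks (λ {x} _ → ∑-swap (upTo N) ks _) ⟩
        ∑ ks (λ x → ∑ ks (λ y → ∑ (upTo N) (λ b → ind (collide? (2 * b + 1) s x y))))
          ≤⟨ ∑-mono ks (λ x∈ → ∑-mono ks (λ y∈ → universal s≤w (ks<N x∈) (ks<N y∈))) ⟩
        ∑ ks (λ _ → ∑ ks (λ _ → 2 * 2 ^ s))
          ≡⟨ trans (∑-const ks _) (cong (length ks *_) (∑-const ks _)) ⟩
        length ks * (length ks * (2 * 2 ^ s))
          ≡⟨ solve 2 (λ c q → c :* (c :* (con 2 :* q)) := con 2 :* (c :* c) :* q) refl (length ks) (2 ^ s) ⟩
        2 * (length ks * length ks) * 2 ^ s ∎)
      where
      open ≤-Reasoning
      open +-*-Solver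
      a : ℕ
      a = (2 * b + 1) % N
      same : collisions a s ks ≡ collisions (2 * b + 1) s ks
      same = ∑-cong ks (λ {x} _ → ∑-cong ks (λ {y} _ → ≤-antisym
        (ind-mono (collide? a s x y) (collide? (2 * b + 1) s x y)
           (λ (x≢y , eq) → x≢y , trans (sym (hash-% (2 * b + 1) s x)) (trans eq (hash-% (2 * b + 1) s y))))
        (ind-mono (collide? (2 * b + 1) s x y) (collide? a s x y)
           (λ (x≢y , eq) → x≢y , trans (hash-% (2 * b + 1) s x) (trans eq (sym (hash-% (2 * b + 1) s y)))))))

-- Order, floors, means and maxima in an Archimedean field.

module OrderedField where

  open import Algebra.Bundles using (CommutativeRing)
  import Algebra.Properties.Ring
  import Algebra.Properties.Semiring.Mult
  open Counting
  open import Data.Empty using (⊥-elim)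
  open import Data.Fin.Base using (Fin; zero; suc)
  open import Data.List.Base as List using (List; []; _∷_; allFin; length)
  open import Data.List.Membership.Propositional using (_∈_)
  open import Data.List.Properties using (map-tabulate)
  open import Data.List.Relation.Unary.Any using (here; there)
  open import Data.Nat.Base as ℕ using (ℕ; zero; suc)
  import Data.Nat.Properties as ℕ
  open import Data.Product.Base using (_×_; _,_; proj₁; proj₂; ∃-syntax)
  open import Data.Sum.Base using (inj₁; inj₂)
  open import Defs
  open import Function.Base using (_∘_; id)
  open import Relation.Binary.PropositionalEquality as ≡ using (_≡_)
  open import Relation.Binary.Structures using (IsDecTotalOrder)
  open import Relation.Nullary using (yes; no; ¬_)

  allFin-suc : ∀ n → allFin (suc n) ≡ zero ∷ List.map suc (allFin n)
  allFin-suc n = ≡.cong (zero ∷_) (≡.sym (map-tabulate id suc))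

  ∑-allFin-suc : ∀ n (f : Fin (suc n) → ℕ) → ∑ (allFin (suc n)) f ≡ f zero ℕ.+ ∑ (allFin n) (f ∘ suc)
  ∑-allFin-suc n f = ≡.trans (≡.cong (λ xs → ∑ xs f) (allFin-suc n)) (≡.cong (f zero ℕ.+_) (∑-map suc (allFin n) f))

  module OrderedFieldProperties {c ℓ₁ ℓ₂} (F : ArchimedeanField c ℓ₁ ℓ₂) where
    open ArchimedeanField F
    module ≈ = CommutativeRing commutativeRing
    module ≤ = IsDecTotalOrder isDecTotalOrder
    open Algebra.Properties.Ring ≈.ring using (-‿distribˡ-*; -‿involutive)
    private module × = Algebra.Properties.Semiring.Mult ≈.semiring

    ≤-respʳ : ∀ {x y z} → y ≈ z → x ≤ y → x ≤ z
    ≤-respʳ y≈z x≤y = ≤.trans x≤y (≤.reflexive y≈z)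

    ≤-respˡ : ∀ {x y z} → x ≈ y → x ≤ z → y ≤ z
    ≤-respˡ x≈y x≤z = ≤.trans (≤.reflexive (≈.sym x≈y)) x≤z

    ≰⇒≥ : ∀ {x y} → ¬ (x ≤ y) → y ≤ x
    ≰⇒≥ {x} {y} x≰y with ≤.total x y
    ... | inj₁ x≤y = ⊥-elim (x≰y x≤y)
    ... | inj₂ y≤x = y≤x

    +-mono-≤ : ∀ {a b x y} → a ≤ b → x ≤ y → a + x ≤ b + y
    +-mono-≤ {a} {b} {x} {y} a≤b x≤y =
      ≤.trans (+-monoʳ-≤ a x≤y) (≤-respˡ (≈.+-comm y a) (≤-respʳ (≈.+-comm y b) (+-monoʳ-≤ y a≤b)))

    0≤y-x : ∀ {x y} → x ≤ y → 0# ≤ - x + y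
    0≤y-x {x} x≤y = ≤-respˡ (≈.-‿inverseˡ x) (+-monoʳ-≤ (- x) x≤y)

    x+[y-x]≈y : ∀ x y → x + (- x + y) ≈ y
    x+[y-x]≈y x y = ≈.trans (≈.sym (≈.+-assoc x (- x) y))
      (≈.trans (≈.+-congʳ (≈.-‿inverseʳ x)) (≈.+-identityˡ y))

    x≤x+y : ∀ {y} x → 0# ≤ y → x ≤ x + y
    x≤x+y x 0≤y = ≤-respˡ (≈.+-identityʳ x) (+-monoʳ-≤ x 0≤y)

    y≤x+y : ∀ {x} y → 0# ≤ x → y ≤ x + y
    y≤x+y y 0≤x = ≤-respʳ (≈.+-comm y _) (x≤x+y y 0≤x)

    *-monoˡ-≤ : ∀ {z x y} → 0# ≤ z → x ≤ y → z * x ≤ z * y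
    *-monoˡ-≤ {z} {x} {y} 0≤z x≤y = ≤-respʳ
      (≈.trans (≈.sym (≈.distribˡ z x _)) (≈.*-congˡ (x+[y-x]≈y x y)))
      (x≤x+y (z * x) (*-nonNegative 0≤z (0≤y-x x≤y)))

    *-monoʳ-≤ : ∀ {z x y} → 0# ≤ z → x ≤ y → x * z ≤ y * z
    *-monoʳ-≤ 0≤z x≤y = ≤-respˡ (≈.*-comm _ _) (≤-respʳ (≈.*-comm _ _) (*-monoˡ-≤ 0≤z x≤y))

    0≤1 : 0# ≤ 1#
    0≤1 with ≤.total 0# 1#
    ... | inj₁ 0≤1 = 0≤1
    ... | inj₂ 1≤0 = ≤-respʳ -1*-1≈1 (*-nonNegative 0≤-1 0≤-1)
      where
      0≤-1 : 0# ≤ - 1#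
      0≤-1 = ≤-respʳ (≈.+-identityʳ (- 1#)) (0≤y-x 1≤0)
      -1*-1≈1 : - 1# * - 1# ≈ 1#
      -1*-1≈1 = ≈.trans (≈.sym (-‿distribˡ-* 1# (- 1#)))
        (≈.trans (≈.-‿cong (≈.*-identityˡ (- 1#))) (-‿involutive 1#))

    1≰0 : ¬ (1# ≤ 0#)
    1≰0 1≤0 = 0≉1 (≤.antisym 0≤1 1≤0)

    x*y≤x : ∀ {x y} → 0# ≤ x → y ≤ 1# → x * y ≤ x
    x*y≤x {x} 0≤x y≤1 = ≤-respʳ (≈.*-identityʳ x) (*-monoˡ-≤ 0≤x y≤1)

    x*y≤1 : ∀ {x y} → 0# ≤ x → x ≤ 1# → y ≤ 1# → x * y ≤ 1#
    x*y≤1 0≤x x≤1 y≤1 = ≤.trans (x*y≤x 0≤x y≤1) x≤1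

    *-nonzero : ∀ {x y} → ¬ (x ≈ 0#) → ¬ (y ≈ 0#) → ¬ (x * y ≈ 0#)
    *-nonzero {x} {y} x≉0 y≉0 xy≈0 = y≉0 (≈.trans (≈.sym (≈.*-identityˡ y))
      (≈.trans (≈.*-congʳ (≈.trans (≈.sym (*-inverseʳ x x≉0)) (≈.*-comm x (x ⁻¹))))
      (≈.trans (≈.*-assoc (x ⁻¹) x y) (≈.trans (≈.*-congˡ xy≈0) (≈.zeroʳ (x ⁻¹))))))

    *-divide : ∀ {x y z} → ¬ (y ≈ 0#) → x * y ≈ z → x ≈ z * y ⁻¹
    *-divide {x} {y} {z} y≉0 xy≈z = ≈.trans (≈.sym (≈.*-identityʳ x))
      (≈.trans (≈.*-congˡ (≈.sym (*-inverseʳ y y≉0)))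
      (≈.trans (≈.sym (≈.*-assoc x y (y ⁻¹))) (≈.*-congʳ xy≈z)))

    1⁻¹≈1 : 1# ⁻¹ ≈ 1#
    1⁻¹≈1 = ≈.trans (≈.sym (≈.*-identityˡ _)) (*-inverseʳ 1# (0≉1 ∘ ≈.sym))

    ⁻¹-nonNegative : ∀ {x} → 0# ≤ x → ¬ (x ≈ 0#) → 0# ≤ x ⁻¹
    ⁻¹-nonNegative {x} 0≤x x≉0 with ≤.total 0# (x ⁻¹)
    ... | inj₁ 0≤x⁻¹ = 0≤x⁻¹
    ... | inj₂ x⁻¹≤0 = ⊥-elim (1≰0
      (≤-respˡ (*-inverseʳ x x≉0) (≤-respʳ (≈.zeroʳ x) (*-monoˡ-≤ 0≤x x⁻¹≤0))))

    fromℕ-+ : ∀ m n → fromℕ (m ℕ.+ n) ≈ fromℕ m + fromℕ n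
    fromℕ-+ = ×.×-homo-+ 1#

    fromℕ-* : ∀ m n → fromℕ (m ℕ.* n) ≈ fromℕ m * fromℕ n
    fromℕ-* = ×.×1-homo-*

    0≤fromℕ : ∀ n → 0# ≤ fromℕ n
    0≤fromℕ zero    = ≤.refl
    0≤fromℕ (suc n) = ≤.trans 0≤1 (x≤x+y 1# (0≤fromℕ n))

    fromℕ-mono : ∀ {m n} → m ℕ.≤ n → fromℕ m ≤ fromℕ n
    fromℕ-mono {n = n} ℕ.z≤n = 0≤fromℕ n
    fromℕ-mono (ℕ.s≤s m≤n)   = +-monoʳ-≤ 1# (fromℕ-mono m≤n)

    fromℕ-cancel : ∀ {m n} → fromℕ m ≤ fromℕ n → m ℕ.≤ n
    fromℕ-cancel {zero}          _  = ℕ.z≤n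
    fromℕ-cancel {suc m} {zero}  le = ⊥-elim (1≰0 (≤.trans (x≤x+y 1# (0≤fromℕ m)) le))
    fromℕ-cancel {suc m} {suc n} le = ℕ.s≤s (fromℕ-cancel
      (≤-respˡ (cancel (fromℕ m)) (≤-respʳ (cancel (fromℕ n)) (+-monoʳ-≤ (- 1#) le))))
      where
      cancel : ∀ x → - 1# + (1# + x) ≈ x
      cancel x = ≈.trans (≈.sym (≈.+-assoc (- 1#) 1# x))
        (≈.trans (≈.+-congʳ (≈.-‿inverseˡ 1#)) (≈.+-identityˡ x))

    fromℕ-suc≉0 : ∀ n → ¬ (fromℕ (suc n) ≈ 0#)
    fromℕ-suc≉0 n eq = ℕ.<⇒≱ ℕ.z<s (fromℕ-cancel {suc n} {0} (≤.reflexive eq))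

    private
      floor-exists : ∀ x → 0# ≤ x → ∃[ k ] fromℕ k ≤ x × (∀ {j} → fromℕ j ≤ x → j ℕ.≤ k)
      floor-exists x 0≤x with archimedean x
      ... | n , x≤n with greatest (λ k → fromℕ k ≤? x) n 0≤x
      ...   | k , k≤x , max = k , k≤x , λ j≤x → max j≤x (fromℕ-cancel (≤.trans j≤x x≤n))

    -- 0 on negative arguments.
    ⌊_⌋ : Carrier → ℕ
    ⌊ x ⌋ with 0# ≤? x
    ... | yes 0≤x = proj₁ (floor-exists x 0≤x)
    ... | no _    = 0

    fromℕ⌊⌋≤ : ∀ {x} → 0# ≤ x → fromℕ ⌊ x ⌋ ≤ x
    fromℕ⌊⌋≤ {x} 0≤x with 0# ≤? x
    ... | yes p = proj₁ (proj₂ (floor-exists x p))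
    ... | no ¬p = ⊥-elim (¬p 0≤x)

    ≤⌊⌋ : ∀ {j x} → fromℕ j ≤ x → j ℕ.≤ ⌊ x ⌋
    ≤⌊⌋ {j} {x} j≤x with 0# ≤? x
    ... | yes p = proj₂ (proj₂ (floor-exists x p)) j≤x
    ... | no ¬p = ⊥-elim (¬p (≤.trans (0≤fromℕ j) j≤x))

    ⌊⌋-cong : ∀ {x y} → 0# ≤ x → x ≈ y → ⌊ x ⌋ ≡ ⌊ y ⌋
    ⌊⌋-cong 0≤x x≈y = ℕ.≤-antisym (≤⌊⌋ (≤-respʳ x≈y (fromℕ⌊⌋≤ 0≤x)))
      (≤⌊⌋ (≤-respʳ (≈.sym x≈y) (fromℕ⌊⌋≤ (≤-respʳ x≈y 0≤x))))

    fromℕ-∑ : ∀ {n} (f : Fin n → ℕ) (g : Fin n → Carrier) → (∀ i → fromℕ (f i) ≤ g i) →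
              fromℕ (∑ (allFin n) f) ≤ sum g
    fromℕ-∑ {zero}  f g le = ≤.refl
    fromℕ-∑ {suc n} f g le = ≤-respˡ
      (≈.trans (≈.sym (fromℕ-+ (f zero) _)) (≈.reflexive (≡.cong fromℕ (≡.sym (∑-allFin-suc n f)))))
      (+-mono-≤ (le zero) (fromℕ-∑ (f ∘ suc) (g ∘ suc) (le ∘ suc)))

    sum-nonNegative : ∀ {n} (g : Fin n → Carrier) → (∀ i → 0# ≤ g i) → 0# ≤ sum g
    sum-nonNegative {zero}  g 0≤g = ≤.refl
    sum-nonNegative {suc n} g 0≤g =
      ≤.trans (0≤g zero) (x≤x+y (g zero) (sum-nonNegative (g ∘ suc) (0≤g ∘ suc)))

    ≤sum : ∀ {n} (g : Fin n → Carrier) → (∀ i → 0# ≤ g i) → ∀ i → g i ≤ sum g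
    ≤sum g 0≤g zero    = x≤x+y (g zero) (sum-nonNegative (g ∘ suc) (0≤g ∘ suc))
    ≤sum g 0≤g (suc i) = ≤.trans (≤sum (g ∘ suc) (0≤g ∘ suc) i) (y≤x+y _ (0≤g zero))

    ∑ᴸ : List Carrier → Carrier
    ∑ᴸ = List.foldr _+_ 0#

    module _ {a} {A : Set a} (f : A → Carrier) where

      mean : List A → Carrier
      mean xs = ∑ᴸ (List.map f xs) * fromℕ (length xs) ⁻¹

      ∑ᴸ-nonNegative : (∀ x → 0# ≤ f x) → ∀ xs → 0# ≤ ∑ᴸ (List.map f xs)
      ∑ᴸ-nonNegative 0≤f []       = ≤.refl
      ∑ᴸ-nonNegative 0≤f (x ∷ xs) = ≤.trans (0≤f x) (x≤x+y (f x) (∑ᴸ-nonNegative 0≤f xs))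

      ∑ᴸ≤length : (∀ x → f x ≤ 1#) → ∀ xs → ∑ᴸ (List.map f xs) ≤ fromℕ (length xs)
      ∑ᴸ≤length f≤1 []       = ≤.refl
      ∑ᴸ≤length f≤1 (x ∷ xs) = +-mono-≤ (f≤1 x) (∑ᴸ≤length f≤1 xs)

      -- The data arrays admit only values between 0 and 1, and the averages of fat nodes are stored
      -- there. The member of `xs` makes the length invertible.
      mean-∈[0,1] : (∀ x → 0# ≤ f x) → (∀ x → f x ≤ 1#) → ∀ {x} xs → x ∈ xs →
                    0# ≤ mean xs × mean xs ≤ 1#
      mean-∈[0,1] 0≤f f≤1 xs@(_ ∷ ys) _ =
        *-nonNegative (∑ᴸ-nonNegative 0≤f xs) 0≤len⁻¹ ,
        ≤-respʳ (*-inverseʳ _ len≉0) (*-monoʳ-≤ 0≤len⁻¹ (∑ᴸ≤length f≤1 xs))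
        where
        len≉0 : ¬ (fromℕ (length xs) ≈ 0#)
        len≉0 = fromℕ-suc≉0 (length ys)
        0≤len⁻¹ : 0# ≤ fromℕ (length xs) ⁻¹
        0≤len⁻¹ = ⁻¹-nonNegative (0≤fromℕ (length xs)) len≉0

      maximum : ∀ {x} xs → x ∈ xs → ∃[ y ] y ∈ xs × (∀ {x} → x ∈ xs → f x ≤ f y)
      maximum (x ∷ [])         _ = x , here ≡.refl , λ { (here ≡.refl) → ≤.refl }
      maximum (x ∷ xs@(_ ∷ _)) _ with maximum xs (here ≡.refl)
      ... | y , y∈ , max with ≤.total (f x) (f y)
      ...   | inj₁ fx≤fy = y , there y∈ , λ { (here ≡.refl) → fx≤fy ; (there x∈) → max x∈ }
      ...   | inj₂ fy≤fx = x , here ≡.refl , λ { (here ≡.refl) → ≤.refl ; (there x∈) → ≤.trans (max x∈) fy≤fx }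

-- Colouring the strings of a trie with prescribed demands.

module Colouring where

  open Counting
  open import Data.Fin.Base using (Fin; zero; suc)
  import Data.Fin.Properties as Fin
  open import Data.List.Base using (List; []; _∷_; _∷ʳ_; allFin; length)
  open import Data.List.Membership.Propositional.Properties using (∈-allFin)
  open import Data.Maybe.Base using (Maybe; just; nothing; _<∣>_)
  open import Data.Maybe.Properties using (≡-dec)
  open import Data.Nat.Base
  open import Data.Nat.Properties
  open import Data.Product.Base using (_×_; _,_; proj₁; proj₂; ∃-syntax)
  open import Data.Unit.Base using (⊤; tt)
  open import Function.Base using (_∘_)
  open OrderedField using (∑-allFin-suc)
  open import Relation.Binary.PropositionalEquality
  open import Relation.Nullary using (Dec; yes; no)
  open import Relation.Nullary.Decidable using (_×-dec_)

  module _ {σ : ℕ} where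

    -- Strings are total functions, so that passing to the subtree below a first letter is
    -- composition with `suc`.
    Agree : List (Fin σ) → (ℕ → Fin σ) → Set
    Agree []      f = ⊤
    Agree (x ∷ Y) f = f 0 ≡ x × Agree Y (f ∘ suc)

    agree? : ∀ Y f → Dec (Agree Y f)
    agree? []      f = yes tt
    agree? (x ∷ Y) f = (f 0 Fin.≟ x) ×-dec agree? Y (f ∘ suc)

    infix 4 _≟ᴹ_
    _≟ᴹ_ : (x y : Maybe (Fin σ)) → Dec (x ≡ y)
    _≟ᴹ_ = ≡-dec Fin._≟_

    #_⟨_⟩ : ∀ {K} → (Fin K → Maybe (Fin σ)) → Fin σ → ℕ
    #_⟨_⟩ {K} col c = ∑ (allFin K) (λ j → ind (col j ≟ᴹ just c))

    -- Greedy: each free index takes any colour that is still in demand. As there are at least as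
    -- many free indices as demands, every demand is met exactly, and the remaining indices stay
    -- uncoloured.
    fill : ∀ K {Free : Fin K → Set} (free? : ∀ j → Dec (Free j)) (δ : Fin σ → ℕ) →
           ∑ (allFin σ) δ ≤ ∑ (allFin K) (λ j → ind (free? j)) →
           ∃[ new ] (∀ {j c} → new j ≡ just c → Free j) × (∀ c → # new ⟨ c ⟩ ≡ δ c)
    fill zero    free? δ le = (λ ()) , (λ { {()} }) , λ c → sym (n≤0⇒n≡0 (≤-trans (∈⇒≤∑ δ (∈-allFin c)) le))
    fill (suc K) {Free} free? δ le with free? zero | subst (∑ (allFin σ) δ ≤_) (∑-allFin-suc K _) le
    ... | no ¬free | le₁ with fill K (free? ∘ suc) δ le₁
    ...   | new , sound , exact = new′ , (λ {j} → sound′ {j}) , λ c → trans (∑-allFin-suc K (λ j → ind (new′ j ≟ᴹ just c))) (exact c)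
      where
      new′ : Fin (suc K) → Maybe (Fin σ)
      new′ zero    = nothing
      new′ (suc j) = new j
      sound′ : ∀ {j c} → new′ j ≡ just c → Free j
      sound′ {suc j} = sound {j}
    fill (suc K) {Free} free? δ le | yes free | le₁ with Fin.any? (λ c → 0 <? δ c)
    ... | no none = (λ _ → nothing) , (λ ()) , λ c →
            trans (trans (∑-const (allFin (suc K)) 0) (*-zeroʳ (length (allFin (suc K)))))
                  (sym (n≤0⇒n≡0 (≮⇒≥ (λ δc>0 → none (c , δc>0)))))
    ... | yes (c₀ , δc₀>0) with fill K (free? ∘ suc) δ′ le′
      where
      δ′ : Fin σ → ℕ
      δ′ c = δ c ∸ ind (c₀ Fin.≟ c)
      δ≡ : ∀ c → δ c ≡ ind (c₀ Fin.≟ c) + δ′ c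
      δ≡ c with c₀ Fin.≟ c
      ... | no _     = refl
      ... | yes refl = sym (m+[n∸m]≡n δc₀>0)
      le′ : ∑ (allFin σ) δ′ ≤ ∑ (allFin K) (λ j → ind (free? (suc j)))
      le′ = +-cancelˡ-≤ 1 _ _ (begin
        1 + ∑ (allFin σ) δ′
          ≤⟨ +-monoˡ-≤ _ (≤-trans (≤-reflexive (sym (ind-yes (c₀ Fin.≟ c₀) refl))) (∈⇒≤∑ _ (∈-allFin c₀))) ⟩
        ∑ (allFin σ) (λ c → ind (c₀ Fin.≟ c)) + ∑ (allFin σ) δ′
          ≡⟨ ∑-+ (allFin σ) (λ c → ind (c₀ Fin.≟ c)) δ′ ⟨
        ∑ (allFin σ) (λ c → ind (c₀ Fin.≟ c) + δ′ c)
          ≡⟨ ∑-cong (allFin σ) (λ {c} _ → sym (δ≡ c)) ⟩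
        ∑ (allFin σ) δ
          ≤⟨ le₁ ⟩
        1 + ∑ (allFin K) (λ j → ind (free? (suc j))) ∎)
        where open ≤-Reasoning
    ...   | new , sound , exact = new′ , (λ {j} → sound′ {j}) , exact′
      where
      new′ : Fin (suc K) → Maybe (Fin σ)
      new′ zero    = just c₀
      new′ (suc j) = new j
      sound′ : ∀ {j c} → new′ j ≡ just c → Free j
      sound′ {zero}  _ = free
      sound′ {suc j} = sound {j}
      exact′ : ∀ c → # new′ ⟨ c ⟩ ≡ δ c
      exact′ c = trans (∑-allFin-suc K (λ j → ind (new′ j ≟ᴹ just c))) (trans (cong (ind (just c₀ ≟ᴹ just c) +_) (exact c)) lemma)
        where
        lemma : ind (just c₀ ≟ᴹ just c) + (δ c ∸ ind (c₀ Fin.≟ c)) ≡ δ c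
        lemma with c₀ Fin.≟ c
        ... | no _     = refl
        ... | yes refl = m+[n∸m]≡n δc₀>0

    -- Each coloured index uses up one unit of demand, so the uncoloured members of `U` suffice for
    -- the rest. Colours once given are kept; whatever has been achieved deeper in the trie
    -- therefore survives.
    complete : ∀ {K} {U : Fin K → Set} (U? : ∀ j → Dec (U j)) (B : Fin K → ℕ → Fin σ)
               (need : Fin σ → ℕ) (col₀ : Fin K → Maybe (Fin σ)) →
               (∀ {j c} → col₀ j ≡ just c → U j) →
               (∀ c → # col₀ ⟨ c ⟩ ≤ need c) →
               ∑ (allFin σ) need ≤ ∑ (allFin K) (λ j → ind (U? j)) →
               ∃[ col ] (∀ {j c} → col j ≡ just c → U j) × (∀ c → # col ⟨ c ⟩ ≡ need c) ×
                 (∀ {j c} → col₀ j ≡ just c → col j ≡ just c)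
    complete {K} {U} U? B need col₀ sound₀ below room
      with fill K (λ j → U? j ×-dec (col₀ j ≟ᴹ nothing)) (λ c → need c ∸ # col₀ ⟨ c ⟩) le
      where
      open ≤-Reasoning
      free coloured : Fin K → ℕ
      free j = ind (U? j ×-dec (col₀ j ≟ᴹ nothing))
      coloured j = ∑ (allFin σ) (λ c → ind (col₀ j ≟ᴹ just c))
      split : ∀ j → ind (U? j) ≤ free j + coloured j
      split j with U? j | col₀ j
      ... | no _  | _       = z≤n
      ... | yes _ | nothing = s≤s z≤n
      ... | yes _ | just c  = ≤-trans (≤-reflexive (sym (ind-yes (just c ≟ᴹ just c) refl)))
                                (∈⇒≤∑ (λ c′ → ind (just c ≟ᴹ just c′)) (∈-allFin c))
      le : ∑ (allFin σ) (λ c → need c ∸ # col₀ ⟨ c ⟩) ≤ ∑ (allFin K) free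
      le = +-cancelʳ-≤ (∑ (allFin σ) # col₀ ⟨_⟩) _ _ (begin
        ∑ (allFin σ) (λ c → need c ∸ # col₀ ⟨ c ⟩) + ∑ (allFin σ) # col₀ ⟨_⟩
          ≡⟨ ∑-+ (allFin σ) _ _ ⟨
        ∑ (allFin σ) (λ c → (need c ∸ # col₀ ⟨ c ⟩) + # col₀ ⟨ c ⟩)
          ≡⟨ ∑-cong (allFin σ) (λ {c} _ → m∸n+n≡m (below c)) ⟩
        ∑ (allFin σ) need
          ≤⟨ room ⟩
        ∑ (allFin K) (λ j → ind (U? j))
          ≤⟨ ∑-mono (allFin K) (λ {j} _ → split j) ⟩
        ∑ (allFin K) (λ j → free j + coloured j)
          ≡⟨ ∑-+ (allFin K) free coloured ⟩
        ∑ (allFin K) free + ∑ (allFin K) coloured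
          ≡⟨ cong (∑ (allFin K) free +_) (∑-swap (allFin K) (allFin σ) (λ j c → ind (col₀ j ≟ᴹ just c))) ⟩
        ∑ (allFin K) free + ∑ (allFin σ) # col₀ ⟨_⟩ ∎)
    ... | new , sound , exact = (λ j → col₀ j <∣> new j) , (λ {j} → sound′ {j}) , exact′ , (λ {j} → keeps {j})
      where
      sound′ : ∀ {j c} → (col₀ j <∣> new j) ≡ just c → U j
      sound′ {j} eq with col₀ j in col₀j
      ... | just _  = sound₀ col₀j
      ... | nothing = proj₁ (sound eq)
      keeps : ∀ {j c} → col₀ j ≡ just c → (col₀ j <∣> new j) ≡ just c
      keeps {j} eq rewrite eq = refl
      pointwise : ∀ c j → ind ((col₀ j <∣> new j) ≟ᴹ just c) ≡ ind (col₀ j ≟ᴹ just c) + ind (new j ≟ᴹ just c)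
      pointwise c j with col₀ j in col₀j | new j in newj
      ... | nothing | nothing = refl
      ... | nothing | just _  = refl
      ... | just _  | nothing = sym (+-identityʳ _)
      ... | just _  | just _ with trans (sym col₀j) (proj₂ (sound newj))
      ...   | ()
      exact′ : ∀ c → # (λ j → col₀ j <∣> new j) ⟨ c ⟩ ≡ need c
      exact′ c = trans (∑-cong (allFin K) (λ {j} _ → pointwise c j))
        (trans (∑-+ (allFin K) _ _) (trans (cong (# col₀ ⟨ c ⟩ +_) (exact c)) (m+[n∸m]≡n (below c))))

    -- Only the node itself has its demand met exactly: its parent adds these numbers up. Strictly
    -- below, lower bounds are enough, and these persist when further strings are coloured.
    record Colouring (r : ℕ) {K : ℕ} {U : Fin K → Set} (U? : ∀ j → Dec (U j)) (B : Fin K → ℕ → Fin σ)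
                     (need : List (Fin σ) → Fin σ → ℕ) : Set where
      field
        col      : Fin K → Maybe (Fin σ)
        sound    : ∀ {j c} → col j ≡ just c → U j
        exact    : ∀ c → # col ⟨ c ⟩ ≡ need [] c
        suffices : ∀ Y c → length Y ≤ r →
                   need Y c ≤ ∑ (allFin K) (λ j → ind ((col j ≟ᴹ just c) ×-dec agree? Y (B j)))

    open Colouring

    module _ {K : ℕ} {U : Fin K → Set} (U? : ∀ j → Dec (U j)) (B : Fin K → ℕ → Fin σ)
             (need : List (Fin σ) → Fin σ → ℕ)
             (super : ∀ Y c → ∑ (allFin σ) (λ d → need (Y ∷ʳ d) c) ≤ need Y c)
             (room : ∑ (allFin σ) (need []) ≤ ∑ (allFin K) (λ j → ind (U? j ×-dec yes tt))) where

      private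
        room-here : ∑ (allFin σ) (need []) ≤ ∑ (allFin K) (λ j → ind (U? j))
        room-here = ≤-trans room (∑-mono (allFin K) (λ {j} _ → ind-mono (U? j ×-dec yes tt) (U? j) proj₁))

        suffices-[] : ∀ {col} c → # col ⟨ c ⟩ ≡ need [] c →
                      need [] c ≤ ∑ (allFin K) (λ j → ind ((col j ≟ᴹ just c) ×-dec yes tt))
        suffices-[] {col} c exact = ≤-trans (≤-reflexive (sym exact)) (∑-mono (allFin K)
          (λ {j} _ → ind-mono (col j ≟ᴹ just c) ((col j ≟ᴹ just c) ×-dec yes tt) (_, tt)))

      colour-leaf : Colouring 0 U? B need
      colour-leaf with complete U? B (need []) (λ _ → nothing) (λ ())
        (λ c → ≤-trans (≤-reflexive (trans (∑-const (allFin K) 0) (*-zeroʳ (length (allFin K))))) z≤n) room-here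
      ... | col , sound , exact , _ = record
        { col = col ; sound = λ {j} → sound {j} ; exact = exact
        ; suffices = λ { [] c _ → suffices-[] c (exact c) } }

      child? : ∀ d j → Dec (U j × B j 0 ≡ d)
      child? d j = U? j ×-dec (B j 0 Fin.≟ d)

      -- A string is coloured as the child selected by its first letter prescribes. Every colour is
      -- then used as often as the children demand together, which superadditivity keeps within the
      -- demand of the node, and `complete` adds what is missing.
      colour-node : ∀ {r} → (∀ d → Colouring r (child? d) (λ j → B j ∘ suc) (λ Y → need (d ∷ Y))) →
                    Colouring (suc r) U? B need
      colour-node {r} children
        with complete U? B (need []) (λ j → col (children (B j 0)) j)
               (λ {j} eq → proj₁ (sound (children (B j 0)) {j} eq)) below room-here
        where
        open ≤-Reasoning
        below : ∀ c → # (λ j → col (children (B j 0)) j) ⟨ c ⟩ ≤ need [] c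
        below c = begin
          # (λ j → col (children (B j 0)) j) ⟨ c ⟩
            ≤⟨ ∑-mono (allFin K) (λ {j} _ → ∈⇒≤∑ (λ d → ind (col (children d) j ≟ᴹ just c)) (∈-allFin (B j 0))) ⟩
          ∑ (allFin K) (λ j → ∑ (allFin σ) (λ d → ind (col (children d) j ≟ᴹ just c)))
            ≡⟨ ∑-swap (allFin K) (allFin σ) (λ j d → ind (col (children d) j ≟ᴹ just c)) ⟩
          ∑ (allFin σ) (λ d → # col (children d) ⟨ c ⟩)
            ≡⟨ ∑-cong (allFin σ) (λ {d} _ → exact (children d) c) ⟩
          ∑ (allFin σ) (λ d → need (d ∷ []) c)
            ≤⟨ super [] c ⟩
          need [] c ∎
      ... | col′ , sound′ , exact′ , keeps = record
        { col = col′ ; sound = λ {j} → sound′ {j} ; exact = exact′ ; suffices = suffices′ }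
        where
        kept : ∀ d {j c} → col (children d) j ≡ just c → col′ j ≡ just c
        kept d {j} {c} eq =
          keeps (subst (λ d′ → col (children d′) j ≡ just c) (sym (proj₂ (sound (children d) {j} eq))) eq)
        suffices′ : ∀ Y c → length Y ≤ suc r →
                    need Y c ≤ ∑ (allFin K) (λ j → ind ((col′ j ≟ᴹ just c) ×-dec agree? Y (B j)))
        suffices′ []      c _        = suffices-[] c (exact′ c)
        suffices′ (d ∷ Y) c (s≤s le) = ≤-trans (suffices (children d) Y c le)
          (∑-mono (allFin K) (λ {j} _ → ind-mono
            ((col (children d) j ≟ᴹ just c) ×-dec agree? Y (B j ∘ suc))
            ((col′ j ≟ᴹ just c) ×-dec agree? (d ∷ Y) (B j))
            (λ (eq , t) → kept d eq , proj₂ (sound (children d) {j} eq) , t)))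

    -- The strings B j form a trie whose nodes Y demand need Y c strings of
    -- colour c.  The children of a node are coloured first; a superadditive
    -- demand leaves each node enough uncoloured strings to meet its own.
    colour : ∀ r {K} {U : Fin K → Set} (U? : ∀ j → Dec (U j)) (B : Fin K → ℕ → Fin σ)
             (need : List (Fin σ) → Fin σ → ℕ) →
             (∀ Y c → ∑ (allFin σ) (λ d → need (Y ∷ʳ d) c) ≤ need Y c) →
             (∀ Y → length Y ≤ r → ∑ (allFin σ) (need Y) ≤ ∑ (allFin K) (λ j → ind (U? j ×-dec agree? Y (B j)))) →
             Colouring r U? B need
    colour zero    U? B need super room = colour-leaf U? B need super (room [] z≤n)
    colour (suc r) {K} U? B need super room = colour-node U? B need super (room [] z≤n) (λ d →
      colour r (child? U? B need super (room [] z≤n) d) (λ j → B j ∘ suc) (λ Y → need (d ∷ Y)) (λ Y → super (d ∷ Y))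
        (λ Y le → ≤-trans (room (d ∷ Y) (s≤s le)) (∑-mono (allFin K) (λ {j} _ → ind-mono
          (U? j ×-dec agree? (d ∷ Y) (B j)) ((U? j ×-dec (B j 0 Fin.≟ d)) ×-dec agree? Y (B j ∘ suc))
          (λ (u , h , t) → (u , h) , t)))))

-- Finitely many strings that contain all solid windows.

module Estimation where

  import Algebra.Properties.Semiring.Sum
  open Colouring
  open Counting
  open import Data.Empty using (⊥-elim)
  open import Data.Fin.Base using (Fin; zero; suc; toℕ)
  open import Data.List.Base using (List; []; _∷_; _∷ʳ_; allFin; length; applyUpTo)
  open import Data.List.Properties using (length-tabulate)
  open import Data.Maybe.Base using (Maybe; just; fromMaybe)
  open import Data.Nat.Base as ℕ using (ℕ; zero; suc)
  import Data.Nat.Properties as ℕ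
  open import Data.Product.Base using (_×_; _,_; proj₁; proj₂; ∃-syntax)
  open import Data.Unit.Base using (tt)
  open import Data.Vec.Base using (Vec; []; _∷_; toList; lookup)
  open import Defs
  open import Function.Base using (_∘_)
  open OrderedField
  open import Relation.Binary.PropositionalEquality as ≡ using (_≡_)
  open import Relation.Nullary using (Dec; yes; no; ¬_)
  open import Relation.Nullary.Decidable using (_×-dec_)

  ∃-ind : ∀ {a p} {A : Set a} {P : A → Set p} (P? : ∀ x → Dec (P x)) xs →
          0 ℕ.< ∑ xs (λ x → ind (P? x)) → ∃[ x ] P x
  ∃-ind P? (x ∷ xs) pos with P? x
  ... | yes px = x , px
  ... | no  _  = ∃-ind P? xs pos

  module _ {σ : ℕ} where

    agree⇒applyUpTo : ∀ {Y : List (Fin σ)} {f} → Agree Y f → applyUpTo f (length Y) ≡ Y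
    agree⇒applyUpTo {[]}    _          = ≡.refl
    agree⇒applyUpTo {x ∷ Y} (eq , agr) = ≡.cong₂ _∷_ eq (agree⇒applyUpTo agr)

    agree-snoc⁺ : ∀ {Y : List (Fin σ)} {x f} → Agree Y f → f (length Y) ≡ x → Agree (Y ∷ʳ x) f
    agree-snoc⁺ {[]}    _          eq  = eq , tt
    agree-snoc⁺ {y ∷ Y} (eq , agr) eq′ = eq , agree-snoc⁺ agr eq′

    agree-snoc⁻ : ∀ {Y : List (Fin σ)} {x f} → Agree (Y ∷ʳ x) f → Agree Y f × f (length Y) ≡ x
    agree-snoc⁻ {[]}    (eq , _)   = tt , eq
    agree-snoc⁻ {y ∷ Y} (eq , agr) with agree-snoc⁻ {Y} agr
    ... | agr′ , eq′ = (eq , agr′) , eq′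

  module Strings {c ℓ₁ ℓ₂} (F : ArchimedeanField c ℓ₁ ℓ₂)
                 {n σ : ℕ} (T : WeightedSequences.WeightedSequence F n σ)
                 (z : ArchimedeanField.Carrier F)
                 (1≤z : ArchimedeanField._≤_ F (ArchimedeanField.1# F) z) where
    open ArchimedeanField F
    open WeightedSequences F
    open WeightedSequence T
    open OrderedFieldProperties F
    private module Sum = Algebra.Properties.Semiring.Sum ≈.semiring

    0≤z : 0# ≤ z
    0≤z = ≤.trans 0≤1 1≤z

    z≉0 : ¬ (z ≈ 0#)
    z≉0 z≈0 = 1≰0 (≤-respʳ z≈0 1≤z)

    z⁻¹≤1 : z ⁻¹ ≤ 1#
    z⁻¹≤1 = ≤-respˡ (≈.*-identityʳ _) (≤-respʳ (≈.trans (≈.*-comm _ z) (*-inverseʳ z z≉0))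
      (*-monoˡ-≤ (⁻¹-nonNegative 0≤z z≉0) 1≤z))

    z⁻¹≤⇒1≤z* : ∀ {x} → z ⁻¹ ≤ x → 1# ≤ z * x
    z⁻¹≤⇒1≤z* z⁻¹≤x = ≤-respˡ (*-inverseʳ z z≉0) (*-monoˡ-≤ 0≤z z⁻¹≤x)

    z⁻¹≤⇒≉0 : ∀ {x} → z ⁻¹ ≤ x → ¬ (x ≈ 0#)
    z⁻¹≤⇒≉0 z⁻¹≤x x≈0 = 1≰0 (≤-respʳ (≈.trans (≈.*-congˡ x≈0) (≈.zeroʳ z)) (z⁻¹≤⇒1≤z* z⁻¹≤x))

    π : ℕ → Fin σ → Carrier
    π = letterProb T

    π-overrun : ∀ {k} a → n ℕ.≤ k → π k a ≡ 0#
    π-overrun {k} a n≤k with k ℕ.<? n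
    ... | yes k<n = ⊥-elim (ℕ.<⇒≱ k<n n≤k)
    ... | no  _   = ≡.refl

    0≤π : ∀ k a → 0# ≤ π k a
    0≤π k a with k ℕ.<? n
    ... | yes k<n = p-nonNeg _ a
    ... | no  _   = ≤.refl

    ∑π≤1 : ∀ k → sum (π k) ≤ 1#
    ∑π≤1 k with k ℕ.<? n
    ... | yes k<n = ≤.reflexive (p-sum _)
    ... | no  _   = ≤-respˡ (≈.sym (Sum.sum-replicate-zero σ)) 0≤1

    π≤1 : ∀ k a → π k a ≤ 1#
    π≤1 k a = ≤.trans (≤sum (π k) (0≤π k) a) (∑π≤1 k)

    Π : ℕ → List (Fin σ) → Carrier
    Π i []      = 1#
    Π i (a ∷ Y) = π i a * Π (suc i) Y

    0≤Π : ∀ i Y → 0# ≤ Π i Y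
    0≤Π i []      = 0≤1
    0≤Π i (a ∷ Y) = *-nonNegative (0≤π i a) (0≤Π (suc i) Y)

    Π≤1 : ∀ i Y → Π i Y ≤ 1#
    Π≤1 i []      = ≤.refl
    Π≤1 i (a ∷ Y) = x*y≤1 (0≤π i a) (π≤1 i a) (Π≤1 (suc i) Y)

    Π-snoc : ∀ i Y a → Π i (Y ∷ʳ a) ≈ Π i Y * π (i ℕ.+ length Y) a
    Π-snoc i []      a = ≈.trans (≈.*-comm _ _)
      (≈.*-congˡ (≈.reflexive (≡.cong (λ k → π k a) (≡.sym (ℕ.+-identityʳ i)))))
    Π-snoc i (b ∷ Y) a = ≈.trans (≈.*-congˡ (≈.trans (Π-snoc (suc i) Y a)
        (≈.*-congˡ (≈.reflexive (≡.cong (λ k → π k a) (≡.sym (ℕ.+-suc i (length Y))))))))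
      (≈.sym (≈.*-assoc (π i b) _ _))

    Π-overrun : ∀ {i} Y → i ℕ.≤ n → n ℕ.< i ℕ.+ length Y → Π i Y ≈ 0#
    Π-overrun {i} []      i≤n over = ⊥-elim (ℕ.<⇒≱ over (ℕ.≤-trans (ℕ.≤-reflexive (ℕ.+-identityʳ i)) i≤n))
    Π-overrun {i} (a ∷ Y) i≤n over with i ℕ.<? n
    ... | no  i≮n = ≈.zeroˡ _
    ... | yes i<n = ≈.trans (≈.*-congˡ (Π-overrun Y i<n (≡.subst (n ℕ.<_) (ℕ.+-suc i (length Y)) over))) (≈.zeroʳ _)

    solid⇒inside : ∀ {i} Y → i ℕ.≤ n → z ⁻¹ ≤ Π i Y → i ℕ.+ length Y ℕ.≤ n
    solid⇒inside Y i≤n solid = ℕ.≮⇒≥ (λ over → z⁻¹≤⇒≉0 solid (Π-overrun Y i≤n over))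

    product≈Π : ∀ {m} (P : Vec (Fin σ) m) k → product (λ j → π (k ℕ.+ toℕ j) (lookup P j)) ≈ Π k (toList P)
    product≈Π []      k = ≈.refl
    product≈Π (a ∷ P) k = ≈.*-cong (≈.reflexive (≡.cong (λ i → π i a) (ℕ.+-identityʳ k)))
      (≈.trans (product-cong (λ j → ≡.cong (λ i → π i (lookup P j)) (ℕ.+-suc k (toℕ j)))) (product≈Π P (suc k)))
      where
      product-cong : ∀ {m} {f g : Fin m → Carrier} → (∀ j → f j ≡ g j) → product f ≈ product g
      product-cong {zero}  _  = ≈.refl
      product-cong {suc m} eq = ≈.*-cong (≈.reflexive (eq zero)) (product-cong (eq ∘ suc))

    Prob≈Π : ∀ {m} (P : Vec (Fin σ) m) i → Prob T P i ≈ Π (toℕ i) (toList P)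
    Prob≈Π P i = product≈Π P (toℕ i)

    -- Floors are superadditive and the letter probabilities of a position sum to at most 1. Used
    -- both for appending a letter to a window and for putting one in front of it.
    ⌊⌋-split : ∀ k x (y : Fin σ → Carrier) → 0# ≤ x → (∀ a → y a ≈ x * π k a) →
               ∑ (allFin σ) (λ a → ⌊ y a ⌋) ℕ.≤ ⌊ x ⌋
    ⌊⌋-split k x y 0≤x eq = ≤⌊⌋ (≤.trans
      (fromℕ-∑ (λ a → ⌊ y a ⌋) (λ a → x * π k a) (λ a → ≤-respʳ (eq a) (fromℕ⌊⌋≤ (≤-respʳ (≈.sym (eq a))
        (*-nonNegative 0≤x (0≤π k a))))))
      (≤-respˡ (Sum.*-distribˡ-sum x (π k)) (x*y≤x 0≤x (∑π≤1 k))))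

    K : ℕ
    K = ⌊ z ⌋

    -- A one-sided form of the z-estimations of the literature, in which the number
    -- of occurrences of Y at i is exactly ⌊ z * Π i Y ⌋.
    module _ (a₀ : Fin σ) where

      -- The strings describe the positions from `i` on: S j k is the letter at i + k. Windows
      -- longer than `n` never matter, and the bound on the length makes the trie to be coloured
      -- finite.
      Estimates : (Fin K → ℕ → Fin σ) → ℕ → Set
      Estimates S i = ∀ k Y → length Y ℕ.≤ n →
        ⌊ z * Π (i ℕ.+ k) Y ⌋ ℕ.≤ ∑ (allFin K) (λ j → ind (agree? Y (λ t → S j (k ℕ.+ t))))

      private
        estimates-[] : ∀ x → x ≈ 1# → ⌊ z * x ⌋ ℕ.≤ ∑ (allFin K) (λ j → 1)
        estimates-[] x x≈1 = ℕ.≤-reflexive (≡.trans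
          (⌊⌋-cong (≤-respʳ (≈.sym zx≈z) 0≤z) zx≈z)
          (≡.sym (≡.trans (∑-const (allFin K) 1) (≡.trans (ℕ.*-identityʳ _) (length-tabulate {n = K} (λ j → j))))))
          where
          zx≈z : z * x ≈ z
          zx≈z = ≈.trans (≈.*-congˡ x≈1) (≈.*-identityʳ z)

        estimates-overrun : ∀ {i} → n ℕ.≤ i → Estimates (λ _ _ → a₀) i
        estimates-overrun n≤i k []      _ = estimates-[] 1# ≈.refl
        estimates-overrun {i} n≤i k (a ∷ Y) _ = ℕ.≤-trans (ℕ.≤-reflexive ⌊⌋≡0) ℕ.z≤n
          where
          zero-prob : z * (π (i ℕ.+ k) a * Π (suc (i ℕ.+ k)) Y) ≈ 0#
          zero-prob = ≈.trans (≈.*-congˡ (≈.trans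
            (≈.*-congʳ (≈.reflexive (π-overrun a (ℕ.≤-trans n≤i (ℕ.m≤m+n i k))))) (≈.zeroˡ _))) (≈.zeroʳ z)
          0≤lhs : 0# ≤ z * (π (i ℕ.+ k) a * Π (suc (i ℕ.+ k)) Y)
          0≤lhs = ≤.reflexive (≈.sym zero-prob)
          ⌊⌋≡0 : ⌊ z * (π (i ℕ.+ k) a * Π (suc (i ℕ.+ k)) Y) ⌋ ≡ 0
          ⌊⌋≡0 = ℕ.n≤0⇒n≡0 (fromℕ-cancel {n = 0} (≤-respʳ zero-prob (fromℕ⌊⌋≤ 0≤lhs)))

      -- The colour of a string is the letter put in front of it at position `i`. A node Y must have
      -- ⌊ z * Π i (a ∷ Y) ⌋ strings of colour a; this demand is superadditive when Y is prolonged,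
      -- and over all a it does not exceed ⌊ z * Π (suc i) Y ⌋, the number of strings guaranteed at
      -- Y.
      extend : ∀ {i} S → Estimates S (suc i) → ∃[ S′ ] Estimates S′ i
      extend {i} S est = S′ , est′
        where
        0≤z*Π : ∀ k Y → 0# ≤ z * Π k Y
        0≤z*Π k Y = *-nonNegative 0≤z (0≤Π k Y)
        need : List (Fin σ) → Fin σ → ℕ
        need Y a = ⌊ z * Π i (a ∷ Y) ⌋
        super : ∀ Y a → ∑ (allFin σ) (λ d → need (Y ∷ʳ d) a) ℕ.≤ need Y a
        super Y a = ⌊⌋-split (suc i ℕ.+ length Y) (z * Π i (a ∷ Y)) (λ d → z * Π i (a ∷ (Y ∷ʳ d))) (0≤z*Π i (a ∷ Y))
          (λ d → ≈.trans (≈.*-congˡ (≈.trans (≈.*-congˡ (Π-snoc (suc i) Y d)) (≈.sym (≈.*-assoc _ _ _))))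
                   (≈.sym (≈.*-assoc _ _ _)))
        demand≤ : ∀ Y → ∑ (allFin σ) (need Y) ℕ.≤ ⌊ z * Π (suc i) Y ⌋
        demand≤ Y = ⌊⌋-split i (z * Π (suc i) Y) (λ a → z * Π i (a ∷ Y)) (0≤z*Π (suc i) Y)
          (λ a → ≈.trans (≈.*-congˡ (≈.*-comm _ _)) (≈.sym (≈.*-assoc _ _ _)))
        count : List (Fin σ) → (Fin K → ℕ → Fin σ) → ℕ
        count Y B = ∑ (allFin K) (λ j → ind (agree? Y (B j)))
        room : ∀ Y → length Y ℕ.≤ n → ∑ (allFin σ) (need Y) ℕ.≤ ∑ (allFin K) (λ j → ind (yes tt ×-dec agree? Y (S j)))
        room Y ≤n = ℕ.≤-trans (demand≤ Y) (ℕ.≤-trans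
          (≡.subst (λ k → ⌊ z * Π k Y ⌋ ℕ.≤ count Y S) (ℕ.+-identityʳ (suc i)) (est 0 Y ≤n))
          (∑-mono (allFin K) (λ {j} _ → ind-mono (agree? Y (S j)) (yes tt ×-dec agree? Y (S j)) (tt ,_))))
        coloured : Colouring n (λ _ → yes tt) S need
        coloured = colour n (λ _ → yes tt) S need super room
        col : Fin K → Maybe (Fin σ)
        col = Colouring.col coloured
        S′ : Fin K → ℕ → Fin σ
        -- Uncoloured strings receive an arbitrary letter. This can only add occurrences, and
        -- `Estimates` asks for lower bounds.
        S′ j zero    = fromMaybe a₀ (col j)
        S′ j (suc t) = S j t
        est′ : Estimates S′ i
        est′ zero    []      _  = estimates-[] 1# ≈.refl
        est′ zero    (a ∷ Y) <n = ≡.subst (λ k → ⌊ z * Π k (a ∷ Y) ⌋ ℕ.≤ count (a ∷ Y) S′) (≡.sym (ℕ.+-identityʳ i))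
          (ℕ.≤-trans (Colouring.suffices coloured Y a (ℕ.<⇒≤ <n)) (∑-mono (allFin K) (λ {j} _ → ind-mono
            ((col j ≟ᴹ just a) ×-dec agree? Y (S j)) (agree? (a ∷ Y) (S′ j))
            (λ (eq , agr) → ≡.cong (fromMaybe a₀) eq , agr))))
        est′ (suc k) Y       ≤n = ≡.subst (λ k′ → ⌊ z * Π k′ Y ⌋ ℕ.≤ count Y (λ j t → S j (k ℕ.+ t)))
          (≡.sym (ℕ.+-suc i k)) (est k Y ≤n)

      estimation : ∀ r i → n ℕ.≤ i ℕ.+ r → ∃[ S ] Estimates S i
      estimation zero    i n≤i = (λ _ _ → a₀) , estimates-overrun (ℕ.≤-trans n≤i (ℕ.≤-reflexive (ℕ.+-identityʳ i)))
      estimation (suc r) i n≤i+r with estimation r (suc i) (ℕ.≤-trans n≤i+r (ℕ.≤-reflexive (ℕ.+-suc i r)))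
      ... | S , est = extend S est

      S : Fin K → ℕ → Fin σ
      S = proj₁ (estimation n 0 ℕ.≤-refl)

      -- A solid window has z * Π i Y at least 1, so the floor promises at least one string.
      S-complete : ∀ i Y → length Y ℕ.≤ n → z ⁻¹ ≤ Π i Y → ∃[ j ] Agree Y (λ t → S j (i ℕ.+ t))
      S-complete i Y ≤n solid = ∃-ind (λ j → agree? Y (λ t → S j (i ℕ.+ t))) (allFin K)
        (ℕ.≤-trans (≤⌊⌋ (≤-respˡ (≈.sym (≈.+-identityʳ 1#)) (z⁻¹≤⇒1≤z* solid)))
                   (proj₂ (estimation n 0 ℕ.≤-refl) i Y ≤n))

-- Binary decision trees that separate strings at branching depths.

module DecisionTree where

  open Colouring
  open import Data.Empty using (⊥-elim)
  open import Data.Fin.Base using (Fin; zero; suc; toℕ)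
  import Data.Fin.Properties as Fin
  open import Data.List.Base using (List; []; _∷_; _++_; _∷ʳ_; length; filter; lookup)
  open import Data.List.Membership.Propositional using (_∈_; find)
  open import Data.List.Membership.Propositional.Properties using (∈-filter⁺; ∈-filter⁻; ∈-++⁺ˡ; ∈-length)
  open import Data.List.Properties using (length-++)
  open import Data.List.Relation.Binary.Permutation.Propositional using (_↭_; ↭-refl; ↭-trans; prep)
  open import Data.List.Relation.Binary.Permutation.Propositional.Properties using (shift; ++⁺; ∈-resp-↭; ↭-length)
  open import Data.List.Relation.Unary.All as All using (All)
  open import Data.List.Relation.Unary.All.Properties using (¬All⇒Any¬)
  open import Data.List.Relation.Unary.Any using (here; there)
  open import Data.Maybe.Base using (Maybe; just; nothing)
  open import Data.Maybe.Properties using (just-injective)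
  open import Data.Nat.Base
  open import Data.Nat.Properties
  open import Data.Product.Base using (_×_; _,_; proj₂; ∃-syntax)
  open import Data.Sum.Base using (_⊎_; inj₁; inj₂; [_,_]′)
  open import Data.Unit.Base using (tt)
  open Estimation using (agree-snoc⁺; agree-snoc⁻)
  open import Function.Base using (_∘_)
  open import Relation.Binary.PropositionalEquality
  open import Relation.Nullary using (Dec; yes; no; ¬_)
  open import Relation.Nullary.Decidable using (¬?)
  open import Relation.Unary using (Pred; Decidable)

  least : ∀ {p} {Q : ℕ → Set p} (Q? : ∀ k → Dec (Q k)) n →
          (∀ {k} → k < n → Q k) ⊎ ∃[ h ] h < n × ¬ Q h × (∀ {k} → k < h → Q k)
  least Q? zero    = inj₁ (λ ())
  least Q? (suc n) with least Q? n
  ... | inj₂ (h , h<n , ¬q , below) = inj₂ (h , m<n⇒m<1+n h<n , ¬q , below)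
  ... | inj₁ all with Q? n
  ...   | no ¬q = inj₂ (n , ≤-refl , ¬q , all)
  ...   | yes q = inj₁ (λ k<1+n → [ all , (λ { refl → q }) ]′ (m<1+n⇒m<n∨m≡n k<1+n))

  filter-↭ : ∀ {a p} {A : Set a} {P : Pred A p} (P? : Decidable P) xs →
             filter P? xs ++ filter (¬? ∘ P?) xs ↭ xs
  filter-↭ P? []       = ↭-refl
  filter-↭ P? (x ∷ xs) with P? x
  ... | yes _ = prep x (filter-↭ P? xs)
  ... | no  _ = ↭-trans (shift x (filter P? xs) _) (prep x (filter-↭ P? xs))

  module _ {σ : ℕ} where

    -- The first ℓ letters of a function, continued by `nothing`. The end of a string thus acts as
    -- one more letter, and strings of different lengths can be told apart like any others.
    at : ℕ → (ℕ → Fin σ) → ℕ → Maybe (Fin σ)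
    at zero    f t       = nothing
    at (suc ℓ) f zero    = just (f 0)
    at (suc ℓ) f (suc t) = at ℓ (f ∘ suc) t

    at-< : ∀ {ℓ t} f → t < ℓ → at ℓ f t ≡ just (f t)
    at-< {suc ℓ} {zero}  f _         = refl
    at-< {suc ℓ} {suc t} f (s≤s t<ℓ) = at-< (f ∘ suc) t<ℓ

    at-≥ : ∀ {ℓ t} f → ℓ ≤ t → at ℓ f t ≡ nothing
    at-≥ {zero}          f _         = refl
    at-≥ {suc ℓ} {suc t} f (s≤s ℓ≤t) = at-≥ (f ∘ suc) ℓ≤t

    agree⇒at : ∀ {Y ℓ} f → length Y ≤ ℓ → Agree Y f → ∀ i → at ℓ f (toℕ i) ≡ just (lookup Y i)
    agree⇒at {x ∷ Y} f (s≤s le) (eq , agr) zero    = cong just eq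
    agree⇒at {x ∷ Y} f (s≤s le) (eq , agr) (suc i) = agree⇒at (f ∘ suc) le agr i

    at⇒agree : ∀ Y {ℓ} f → (∀ i → at ℓ f (toℕ i) ≡ just (lookup Y i)) → length Y ≤ ℓ × Agree Y f
    at⇒agree []      f _  = z≤n , tt
    at⇒agree (x ∷ Y) {zero}  f eq with eq zero
    ... | ()
    at⇒agree (x ∷ Y) {suc ℓ} f eq with at⇒agree Y (f ∘ suc) (λ i → eq (suc i))
    ... | le , agr = s≤s le , just-injective (eq zero) , agr

  -- Leaves are abstract: len e and seq e describe the string of the leaf e.
  module Trees {σ : ℕ} {L : Set} (len : L → ℕ) (seq : L → ℕ → Fin σ) where

    letter : L → ℕ → Maybe (Fin σ)
    letter e = at (len e) (seq e)

    Match : List (Fin σ) → L → Set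
    Match Y e = length Y ≤ len e × Agree Y (seq e)

    match⇒letter : ∀ {Y e} → Match Y e → ∀ i → letter e (toℕ i) ≡ just (lookup Y i)
    match⇒letter {e = e} (le , agr) = agree⇒at (seq e) le agr

    match-resp : ∀ {Y e e′} → (∀ {t} → t < length Y → letter e t ≡ letter e′ t) → Match Y e → Match Y e′
    match-resp {Y} {e} {e′} same m =
      at⇒agree Y (seq e′) (λ i → trans (sym (same (Fin.toℕ<n i))) (match⇒letter {Y} {e} m i))

    match-snoc⁺ : ∀ {Y x e} → Match Y e → letter e (length Y) ≡ just x → Match (Y ∷ʳ x) e
    match-snoc⁺ {Y} {x} {e} (le , agr) eq with length Y <? len e
    ... | yes lt = subst (_≤ len e) (sym (trans (length-++ Y) (+-comm (length Y) 1))) lt ,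
                   agree-snoc⁺ agr (just-injective (trans (sym (at-< (seq e) lt)) eq))
    ... | no ≮ with trans (sym eq) (at-≥ (seq e) (≮⇒≥ ≮))
    ...   | ()

    match-snoc⁻ : ∀ {Y x e} → Match (Y ∷ʳ x) e → Match Y e × letter e (length Y) ≡ just x
    match-snoc⁻ {Y} {x} {e} (le , agr) with agree-snoc⁻ {Y = Y} agr
    ... | agr′ , eq = (<⇒≤ lt , agr′) , trans (at-< (seq e) lt) (cong just eq)
      where
      lt : length Y < len e
      lt = subst (_≤ len e) (trans (length-++ Y) (+-comm (length Y) 1)) le

    -- A group collects leaves with equal strings. A split asks whether the letter at depth h is a;
    -- with two branches instead of one per letter, the number of nodes is linear in the number of
    -- leaves whatever the alphabet is.
    data Tree : Set where
      group : L → List L → Tree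
      split : ℕ → Fin σ → Tree → Tree → Tree

    leaves : Tree → List L
    leaves (group e es)    = e ∷ es
    leaves (split h a y n) = leaves y ++ leaves n

    nodes : Tree → ℕ
    nodes (group e es)    = 1
    nodes (split h a y n) = suc (nodes y + nodes n)

    Coherent : ℕ → List L → Set
    Coherent m E = ∀ {e e′} → e ∈ E → e′ ∈ E → ∀ {t} → t < m → letter e t ≡ letter e′ t

    -- The Patricia invariant: all leaves below a split agree before its depth. A pattern that ends
    -- before this depth may therefore treat the whole subtree as a single candidate.
    data Valid (n : ℕ) : Tree → Set where
      group : ∀ {e es} → (∀ m → Coherent m (e ∷ es)) → Valid n (group e es)
      split : ∀ {h a y t} → h < n → Coherent h (leaves y ++ leaves t) →
              (∀ {e} → e ∈ leaves y → letter e h ≡ just a) →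
              (∀ {e} → e ∈ leaves t → letter e h ≢ just a) →
              Valid n y → Valid n t → Valid n (split h a y t)

    head∈ : ∀ t → ∃[ e ] e ∈ leaves t
    head∈ (group e es)    = e , here refl
    head∈ (split h a y n) with head∈ y
    ... | e , e∈ = e , ∈-++⁺ˡ e∈

    0<leaves : ∀ t → 0 < length (leaves t)
    0<leaves t = ∈-length (proj₂ (head∈ t))

    nodes≤ : ∀ t → suc (nodes t) ≤ 2 * length (leaves t)
    nodes≤ (group e es)    = *-monoʳ-≤ 2 (s≤s z≤n)
    nodes≤ (split h a y n) = subst₂ _≤_ (cong suc (+-suc (nodes y) (nodes n)))
      (trans (sym (*-distribˡ-+ 2 (length (leaves y)) _)) (cong (2 *_) (sym (length-++ (leaves y)))))
      (+-mono-≤ (nodes≤ y) (nodes≤ n))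

    module _ {n : ℕ} (len≤n : ∀ e → len e ≤ n) where

      private
        -- A split can only test for a proper letter. Two entries that differ at h are not both
        -- `nothing`, so one of them provides such a letter and the other one lacks it.
        separate : ∀ {e es h} → ¬ All (λ e′ → letter e h ≡ letter e′ h) es →
                   ∃[ a ] ∃[ x ] ∃[ y ] x ∈ e ∷ es × y ∈ e ∷ es × letter x h ≡ just a × letter y h ≢ just a
        separate {e} {es} {h} ¬all with find (¬All⇒Any¬ (λ e′ → letter e h ≟ᴹ letter e′ h) es ¬all)
        ... | e′ , e′∈ , differ with letter e h in eq | letter e′ h in eq′
        ...   | just a  | _       = a , e , e′ , here refl , there e′∈ , eq , λ eq″ → differ (trans (sym eq″) eq′)
        ...   | nothing | just a  = a , e′ , e , there e′∈ , here refl , eq′ , λ eq″ → nothing≢just (trans (sym eq) eq″)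
          where
          nothing≢just : ∀ {b : Fin σ} → nothing ≢ just b
          nothing≢just ()
        ...   | nothing | nothing = ⊥-elim (differ refl)

      -- The split is made at the least depth at which some leaf differs from the head, which yields
      -- the invariant. `separate` puts a leaf on either side, so both parts are strictly smaller
      -- and the fuel lasts.
      build : ∀ fuel E {x} → x ∈ E → length E ≤ fuel → ∃[ t ] Valid n t × leaves t ↭ E
      build (suc fuel) E@(e ∷ es) _ len≤
        with least (λ h → All.all? (λ e′ → letter e h ≟ᴹ letter e′ h) es) n
      ... | inj₁ same = group e es , group (λ m → coherent) , ↭-refl
        where
        as-head : ∀ {e′} → e′ ∈ e ∷ es → ∀ t → letter e t ≡ letter e′ t
        as-head (here refl) t = refl
        as-head {e′} (there e′∈) t with t <? n
        ... | yes t<n = All.lookup (same t<n) e′∈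
        ... | no  t≮n = trans (at-≥ (seq e) (≤-trans (len≤n e) (≮⇒≥ t≮n)))
                              (sym (at-≥ (seq e′) (≤-trans (len≤n e′) (≮⇒≥ t≮n))))
        coherent : ∀ {m} → Coherent m (e ∷ es)
        coherent e₁∈ e₂∈ {t} _ = trans (sym (as-head e₁∈ t)) (as-head e₂∈ t)
      ... | inj₂ (h , h<n , ¬all , below) with separate ¬all
      ...   | a , x , y , x∈ , y∈ , x-a , y-¬a
        with build fuel (filter P? E) (∈-filter⁺ P? x∈ x-a) (≤-pred (≤-trans yes< len≤))
           | build fuel (filter (¬? ∘ P?) E) (∈-filter⁺ (¬? ∘ P?) y∈ y-¬a) (≤-pred (≤-trans no< len≤))
        where
        P? : Decidable (λ e′ → letter e′ h ≡ just a)
        P? e′ = letter e′ h ≟ᴹ just a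
        total : length (filter P? E) + length (filter (¬? ∘ P?) E) ≡ length E
        total = trans (sym (length-++ (filter P? E))) (↭-length (filter-↭ P? E))
        yes< : length (filter P? E) < length E
        yes< = subst (length (filter P? E) <_) total
          (m<m+n _ (∈-length (∈-filter⁺ (¬? ∘ P?) y∈ y-¬a)))
        no< : length (filter (¬? ∘ P?) E) < length E
        no< = subst (length (filter (¬? ∘ P?) E) <_) total
          (m<n+m _ (∈-length (∈-filter⁺ P? x∈ x-a)))
      ...     | ty , vy , py | tn , vn , pn = split h a ty tn ,
        split h<n coherent
          (λ e∈ → proj₂ (∈-filter⁻ P? {xs = E} (∈-resp-↭ py e∈)))
          (λ e∈ → proj₂ (∈-filter⁻ (¬? ∘ P?) {xs = E} (∈-resp-↭ pn e∈)))
          vy vn ,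
        perm
        where
        P? : Decidable (λ e′ → letter e′ h ≡ just a)
        P? e′ = letter e′ h ≟ᴹ just a
        perm : leaves ty ++ leaves tn ↭ E
        perm = ↭-trans (++⁺ py pn) (filter-↭ P? E)
        as-head : ∀ {e′ t} → t < h → e′ ∈ E → letter e t ≡ letter e′ t
        as-head t<h (here refl) = refl
        as-head t<h (there e′∈) = All.lookup (below t<h) e′∈
        coherent : Coherent h (leaves ty ++ leaves tn)
        coherent e₁∈ e₂∈ t<h = trans (sym (as-head t<h (∈-resp-↭ perm e₁∈))) (as-head t<h (∈-resp-↭ perm e₂∈))

-- Leaves, occurrences and prefix products.

module Leaves where

  open Colouring
  open Counting
  open DecisionTree
  open import Data.Empty using (⊥-elim)
  open import Data.Fin.Base using (Fin; zero; suc; toℕ)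
  import Data.Fin.Properties as Fin
  open import Data.List.Base as List using (List; []; _∷_; allFin; length; applyUpTo; cartesianProduct)
  open import Data.List.Membership.Propositional using (_∈_)
  open import Data.List.Membership.Propositional.Properties using (∈-allFin; ∈-filter⁺; ∈-filter⁻)
  open import Data.List.Properties using (length-++; length-applyUpTo; length-map)
  open import Data.Nat.Base as ℕ using (ℕ; zero; suc)
  import Data.Nat.Properties as ℕ
  open import Data.Product.Base using (_×_; _,_; proj₁; proj₂; ∃-syntax)
  open import Data.Unit.Base using (tt)
  open import Data.Vec.Base using (Vec; toList)
  open import Data.Vec.Properties using (length-toList)
  open import Defs
  open Estimation
  open import Function.Base using (_∘_)
  open OrderedField
  open import Relation.Binary.PropositionalEquality as ≡ using (_≡_)
  open import Relation.Nullary using (yes; no; ¬_)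

  length-cartesianProduct : ∀ {a b} {A : Set a} {B : Set b} (xs : List A) (ys : List B) →
                            length (cartesianProduct xs ys) ≡ length xs ℕ.* length ys
  length-cartesianProduct []       ys = ≡.refl
  length-cartesianProduct (x ∷ xs) ys = ≡.trans (length-++ (List.map (x ,_) ys))
    (≡.cong₂ ℕ._+_ (length-map (x ,_) ys) (length-cartesianProduct xs ys))

  module LeafStrings {c ℓ₁ ℓ₂} (F : ArchimedeanField c ℓ₁ ℓ₂)
                     {n σ : ℕ} (T : WeightedSequences.WeightedSequence F n σ)
                     (z : ArchimedeanField.Carrier F)
                     (1≤z : ArchimedeanField._≤_ F (ArchimedeanField.1# F) z)
                     (a₀ : Fin σ) where
    open ArchimedeanField F
    open WeightedSequences F
    open OrderedFieldProperties F
    open Strings F T z 1≤z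

    Leaf : Set
    Leaf = Fin K × Fin n

    pos : Leaf → Fin n
    pos = proj₂

    start : Leaf → ℕ
    start e = toℕ (pos e)

    str : Fin K → ℕ → Fin σ
    str = S a₀

    seq : Leaf → ℕ → Fin σ
    seq (j , i) t = str j (toℕ i ℕ.+ t)

    Π-antitone : ∀ {ℓ ℓ′} i f → ℓ ℕ.≤ ℓ′ → Π i (applyUpTo f ℓ′) ≤ Π i (applyUpTo f ℓ)
    Π-antitone {ℓ′ = ℓ′} i f ℕ.z≤n = Π≤1 i (applyUpTo f ℓ′)
    Π-antitone i f (ℕ.s≤s le) = *-monoˡ-≤ (0≤π i (f 0)) (Π-antitone (suc i) (f ∘ suc) le)

    private
      extent : ∀ e → ∃[ ℓ ] z ⁻¹ ≤ Π (start e) (applyUpTo (seq e) ℓ) ×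
               (∀ {j} → z ⁻¹ ≤ Π (start e) (applyUpTo (seq e) j) → j ℕ.≤ n → j ℕ.≤ ℓ)
      extent e = greatest (λ ℓ → z ⁻¹ ≤? Π (start e) (applyUpTo (seq e) ℓ)) n z⁻¹≤1

    -- The length of the longest solid factor of str j at i, for e = (j , i).
    len : Leaf → ℕ
    len e = proj₁ (extent e)

    open Trees len seq public

    start+len≤n : ∀ e → start e ℕ.+ len e ℕ.≤ n
    start+len≤n e = ≡.subst (λ ℓ → start e ℕ.+ ℓ ℕ.≤ n) (length-applyUpTo (seq e) (len e))
      (solid⇒inside (applyUpTo (seq e) (len e)) (ℕ.<⇒≤ (Fin.toℕ<n (pos e))) (proj₁ (proj₂ (extent e))))

    len≤n : ∀ e → len e ℕ.≤ n
    len≤n e = ℕ.≤-trans (ℕ.m≤n+m (len e) (start e)) (start+len≤n e)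

    match⇒solid : ∀ {Y e} → Match Y e → z ⁻¹ ≤ Π (start e) Y
    match⇒solid {Y} {e} (≤len , agr) = ≤-respʳ (≈.reflexive (≡.cong (Π (start e)) (agree⇒applyUpTo agr)))
      (≤.trans (proj₁ (proj₂ (extent e))) (Π-antitone (start e) (seq e) ≤len))

    solid⇒match : ∀ {Y} i → z ⁻¹ ≤ Π (toℕ i) Y → ∃[ j ] Match Y (j , i)
    solid⇒match {Y} i solid = j , proj₂ (proj₂ (extent (j , i)))
        (≤-respʳ (≈.reflexive (≡.cong (Π (toℕ i)) (≡.sym (agree⇒applyUpTo agr)))) solid) ≤n , agr
      where
      ≤n : length Y ℕ.≤ n
      ≤n = ℕ.≤-trans (ℕ.m≤n+m (length Y) (toℕ i)) (solid⇒inside Y (ℕ.<⇒≤ (Fin.toℕ<n i)) solid)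
      j : Fin K
      j = proj₁ (S-complete a₀ (toℕ i) Y ≤n solid)
      agr : Agree Y (λ t → str j (toℕ i ℕ.+ t))
      agr = proj₂ (S-complete a₀ (toℕ i) Y ≤n solid)

    match⇒∈Occ : ∀ {m} (P : Vec (Fin σ) m) {e} → Match (toList P) e → pos e ∈ Occ T z P
    match⇒∈Occ P {e} match = ∈-filter⁺ (λ i → z ⁻¹ ≤? Prob T P i) (∈-allFin (pos e))
      (≤-respʳ (≈.sym (Prob≈Π P (pos e))) (match⇒solid {toList P} {e} match))

    ∈Occ⇒solid : ∀ {m} (P : Vec (Fin σ) m) {i} → i ∈ Occ T z P → z ⁻¹ ≤ Prob T P i
    ∈Occ⇒solid P i∈ = proj₂ (∈-filter⁻ (λ i → z ⁻¹ ≤? Prob T P i) {xs = allFin n} i∈)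

    ∈Occ⇒match : ∀ {m} (P : Vec (Fin σ) m) {i} → i ∈ Occ T z P → ∃[ j ] Match (toList P) (j , i)
    ∈Occ⇒match P {i} i∈ = solid⇒match {toList P} i (≤-respʳ (Prob≈Π P i) (∈Occ⇒solid P i∈))

    0≤Prob : ∀ {m} (P : Vec (Fin σ) m) i → 0# ≤ Prob T P i
    0≤Prob P i = ≤-respʳ (≈.sym (Prob≈Π P i)) (0≤Π (toℕ i) (toList P))

    Prob≤1 : ∀ {m} (P : Vec (Fin σ) m) i → Prob T P i ≤ 1#
    Prob≤1 P i = ≤-respˡ (≈.sym (Prob≈Π P i)) (Π≤1 (toℕ i) (toList P))

    -- Zero factors are skipped, so that every window of solid positions has the
    -- quotient of two prefix products as its probability.
    factor : Fin K → ℕ → Carrier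
    factor j t with π t (str j t) ≟ 0#
    ... | yes _ = 1#
    ... | no  _ = π t (str j t)

    prefix : Fin K → ℕ → Carrier
    prefix j zero    = 1#
    prefix j (suc t) = prefix j t * factor j t

    factor≉0 : ∀ j t → ¬ (factor j t ≈ 0#)
    factor≉0 j t with π t (str j t) ≟ 0#
    ... | yes _ = 0≉1 ∘ ≈.sym
    ... | no ≉0 = ≉0

    factor∈[0,1] : ∀ j t → 0# ≤ factor j t × factor j t ≤ 1#
    factor∈[0,1] j t with π t (str j t) ≟ 0#
    ... | yes _ = 0≤1 , ≤.refl
    ... | no  _ = 0≤π t _ , π≤1 t _

    factor≈π : ∀ j t → ¬ (π t (str j t) ≈ 0#) → factor j t ≈ π t (str j t)
    factor≈π j t ≉0 with π t (str j t) ≟ 0#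
    ... | yes ≈0 = ⊥-elim (≉0 ≈0)
    ... | no _   = ≈.refl

    prefix≉0 : ∀ j t → ¬ (prefix j t ≈ 0#)
    prefix≉0 j zero    = 0≉1 ∘ ≈.sym
    prefix≉0 j (suc t) = *-nonzero (prefix≉0 j t) (factor≉0 j t)

    prefix∈[0,1] : ∀ j t → 0# ≤ prefix j t × prefix j t ≤ 1#
    prefix∈[0,1] j zero    = 0≤1 , ≤.refl
    prefix∈[0,1] j (suc t) with prefix∈[0,1] j t | factor∈[0,1] j t
    ... | 0≤p , p≤1 | 0≤f , f≤1 = *-nonNegative 0≤p 0≤f , x*y≤1 0≤p p≤1 f≤1

    -- A nonzero window has only nonzero letter probabilities, so none of its factors was replaced
    -- by 1. Stating the quotient as a product keeps division out of the induction.
    prefix-window : ∀ j i Y → Agree Y (λ t → str j (i ℕ.+ t)) → ¬ (Π i Y ≈ 0#) →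
                    Π i Y * prefix j i ≈ prefix j (i ℕ.+ length Y)
    prefix-window j i []      _          _  = ≈.trans (≈.*-identityˡ _)
      (≈.reflexive (≡.cong (prefix j) (≡.sym (ℕ.+-identityʳ i))))
    prefix-window j i (a ∷ Y) (eq , agr) ≉0 = begin
      π i a * Π (suc i) Y * prefix j i        ≈⟨ ≈.*-congʳ (≈.*-comm _ _) ⟩
      Π (suc i) Y * π i a * prefix j i        ≈⟨ ≈.*-assoc _ _ _ ⟩
      Π (suc i) Y * (π i a * prefix j i)      ≈⟨ ≈.*-congˡ (≈.*-comm _ _) ⟩
      Π (suc i) Y * (prefix j i * π i a)      ≈⟨ ≈.*-congˡ (≈.*-congˡ (≈.sym factor≈)) ⟩
      Π (suc i) Y * prefix j (suc i)          ≈⟨ prefix-window j (suc i) Y agr′ (λ ≈0 → ≉0 (≈.trans (≈.*-congˡ ≈0) (≈.zeroʳ _))) ⟩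
      prefix j (suc i ℕ.+ length Y)           ≈⟨ ≈.reflexive (≡.cong (prefix j) (≡.sym (ℕ.+-suc i (length Y)))) ⟩
      prefix j (i ℕ.+ suc (length Y))         ∎
      where
      open import Relation.Binary.Reasoning.Setoid ≈.setoid
      str≡ : str j i ≡ a
      str≡ = ≡.trans (≡.cong (str j) (≡.sym (ℕ.+-identityʳ i))) eq
      factor≈ : factor j i ≈ π i a
      factor≈ = ≈.trans (factor≈π j i (λ ≈0 → ≉0 (≈.trans (≈.*-congʳ (≈.trans (≈.reflexive (≡.cong (π i) (≡.sym str≡))) ≈0)) (≈.zeroˡ _))))
        (≈.reflexive (≡.cong (π i) str≡))
      agree-cong : ∀ {Y : List (Fin σ)} {f g} → (∀ t → f t ≡ g t) → Agree Y f → Agree Y g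
      agree-cong {[]}    _   _         = tt
      agree-cong {b ∷ Y} f≗g (eq , agr) = ≡.trans (≡.sym (f≗g 0)) eq , agree-cong (f≗g ∘ suc) agr
      agr′ : Agree Y (λ t → str j (suc i ℕ.+ t))
      agr′ = agree-cong (λ t → ≡.cong (str j) (ℕ.+-suc i t)) agr

    Prob≈window : ∀ {m} (P : Vec (Fin σ) m) {e} → Match (toList P) e →
                  Prob T P (pos e) ≈ prefix (proj₁ e) (start e ℕ.+ m) * prefix (proj₁ e) (start e) ⁻¹
    Prob≈window {m} P {e@(j , i)} match@(_ , agr) = ≈.trans (Prob≈Π P i)
      (≈.trans (*-divide (prefix≉0 j (toℕ i)) (prefix-window j (toℕ i) (toList P) agr
         (z⁻¹≤⇒≉0 (match⇒solid {toList P} {e} match))))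
       (≈.*-congʳ (≈.reflexive (≡.cong (λ k → prefix j (toℕ i ℕ.+ k)) (length-toList P)))))

-- Memory segments and the layout of structures in them.

module Memory where

  open Counting
  open import Data.List.Base using (List; []; _∷_; _++_; length; map; applyUpTo)
  open import Data.List.Membership.Propositional using (_∈_)
  open import Data.List.Properties using (length-++)
  open import Data.List.Relation.Unary.All as All using (All; []; _∷_)
  import Data.List.Relation.Unary.All.Properties as All
  open import Data.List.Relation.Unary.Any using (here; there)
  open import Data.Nat.Base as ℕ using (ℕ; zero; suc)
  import Data.Nat.Properties as ℕ
  open import Data.Product.Base using (_×_; _,_; proj₁; proj₂)
  open import Defs
  open import Function.Base using (_∘_; _∘′_)
  open import Level using (_⊔_)
  open import Relation.Binary.PropositionalEquality as ≡ using (_≡_)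

  module Cells {c ℓ₁ ℓ₂} (F : ArchimedeanField c ℓ₁ ℓ₂) where
    open ArchimedeanField F

    record Memory : Set c where
      field
        int  : ℕ → ℕ
        prob : ℕ → Carrier

    open Memory public

    -- The integer and the probability at the same address of the two data arrays.
    Cell : Set c
    Cell = ℕ × Carrier

    word : ℕ → Cell
    word k = k , 0#

    data Seg (M : Memory) : ℕ → List Cell → Set c where
      []  : ∀ {b} → Seg M b []
      _∷_ : ∀ {b cell cells} → int M b ≡ proj₁ cell × prob M b ≡ proj₂ cell →
            Seg M (suc b) cells → Seg M b (cell ∷ cells)

    seg-++⁻ˡ : ∀ {M b} xs {ys} → Seg M b (xs ++ ys) → Seg M b xs
    seg-++⁻ˡ []       s       = []
    seg-++⁻ˡ (x ∷ xs) (p ∷ s) = p ∷ seg-++⁻ˡ xs s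

    seg-++⁻ʳ : ∀ {M b} xs {ys} → Seg M b (xs ++ ys) → Seg M (b ℕ.+ length xs) ys
    seg-++⁻ʳ {M} {b} []       {ys} s       = ≡.subst (λ a → Seg M a ys) (≡.sym (ℕ.+-identityʳ b)) s
    seg-++⁻ʳ {M} {b} (x ∷ xs) {ys} (p ∷ s) =
      ≡.subst (λ a → Seg M a ys) (≡.sym (ℕ.+-suc b (length xs))) (seg-++⁻ʳ xs s)

    seg-applyUpTo : ∀ {M b} (f : ℕ → Cell) {k i} → Seg M b (applyUpTo f k) → i ℕ.< k →
                    int M (b ℕ.+ i) ≡ proj₁ (f i) × prob M (b ℕ.+ i) ≡ proj₂ (f i)
    seg-applyUpTo {M} {b} f {suc k} {zero}  (p ∷ s) _ rewrite ℕ.+-identityʳ b = p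
    seg-applyUpTo {M} {b} f {suc k} {suc i} (p ∷ s) (ℕ.s≤s i<k) rewrite ℕ.+-suc b i =
      seg-applyUpTo (f ∘ suc) s i<k

    module Building (N : ℕ) where

      Word : Cell → Set ℓ₂
      Word (k , x) = k ℕ.< N × 0# ≤ x × x ≤ 1#

      -- Cells to be stored from address b on, such that A holds at root.
      record Layout {a} (A : Memory → ℕ → Set a) (pad b size : ℕ) : Set (a ⊔ c ⊔ ℓ₂) where
        field
          cells  : List Cell
          root   : ℕ
          root<N : root ℕ.< N
          words  : All Word cells
          fits   : pad ℕ.+ length cells ℕ.≤ size
          holds  : ∀ {M} → Seg M b cells → A M root

      -- A structure can be placed at any address with room for `size` cells. Of these, `pad` cells
      -- are left unfilled: this is credit that a parent node spends on its dictionary, in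
      -- proportion to the number of its children.
      Builder : ∀ {a} → (Memory → ℕ → Set a) → (pad size : ℕ) → Set (a ⊔ c ⊔ ℓ₂)
      Builder A pad size = ∀ b → b ℕ.+ size ℕ.< N → Layout A pad b size

      record Layouts {x a} {X : Set x} (A : X → Memory → ℕ → Set a) (xs : List X)
                     (pad b size : ℕ) : Set (x ⊔ a ⊔ c ⊔ ℓ₂) where
        field
          cells   : List Cell
          entries : List (X × ℕ)
          keys    : map proj₁ entries ≡ xs
          roots<N : ∀ {e} → e ∈ entries → proj₂ e ℕ.< N
          words   : All Word cells
          fits    : length xs ℕ.* pad ℕ.+ length cells ℕ.≤ size
          holds   : ∀ {M} → Seg M b cells → ∀ {e} → e ∈ entries → A (proj₁ e) M (proj₂ e)

      sequence : ∀ {x a} {X : Set x} {A : X → Memory → ℕ → Set a} xs {pad} {size : X → ℕ} →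
                 (∀ {x} → x ∈ xs → Builder (A x) pad (size x)) →
                 ∀ b → b ℕ.+ ∑ xs size ℕ.< N → Layouts A xs pad b (∑ xs size)
      sequence []       _     b _     = record
        { cells = [] ; entries = [] ; keys = ≡.refl ; roots<N = λ () ; words = [] ; fits = ℕ.z≤n ; holds = λ _ () }
      sequence {A = A} (x ∷ xs) {pad} {size} build b b+<N = record
        { cells   = first.cells ++ rest.cells
        ; entries = (x , first.root) ∷ rest.entries
        ; keys    = ≡.cong (x ∷_) rest.keys
        ; roots<N = λ { (here ≡.refl) → first.root<N ; (there e∈) → rest.roots<N e∈ }
        ; words   = All.++⁺ first.words rest.words
        ; fits    = fits
        ; holds   = λ s → λ
            { (here ≡.refl) → first.holds (seg-++⁻ˡ first.cells s)
            ; (there e∈)    → rest.holds (seg-++⁻ʳ first.cells s) e∈ }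
        }
        where
        open ℕ.≤-Reasoning
        first : Layout (A x) pad b (size x)
        first = build (here ≡.refl) b (ℕ.≤-<-trans (ℕ.+-monoʳ-≤ b (ℕ.m≤m+n (size x) _)) b+<N)
        module first = Layout first
        rest : Layouts A xs pad (b ℕ.+ length first.cells) (∑ xs size)
        rest = sequence xs (build ∘′ there) (b ℕ.+ length first.cells) (begin-strict
          b ℕ.+ length first.cells ℕ.+ ∑ xs size     ≡⟨ ℕ.+-assoc b _ _ ⟩
          b ℕ.+ (length first.cells ℕ.+ ∑ xs size)   ≤⟨ ℕ.+-monoʳ-≤ b (ℕ.+-monoˡ-≤ (∑ xs size)
                                                          (ℕ.≤-trans (ℕ.m≤n+m _ pad) first.fits)) ⟩
          b ℕ.+ ∑ (x ∷ xs) size                      <⟨ b+<N ⟩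
          N                                          ∎)
        module rest = Layouts rest
        fits : length (x ∷ xs) ℕ.* pad ℕ.+ length (first.cells ++ rest.cells) ℕ.≤ ∑ (x ∷ xs) size
        fits = begin
          pad ℕ.+ length xs ℕ.* pad ℕ.+ length (first.cells ++ rest.cells)
            ≡⟨ ≡.cong (pad ℕ.+ length xs ℕ.* pad ℕ.+_) (length-++ first.cells) ⟩
          pad ℕ.+ length xs ℕ.* pad ℕ.+ (length first.cells ℕ.+ length rest.cells)
            ≡⟨ +-interchange pad _ _ _ ⟩
          (pad ℕ.+ length first.cells) ℕ.+ (length xs ℕ.* pad ℕ.+ length rest.cells)
            ≤⟨ ℕ.+-mono-≤ first.fits rest.fits ⟩
          ∑ (x ∷ xs) size ∎

-- Static dictionaries with constant lookup time.

module Dictionary where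

  open Counting
  open import Data.Empty using (⊥-elim)
  open import Data.List.Base using (List; []; _∷_; _++_; filter; length; map; applyUpTo; upTo)
  open import Data.List.Membership.Propositional using (_∈_; _∉_; find; lose)
  open import Data.List.Membership.Propositional.Properties
    using (∈-filter⁺; ∈-filter⁻; ∈-map⁺; ∈-map⁻; ∈-upTo⁺)
  open import Data.List.Properties using (length-++; length-map; length-upTo; length-applyUpTo)
  open import Data.List.Relation.Unary.Any using (any?)
  open import Data.List.Relation.Unary.All as All using (All; []; _∷_)
  import Data.List.Relation.Unary.All.Properties as All
  open import Data.List.Relation.Unary.Unique.Propositional using (Unique)
  open import Data.List.Relation.Unary.Unique.Propositional.Properties using (upTo⁺)
  open import Data.Nat.Base
  open import Data.Nat.Properties
  open import Data.Nat.Solver using (module +-*-Solver)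
  open import Data.Product.Base using (_×_; _,_; proj₁; proj₂; ∃-syntax)
  open import Data.Sum.Base using (_⊎_; inj₁; inj₂)
  open import Defs using (ArchimedeanField)
  open Hashing using (module MultiplyShift)
  open Memory
  open OrderedField using (module OrderedFieldProperties)
  open import Relation.Binary.PropositionalEquality
  open import Relation.Nullary using (Dec; yes; no; ¬_)

  -- Hash values are leading bits, so the number of slots has to be a power of two. The power is
  -- doubled whenever x + 1 reaches it, which loses no more than a factor of about two.
  ∃2^> : ∀ x → ∃[ l ] x < 2 ^ l × 2 ^ l ≤ 2 * x + 1
  ∃2^> zero    = 0 , z<s , ≤-refl
  ∃2^> (suc x) with ∃2^> x
  ... | l , x<2^l , 2^l≤ with suc x <? 2 ^ l
  ...   | yes 1+x<2^l = l , 1+x<2^l , ≤-trans 2^l≤ (+-monoˡ-≤ 1 (*-monoʳ-≤ 2 (n≤1+n x)))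
  ...   | no  1+x≮2^l = suc l , ≤-<-trans x<2^l (m<m+n (2 ^ l) (≤-trans (m^n>0 2 l) (m≤m+n (2 ^ l) 0))) ,
          ≤-trans (*-monoʳ-≤ 2 (≮⇒≥ 1+x≮2^l)) (m≤m+n (2 * suc x) 1)

  n<2^n : ∀ n → n < 2 ^ n
  n<2^n zero    = z<s
  n<2^n (suc n) = ≤-<-trans (n<2^n n) (m<m+n (2 ^ n) (≤-trans (m^n>0 2 n) (m≤m+n (2 ^ n) 0)))

  2^-cancel-≤ : ∀ {l w} → 2 ^ l < 2 ^ w → l ≤ w
  2^-cancel-≤ lt = ≮⇒≥ (λ w<l → <⇒≱ lt (^-monoʳ-≤ 2 (<⇒≤ w<l)))

  key : ℕ × ℕ → ℕ
  key = proj₁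

  select : ∀ {p} {P : ℕ → Set p} (P? : ∀ k → Dec (P k)) (E : List (ℕ × ℕ)) default →
           ∃[ r ] ((∃[ k ] (k , r) ∈ E × P k) ⊎ ((∀ {k} → k ∈ map key E → ¬ P k) × r ≡ default))
  select P? E default with any? (λ e → P? (key e)) E
  ... | yes some with find some
  ...   | (k , r) , e∈ , pk = r , inj₁ (k , e∈ , pk)
  select P? E default | no none = default , inj₂ ((λ k∈ pk → absent (∈-map⁻ key k∈) pk) , refl)
    where
    absent : ∀ {k} → ∃[ e ] e ∈ E × k ≡ key e → ¬ _
    absent (e , e∈ , refl) pk = none (lose e∈ pk)

  module Dictionaries {c ℓ₁ ℓ₂} (F : ArchimedeanField c ℓ₁ ℓ₂) (w : ℕ) where
    open OrderedFieldProperties F using (module ≤; 0≤1)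
    open MultiplyShift w public
    open Cells F
    open Building N

    word-ok : ∀ {k} → k < N → Word (word k)
    word-ok k<N = k<N , ≤.refl , 0≤1

    -- What the machine reads in one level of hashing: a header of three words at H and the slot
    -- selected by x, whose content is r. The bounds say that none of the address computations
    -- overflows.
    record Step (M : Memory) (H x r : ℕ) : Set where
      field
        mult shift table : ℕ
        mult≡  : int M H ≡ mult
        shift≡ : int M (suc H) ≡ shift
        table≡ : int M (suc (suc H)) ≡ table
        H+2<N  : suc (suc H) < N
        inside : table + hash mult shift x < N
        value  : int M (table + hash mult shift x) ≡ r

    hashTable : ∀ {a l} (f : ℕ → ℕ) → a < N → l ≤ w → (∀ i → f i < N) →
                Builder (λ M H → ∀ x → Step M H x (f (hash a (w ∸ l) x))) 0 (3 + 2 ^ l)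
    hashTable {a} {l} f a<N l≤w f<N b b+size<N = record
      -- The shift w ∸ l keeps the l leading bits, hence 2 ^ l slots, which follow the three header
      -- words immediately.
      { cells  = word a ∷ word (w ∸ l) ∷ word (suc (suc (suc b))) ∷ slots
      ; root   = b
      ; root<N = ≤-<-trans (m≤m+n b _) b+size<N
      ; words  = word-ok a<N ∷ word-ok (≤-<-trans (m∸n≤m w l) (n<2^n w)) ∷ word-ok 3+b<N ∷
                 All.applyUpTo⁺₂ (λ i → word (f i)) (2 ^ l) (λ i → word-ok (f<N i))
      ; fits   = ≤-reflexive (cong (3 +_) (length-applyUpTo (λ i → word (f i)) (2 ^ l)))
      ; holds  = λ { {M} ((m , _) ∷ (s , _) ∷ (t , _) ∷ seg) x → record
        { mult = a ; shift = w ∸ l ; table = suc (suc (suc b))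
        ; mult≡ = m ; shift≡ = s ; table≡ = t
        ; H+2<N = <⇒≤ 3+b<N
        ; inside = <-trans (+-monoʳ-< (3 + b) (hash<2^l x)) (subst (_< N) b+size≡ b+size<N)
        ; value = proj₁ (seg-applyUpTo (λ i → word (f i)) seg (hash<2^l x)) } }
      }
      where
      slots : List Cell
      slots = applyUpTo (λ i → word (f i)) (2 ^ l)
      hash<2^l : ∀ x → hash a (w ∸ l) x < 2 ^ l
      hash<2^l x = subst (λ k → hash a (w ∸ l) x < 2 ^ k) (m∸[m∸n]≡n l≤w) (hash< a x (m∸n≤m w l))
      b+size≡ : b + (3 + 2 ^ l) ≡ 3 + b + 2 ^ l
      b+size≡ = trans (sym (+-assoc b 3 _)) (cong (_+ 2 ^ l) (+-comm b 3))
      3+b<N : suc (suc (suc b)) < N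
      3+b<N = ≤-<-trans (m≤m+n (3 + b) _) (subst (_< N) b+size≡ b+size<N)

    -- For a key that is not stored, the slot may hold the value of another key. The caller has to
    -- compare keys, which is why every node record contains its own.
    Lookup : List (ℕ × ℕ) → (absent x r : ℕ) → Set
    Lookup E absent x r = (∃[ k ] (k , r) ∈ E × (x ∈ map key E → k ≡ x)) ⊎ (x ∉ map key E × r ≡ absent)

    Dict : List (ℕ × ℕ) → (absent : ℕ) → Memory → ℕ → Set
    Dict E absent M H = ∀ x → ∃[ b ] ∃[ r ] Step M H x b × Step M b x r × Lookup E absent x r

    module _ {absent : ℕ} (absent<N : absent < N) where

      selected<N : ∀ {p} {P : ℕ → Set p} {E r} → (∀ {e} → e ∈ E → proj₂ e < N) →
                   (∃[ k ] (k , r) ∈ E × P k) ⊎ ((∀ {k} → k ∈ map key E → ¬ P k) × r ≡ absent) → r < N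
      selected<N values<N (inj₁ (k , e∈ , _)) = values<N e∈
      selected<N values<N (inj₂ (_ , refl))   = absent<N

      module _ (E : List (ℕ × ℕ)) (keys<N : ∀ {k} → k ∈ map key E → k < N)
               (values<N : ∀ {e} → e ∈ E → proj₂ e < N) where

        private
          ks : List ℕ
          ks = map key E

          C : ℕ
          C = length E

          length-ks : length ks ≡ C
          length-ks = length-map key E

        module _ (l a : ℕ) (2C²<2^l : 2 * (C * C) < 2 ^ l) (l≤w : l ≤ w)
                 (few : collisions a (w ∸ l) ks * 2 ^ (w ∸ (w ∸ l)) ≤ 2 * (length ks * length ks)) where

          private
            s : ℕ
            s = w ∸ l

          -- The bound on the multiplier leaves fewer than one collision, because the number of
          -- slots exceeds 2 * C * C.
          no-collision : collisions a s ks ≡ 0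
          no-collision = n<1⇒n≡0 (*-cancelʳ-< (2 ^ l) (collisions a s ks) 1 (begin-strict
            collisions a s ks * 2 ^ l         ≡⟨ cong (λ k → collisions a s ks * 2 ^ k) (m∸[m∸n]≡n l≤w) ⟨
            collisions a s ks * 2 ^ (w ∸ s)   ≤⟨ few ⟩
            2 * (length ks * length ks)       ≡⟨ cong (λ d → 2 * (d * d)) length-ks ⟩
            2 * (C * C)                       <⟨ 2C²<2^l ⟩
            2 ^ l                             ≡⟨ +-identityʳ (2 ^ l) ⟨
            1 * 2 ^ l                         ∎))
            where open ≤-Reasoning

          hash-injective : ∀ {k x} → k ∈ ks → x ∈ ks → hash a s k ≡ hash a s x → k ≡ x
          hash-injective {k} {x} k∈ x∈ eq with k ≟ x
          ... | yes k≡x = k≡x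
          ... | no  k≢x = ⊥-elim (<⇒≱ z<s (begin
            1                                             ≡⟨ ind-yes (collide? a s k x) (k≢x , eq) ⟨
            ind (collide? a s k x)                        ≤⟨ ∈⇒≤∑ (λ y → ind (collide? a s k y)) x∈ ⟩
            ∑ ks (λ y → ind (collide? a s k y))           ≤⟨ ∈⇒≤∑ (λ x → ∑ ks (λ y → ind (collide? a s x y))) k∈ ⟩
            collisions a s ks                             ≡⟨ no-collision ⟩
            0                                             ∎))
            where open ≤-Reasoning

          slot : ℕ → ℕ
          slot h = proj₁ (select (λ k → hash a s k ≟ h) E absent)

          slot<N : ∀ h → slot h < N
          slot<N h = selected<N values<N (proj₂ (select (λ k → hash a s k ≟ h) E absent))

          slot-lookup : ∀ x → Lookup E absent x (slot (hash a s x))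
          slot-lookup x with select (λ k → hash a s k ≟ hash a s x) E absent
          ... | r , inj₁ (k , e∈ , eq) = inj₁ (k , e∈ , λ x∈ → hash-injective (∈-map⁺ key e∈) x∈ eq)
          ... | r , inj₂ (no-k , refl) = inj₂ ((λ x∈ → no-k x∈ refl) , refl)

        -- With more than 2 C² slots some multiplier has no collision at all.
        bucket : Builder (λ M H → ∀ x → ∃[ r ] Step M H x r × Lookup E absent x r) 0 (4 + 4 * (C * C))
        bucket b b+size<N = build (∃2^> (2 * (C * C)))
          where
          build : ∃[ l ] 2 * (C * C) < 2 ^ l × 2 ^ l ≤ 2 * (2 * (C * C)) + 1 →
                  Layout (λ M H → ∀ x → ∃[ r ] Step M H x r × Lookup E absent x r) 0 b (4 + 4 * (C * C))
          build (l , 2C²<2^l , 2^l≤) = finish (∃few-collisions ks (m∸n≤m w l) keys<N)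
            where
            size≤ : 3 + 2 ^ l ≤ 4 + 4 * (C * C)
            size≤ = ≤-trans (+-monoʳ-≤ 3 2^l≤) (≤-reflexive (size-eq (C * C)))
              where
              size-eq : ∀ e → 3 + (2 * (2 * e) + 1) ≡ 4 + 4 * e
              size-eq = solve 1 (λ e → con 3 :+ (con 2 :* (con 2 :* e) :+ con 1) := con 4 :+ con 4 :* e) refl
                where open +-*-Solver
            l≤w : l ≤ w
            l≤w = 2^-cancel-≤ {l} {w} (≤-<-trans (≤-trans (m≤n+m (2 ^ l) 3) size≤) (≤-<-trans (m≤n+m (4 + 4 * (C * C)) b) b+size<N))
            finish : ∃[ a ] a < N × collisions a (w ∸ l) ks * 2 ^ (w ∸ (w ∸ l)) ≤ 2 * (length ks * length ks) →
                     Layout (λ M H → ∀ x → ∃[ r ] Step M H x r × Lookup E absent x r) 0 b (4 + 4 * (C * C))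
            finish (a , a<N , few) = record
              { cells = T.cells ; root = T.root ; root<N = T.root<N ; words = T.words
              ; fits  = ≤-trans T.fits size≤
              ; holds = λ seg x → slot l a 2C²<2^l l≤w few (hash a (w ∸ l) x) , T.holds seg x , slot-lookup l a 2C²<2^l l≤w few x }
              where
              module T = Layout (hashTable (slot l a 2C²<2^l l≤w few) a<N l≤w (slot<N l a 2C²<2^l l≤w few) b
                (≤-<-trans (+-monoʳ-≤ b size≤) b+size<N))

      module _ (E : List (ℕ × ℕ)) (keys<N : ∀ {k} → k ∈ map key E → k < N)
               (values<N : ∀ {e} → e ∈ E → proj₂ e < N)
               (keys-unique : Unique (map key E)) where

        private
          ks : List ℕ
          ks = map key E

          C : ℕ
          C = length E

          length-ks : length ks ≡ C
          length-ks = length-map key E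

        module _ (a s : ℕ) where

          in? : ∀ i e → Dec (hash a s (key e) ≡ i)
          in? i e = hash a s (key e) ≟ i

          part : ℕ → List (ℕ × ℕ)
          part i = filter (in? i) E

          -- The squares count ordered pairs of keys with the same hash value. A pair consists
          -- either of equal keys, of which there are C as the keys are distinct, or of colliding
          -- ones.
          ∑-part² : ∀ m → ∑ (upTo m) (λ i → length (part i) * length (part i)) ≤ C + collisions a s ks
          ∑-part² m = begin
            ∑ (upTo m) (λ i → length (part i) * length (part i))
              ≡⟨ ∑-cong (upTo m) (λ {i} _ → square i) ⟩
            ∑ (upTo m) (λ i → ∑ ks (λ x → ∑ ks (λ y → hit x i * hit y i)))
              ≡⟨ ∑-swap (upTo m) ks (λ i x → ∑ ks (λ y → hit x i * hit y i)) ⟩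
            ∑ ks (λ x → ∑ (upTo m) (λ i → ∑ ks (λ y → hit x i * hit y i)))
              ≡⟨ ∑-cong ks (λ {x} _ → ∑-swap (upTo m) ks (λ i y → hit x i * hit y i)) ⟩
            ∑ ks (λ x → ∑ ks (λ y → ∑ (upTo m) (λ i → hit x i * hit y i)))
              ≤⟨ ∑-mono ks (λ {x} _ → ∑-mono ks (λ {y} _ → pair x y)) ⟩
            ∑ ks (λ x → ∑ ks (λ y → ind (x ≟ y) + ind (collide? a s x y)))
              ≡⟨ ∑-cong ks (λ {x} _ → ∑-+ ks (λ y → ind (x ≟ y)) (λ y → ind (collide? a s x y))) ⟩
            ∑ ks (λ x → ∑ ks (λ y → ind (x ≟ y)) + ∑ ks (λ y → ind (collide? a s x y)))
              ≡⟨ ∑-+ ks (λ x → ∑ ks (λ y → ind (x ≟ y))) (λ x → ∑ ks (λ y → ind (collide? a s x y))) ⟩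
            ∑ ks (λ x → ∑ ks (λ y → ind (x ≟ y))) + collisions a s ks
              ≤⟨ +-monoˡ-≤ _ (∑-mono ks (λ {x} _ → ∑-ind-unique≤1 (x ≟_) keys-unique (λ x≡y x≡y′ → trans (sym x≡y) x≡y′))) ⟩
            ∑ ks (λ _ → 1) + collisions a s ks
              ≡⟨ cong (_+ collisions a s ks) (trans (∑-const ks 1) (trans (*-identityʳ _) length-ks)) ⟩
            C + collisions a s ks ∎
            where
            open ≤-Reasoning
            hit : ℕ → ℕ → ℕ
            hit x i = ind (hash a s x ≟ i)
            size : ∀ i → length (part i) ≡ ∑ ks (λ x → hit x i)
            size i = trans (length-filter≡∑ (in? i) E) (sym (∑-map key E (λ x → hit x i)))
            square : ∀ i → length (part i) * length (part i) ≡ ∑ ks (λ x → ∑ ks (λ y → hit x i * hit y i))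
            square i = trans (cong₂ _*_ (size i) (size i)) (sym (trans
              (∑-cong ks (λ {x} _ → ∑-*ˡ ks (hit x i) (λ y → hit y i)))
              (∑-*ʳ ks (λ x → hit x i) (∑ ks (λ y → hit y i)))))
            disjoint : ∀ {x y} → hash a s x ≢ hash a s y → ∀ i → hit x i * hit y i ≡ 0
            disjoint {x} {y} x≢y i with hash a s x ≟ i | hash a s y ≟ i
            ... | no _  | _     = refl
            ... | yes _ | no _  = refl
            ... | yes p | yes q = ⊥-elim (x≢y (trans p (sym q)))
            equal-or-collide : ∀ {x y} → hash a s x ≡ hash a s y → Dec (x ≡ y) →
                               1 ≤ ind (x ≟ y) + ind (collide? a s x y)
            equal-or-collide {x} {y} eq (yes x≡y) = ≤-trans (≤-reflexive (sym (ind-yes (x ≟ y) x≡y))) (m≤m+n _ _)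
            equal-or-collide {x} {y} eq (no  x≢y) =
              ≤-trans (≤-reflexive (sym (ind-yes (collide? a s x y) (x≢y , eq)))) (m≤n+m _ (ind (x ≟ y)))
            pair-by : ∀ {x y} → Dec (hash a s x ≡ hash a s y) →
                      ∑ (upTo m) (λ i → hit x i * hit y i) ≤ ind (x ≟ y) + ind (collide? a s x y)
            pair-by {x} {y} (no x≢y) = ≤-trans (≤-reflexive (trans (∑-cong (upTo m) (λ {i} _ → disjoint x≢y i))
              (trans (∑-const (upTo m) 0) (*-zeroʳ (length (upTo m)))))) z≤n
            pair-by {x} {y} (yes eq) = begin
              ∑ (upTo m) (λ i → hit x i * hit y i)
                ≤⟨ ∑-mono (upTo m) (λ {i} _ → *-monoʳ-≤ (hit x i) (ind≤1 (hash a s y ≟ i))) ⟩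
              ∑ (upTo m) (λ i → hit x i * 1)
                ≡⟨ ∑-cong (upTo m) (λ {i} _ → *-identityʳ (hit x i)) ⟩
              ∑ (upTo m) (hit x)
                ≤⟨ ∑-ind-unique≤1 (λ i → hash a s x ≟ i) (upTo⁺ m) (λ p q → trans (sym p) q) ⟩
              1
                ≤⟨ equal-or-collide eq (x ≟ y) ⟩
              ind (x ≟ y) + ind (collide? a s x y) ∎
            pair : ∀ x y → ∑ (upTo m) (λ i → hit x i * hit y i) ≤ ind (x ≟ y) + ind (collide? a s x y)
            pair x y = pair-by (hash a s x ≟ hash a s y)

        private
          squares : ℕ → ℕ → ℕ → ℕ
          squares l a i = length (part a (w ∸ l) i) * length (part a (w ∸ l) i)

        module _ (b l a : ℕ) (C<2^l : C < 2 ^ l) (2^l≤ : 2 ^ l ≤ 2 * C + 1) (l≤w : l ≤ w) (a<N : a < N)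
                 (few : collisions a (w ∸ l) ks * 2 ^ (w ∸ (w ∸ l)) ≤ 2 * (length ks * length ks))
                 (b+size<N : b + (22 * C + 8) < N) where

          private
            s size₂ : ℕ
            s = w ∸ l
            size₂ = ∑ (upTo (2 ^ l)) (λ i → 4 + 4 * squares l a i)

          open ≤-Reasoning

          collisions≤ : collisions a s ks ≤ 2 * C
          collisions≤ = *-cancelʳ-≤ (collisions a s ks) (2 * C) (2 ^ l) {{m^n≢0 2 l}} (begin
            collisions a s ks * 2 ^ l          ≡⟨ cong (λ k → collisions a s ks * 2 ^ k) (m∸[m∸n]≡n l≤w) ⟨
            collisions a s ks * 2 ^ (w ∸ s)    ≤⟨ few ⟩
            2 * (length ks * length ks)        ≡⟨ cong (λ d → 2 * (d * d)) length-ks ⟩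
            2 * (C * C)                        ≡⟨ *-assoc 2 C C ⟨
            2 * C * C                          ≤⟨ *-monoʳ-≤ (2 * C) (<⇒≤ C<2^l) ⟩
            2 * C * 2 ^ l                      ∎)

          -- Four cells for each of the at most 2 * C + 1 slots, and four for each of the at most 3
          -- * C ordered pairs that share a slot.
          buckets-size≤ : size₂ ≤ 20 * C + 4
          buckets-size≤ = begin
            size₂
              ≡⟨ ∑-+ (upTo (2 ^ l)) (λ _ → 4) (λ i → 4 * squares l a i) ⟩
            ∑ (upTo (2 ^ l)) (λ _ → 4) + ∑ (upTo (2 ^ l)) (λ i → 4 * squares l a i)
              ≡⟨ cong₂ _+_ (trans (∑-const (upTo (2 ^ l)) 4) (cong (_* 4) (length-upTo (2 ^ l))))
                   (∑-*ˡ (upTo (2 ^ l)) 4 (squares l a)) ⟩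
            2 ^ l * 4 + 4 * ∑ (upTo (2 ^ l)) (squares l a)
              ≤⟨ +-mono-≤ (*-monoˡ-≤ 4 2^l≤) (*-monoʳ-≤ 4 (≤-trans (∑-part² a s (2 ^ l)) (+-monoʳ-≤ C collisions≤))) ⟩
            (2 * C + 1) * 4 + 4 * (C + 2 * C)
              ≡⟨ eq C ⟩
            20 * C + 4 ∎
            where
            eq : ∀ C → (2 * C + 1) * 4 + 4 * (C + 2 * C) ≡ 20 * C + 4
            eq = solve 1 (λ C → (con 2 :* C :+ con 1) :* con 4 :+ con 4 :* (C :+ con 2 :* C) := con 20 :* C :+ con 4) refl
              where open +-*-Solver

          total-size≤ : size₂ + (3 + 2 ^ l) ≤ 22 * C + 8
          total-size≤ = begin
            size₂ + (3 + 2 ^ l)                  ≤⟨ +-mono-≤ buckets-size≤ (+-monoʳ-≤ 3 2^l≤) ⟩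
            20 * C + 4 + (3 + (2 * C + 1))       ≡⟨ eq C ⟩
            22 * C + 8                           ∎
            where
            eq : ∀ C → 20 * C + 4 + (3 + (2 * C + 1)) ≡ 22 * C + 8
            eq = solve 1 (λ C → con 20 :* C :+ con 4 :+ (con 3 :+ (con 2 :* C :+ con 1)) := con 22 :* C :+ con 8) refl
              where open +-*-Solver

          part⊆ : ∀ i {e} → e ∈ part a s i → e ∈ E
          part⊆ i e∈ = proj₁ (∈-filter⁻ (in? a s i) {xs = E} e∈)

          part-keys<N : ∀ i {k} → k ∈ map key (part a s i) → k < N
          part-keys<N i k∈ with ∈-map⁻ key k∈
          ... | e , e∈ , refl = keys<N (∈-map⁺ key (part⊆ i e∈))

          ∈-part : ∀ {x} → x ∈ ks → x ∈ map key (part a s (hash a s x))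
          ∈-part {x} x∈ with ∈-map⁻ key x∈
          ... | e , e∈E , refl = ∈-map⁺ key (∈-filter⁺ (in? a s (hash a s x)) e∈E refl)

          b+total<N : b + (size₂ + (3 + 2 ^ l)) < N
          b+total<N = ≤-<-trans (+-monoʳ-≤ b total-size≤) b+size<N

          BucketAt : ℕ → Memory → ℕ → Set
          BucketAt i M H = ∀ x → ∃[ r ] Step M H x r × Lookup (part a s i) absent x r

          bucketAt : ∀ i → Builder (BucketAt i) 0 (4 + 4 * squares l a i)
          bucketAt i = bucket (part a s i) (part-keys<N i) (λ e∈ → values<N (part⊆ i e∈))

          b+size₂<N : b + size₂ < N
          b+size₂<N = ≤-<-trans (+-monoʳ-≤ b (m≤m+n size₂ (3 + 2 ^ l))) b+total<N

          buckets : Layouts BucketAt (upTo (2 ^ l)) 0 b size₂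
          buckets = sequence {A = BucketAt} (upTo (2 ^ l)) {0} {λ i → 4 + 4 * squares l a i} (λ {i} _ → bucketAt i) b b+size₂<N

          private
            module B = Layouts buckets

          B-fits : length B.cells ≤ size₂
          B-fits = subst (λ k → k + length B.cells ≤ size₂) (*-zeroʳ (length (upTo (2 ^ l)))) B.fits

          root-of : ℕ → ℕ
          root-of i = proj₁ (select (_≟ i) B.entries absent)

          root-of<N : ∀ i → root-of i < N
          root-of<N i = selected<N B.roots<N (proj₂ (select (_≟ i) B.entries absent))

          top : Layout (λ M H → ∀ x → Step M H x (root-of (hash a s x))) 0 (b + length B.cells) (3 + 2 ^ l)
          top = hashTable root-of a<N l≤w root-of<N (b + length B.cells) (begin-strict
            b + length B.cells + (3 + 2 ^ l)    ≡⟨ +-assoc b (length B.cells) (3 + 2 ^ l) ⟩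
            b + (length B.cells + (3 + 2 ^ l))  ≤⟨ +-monoʳ-≤ b (+-monoˡ-≤ (3 + 2 ^ l) B-fits) ⟩
            b + (size₂ + (3 + 2 ^ l))           <⟨ b+total<N ⟩
            N                                   ∎)

          private
            module T = Layout top

          found : ∀ {M H x b′} → (∀ {e} → e ∈ B.entries → BucketAt (proj₁ e) M (proj₂ e)) → Step M H x b′ →
                  (∃[ i ] (i , b′) ∈ B.entries × i ≡ hash a s x) ⊎ ((∀ {i} → i ∈ map key B.entries → i ≢ hash a s x) × b′ ≡ absent) →
                  ∃[ b ] ∃[ r ] Step M H x b × Step M b x r × Lookup E absent x r
          -- Unreachable: every hash value is below 2 ^ l, and each such number has a bucket.
          found {x = x} buckets-hold step (inj₂ (no-i , _)) =
            ⊥-elim (no-i (subst (hash a s x ∈_) (sym B.keys) (∈-upTo⁺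
              (subst (λ k → hash a s x < 2 ^ k) (m∸[m∸n]≡n l≤w) (hash< a x (m∸n≤m w l))))) refl)
          found {x = x} buckets-hold step (inj₁ (i , i∈ , i≡)) = finish (buckets-hold i∈ x)
            where
            finish : ∃[ r ] Step _ _ x r × Lookup (part a s i) absent x r → _
            finish (r , step₂ , inj₁ (k , k∈ , only)) = _ , r , step , step₂ ,
              inj₁ (k , part⊆ i k∈ , λ x∈ → only (subst (λ j → x ∈ map key (part a s j)) (sym i≡) (∈-part x∈)))
            finish (r , step₂ , inj₂ (x∉ , r≡)) = _ , r , step , step₂ ,
              inj₂ ((λ x∈ → x∉ (subst (λ j → x ∈ map key (part a s j)) (sym i≡) (∈-part x∈))) , r≡)

          two-level : Layout (Dict E absent) 0 b (22 * C + 8)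
          two-level = record
            { cells  = B.cells ++ T.cells
            ; root   = T.root
            ; root<N = T.root<N
            ; words  = All.++⁺ B.words T.words
            ; fits   = ≤-trans (≤-reflexive (length-++ B.cells)) (≤-trans (+-mono-≤ B-fits T.fits) total-size≤)
            ; holds  = λ seg x → found (B.holds (seg-++⁻ˡ B.cells seg)) (T.holds (seg-++⁻ʳ B.cells seg) x)
                (proj₂ (select (_≟ hash a s x) B.entries absent)) }

        -- Two-level perfect hashing (Fredman, Komlós, Szemerédi).
        dictionary : Builder (Dict E absent) 0 (22 * C + 8)
        dictionary b b+size<N = build (∃2^> C)
          where
          build : ∃[ l ] C < 2 ^ l × 2 ^ l ≤ 2 * C + 1 → Layout (Dict E absent) 0 b (22 * C + 8)
          build (l , C<2^l , 2^l≤) = finish (∃few-collisions ks (m∸n≤m w l) keys<N)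
            where
            open ≤-Reasoning
            l≤w : l ≤ w
            l≤w = 2^-cancel-≤ {l} {w} (begin-strict
              2 ^ l              ≤⟨ 2^l≤ ⟩
              2 * C + 1          ≤⟨ +-mono-≤ (*-monoˡ-≤ C (m≤m+n 2 20)) (m≤m+n 1 7) ⟩
              22 * C + 8         ≤⟨ m≤n+m (22 * C + 8) b ⟩
              b + (22 * C + 8)   <⟨ b+size<N ⟩
              N                  ∎)
            finish : ∃[ a ] a < N × collisions a (w ∸ l) ks * 2 ^ (w ∸ (w ∸ l)) ≤ 2 * (length ks * length ks) →
                     Layout (Dict E absent) 0 b (22 * C + 8)
            finish (a , a<N , few) = two-level b l a C<2^l 2^l≤ l≤w a<N few b+size<N

-- The stored trie: fat nodes, thin nodes and their sizes.

module Index where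

  open Colouring using (_≟ᴹ_)
  open Counting
  open DecisionTree
  open Dictionary
  open import Data.Empty using (⊥-elim)
  open import Data.Fin.Base using (Fin; toℕ)
  import Data.Fin.Properties as Fin
  open import Data.List.Base using (List; []; _∷_; _++_; _∷ʳ_; allFin; filter; length; map; concatMap)
  open import Data.List.Membership.Propositional using (_∈_; _∉_; find; lose)
  open import Data.List.Membership.Propositional.Properties
    using (∈-allFin; ∈-filter⁺; ∈-filter⁻; ∈-map⁺; ∈-map⁻; ∈-length)
  open import Data.List.Properties using (length-++; length-map; length-filter; map-∘)
  open import Data.List.Relation.Binary.Permutation.Propositional using (_↭_; ↭-sym)
  open import Data.List.Relation.Binary.Permutation.Propositional.Properties using (∈-resp-↭; ↭-length)
  open import Data.List.Relation.Unary.All as All using (All; []; _∷_)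
  import Data.List.Relation.Unary.All.Properties as All
  open import Data.List.Relation.Unary.Any as Any using (here)
  open import Data.List.Relation.Unary.Unique.Propositional using (Unique)
  open import Data.List.Relation.Unary.Unique.Propositional.Properties using (allFin⁺)
    renaming (filter⁺ to Unique-filter⁺; map⁺ to Unique-map⁺)
  open import Data.Maybe.Base using (just)
  open import Data.Nat.Base as ℕ hiding (_≤_; _⊔_)
  open import Data.Nat.Properties hiding (_≟_)
  open import Data.Nat.Solver using (module +-*-Solver)
  open import Data.Product.Base using (_×_; _,_; proj₁; proj₂; ∃-syntax)
  open import Data.Sum.Base using (inj₁; inj₂)
  open import Data.Vec.Base as Vec using (Vec; toList; fromList)
  open import Data.Vec.Properties using (toList∘fromList)
  open import Defs
  open import Level using (_⊔_)
  open Memory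
  open OrderedField using (module OrderedFieldProperties)
  open import Relation.Binary.PropositionalEquality
  open import Relation.Nullary using (Dec; yes; no; ¬_)

  length-∷ʳ : ∀ {a} {A : Set a} (Y : List A) {x} → length (Y ∷ʳ x) ≡ suc (length Y)
  length-∷ʳ Y = trans (length-++ Y) (+-comm (length Y) 1)

  -- Truncated subtraction of a constant is superadditive. This bounds the fat nodes: children with
  -- k a leaves at depth d + 1 are entitled to k a ∸ d fat nodes each, together at most k ∸ d, and
  -- one more is left for the node itself.
  ∑-∸ : ∀ {a} {A : Set a} (xs : List A) f d → ∑ xs (λ x → f x ∸ d) ℕ.≤ ∑ xs f ∸ d
  ∑-∸ []       f d = z≤n
  ∑-∸ (x ∷ xs) f d = ≤-trans (+-monoʳ-≤ (f x ∸ d) (∑-∸ xs f d)) (superadditive (f x) (∑ xs f))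
    where
    superadditive : ∀ a b → (a ∸ d) + (b ∸ d) ℕ.≤ (a + b) ∸ d
    superadditive a b with ≤-total a d
    ... | inj₁ a≤d rewrite m≤n⇒m∸n≡0 a≤d = ∸-monoˡ-≤ d (m≤n+m b a)
    ... | inj₂ d≤a = ≤-trans (+-monoʳ-≤ (a ∸ d) (m∸n≤m b d)) (≤-reflexive (sym (+-∸-comm b d≤a)))

  module _ {c ℓ₁ ℓ₂} (F : ArchimedeanField c ℓ₁ ℓ₂) {n σ : ℕ} (T : WeightedSequences.WeightedSequence F n σ)
           (z : ArchimedeanField.Carrier F) where
    open ArchimedeanField F using (Carrier; _≈_; _≤_; _⁻¹; 0#; 1#) renaming (_*_ to _*ᶠ_)
    open WeightedSequences F

    -- An interface to the strings found above: the index depends on these facts and not on how the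
    -- strings were coloured.
    record LeafSystem : Set (c ⊔ ℓ₁ ⊔ ℓ₂) where
      field
        K      : ℕ
        str    : Fin K → ℕ → Fin σ
        len    : Fin K × Fin n → ℕ
        prefix : Fin K → ℕ → Carrier

      Leaf : Set
      Leaf = Fin K × Fin n

      pos : Leaf → Fin n
      pos = proj₂

      start : Leaf → ℕ
      start e = toℕ (pos e)

      seq : Leaf → ℕ → Fin σ
      seq e t = str (proj₁ e) (start e + t)

      open Trees len seq public

      field
        start+len≤n  : ∀ e → start e + len e ℕ.≤ n
        match⇒∈Occ   : ∀ {m} (P : Vec (Fin σ) m) {e} → Match (toList P) e → pos e ∈ Occ T z P
        ∈Occ⇒match   : ∀ {m} (P : Vec (Fin σ) m) {i} → i ∈ Occ T z P → ∃[ j ] Match (toList P) (j , i)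
        0≤Prob       : ∀ {m} (P : Vec (Fin σ) m) i → 0# ≤ Prob T P i
        Prob≤1       : ∀ {m} (P : Vec (Fin σ) m) i → Prob T P i ≤ 1#
        prefix∈[0,1] : ∀ j t → 0# ≤ prefix j t × prefix j t ≤ 1#
        Prob≈window  : ∀ {m} (P : Vec (Fin σ) m) {e} → Match (toList P) e →
                       Prob T P (pos e) ≈ prefix (proj₁ e) (start e + m) *ᶠ prefix (proj₁ e) (start e) ⁻¹
        leaf         : Leaf

      len≤n : ∀ e → len e ℕ.≤ n
      len≤n e = ≤-trans (m≤n+m (len e) (start e)) (start+len≤n e)

  module Indexing {c ℓ₁ ℓ₂} (F : ArchimedeanField c ℓ₁ ℓ₂) {n σ : ℕ} (T : WeightedSequences.WeightedSequence F n σ)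
                  (z : ArchimedeanField.Carrier F) (sys : LeafSystem F T z) (w : ℕ) where
    open ArchimedeanField F using (Carrier; _≈_; _≤_; 0#; 1#)
    open OrderedFieldProperties F using (module ≈; module ≤; mean-∈[0,1]; maximum)
    open WeightedSequences F
    open LeafSystem sys public
    open Cells F public
    open Dictionaries F w public
    open Building N public

    -- Address 0 holds the pointer to the root. The fail structure takes the next twelve cells:
    -- three for its leaf, six for its tree node, and three from 10 on for its record. The string
    -- table therefore starts at 13.
    failAddr stringBase : ℕ
    failAddr   = 10
    stringBase = 13

    stringAt : Fin K → ℕ → ℕ
    stringAt j t = stringBase + (toℕ j * suc n + t)

    leafCells : Leaf → List Cell
    leafCells e = word (start e) ∷ word (stringAt (proj₁ e) (start e)) ∷ word (len e) ∷ []

    LeafRecords : Memory → ℕ → List Leaf → Set c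
    LeafRecords M lo E = Seg M lo (concatMap leafCells E)

    length-leafCells : ∀ E → length (concatMap leafCells E) ≡ 3 * length E
    length-leafCells []      = refl
    length-leafCells (e ∷ E) = trans (cong (3 +_) (length-leafCells E)) (sym (*-suc 3 (length E)))

    -- The last two words delimit the records of the leaves below the node. These are contiguous,
    -- because the leaf records are stored in the order of the tree.
    treeCells : (h a yes no lo hi : ℕ) → List Cell
    treeCells h a y n lo hi = word h ∷ word a ∷ word y ∷ word n ∷ word lo ∷ word hi ∷ []

    -- N ∸ 1 exceeds the length of every pattern the machine can be given, so a
    -- group is where the descent into a tree always stops.
    TreeAt : Memory → Tree → (lo a : ℕ) → Set c
    TreeAt M (group e es)    lo a = Seg M a (treeCells (N ∸ 1) 0 0 0 lo (lo + 3 * suc (length es))) × 5 + a < N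
    TreeAt M (split h x y t) lo a = ∃[ ay ] ∃[ at ]
      Seg M a (treeCells h (toℕ x) ay at lo (lo + 3 * length (leaves y ++ leaves t))) × 5 + a < N ×
      TreeAt M y lo ay × TreeAt M t (lo + 3 * length (leaves y)) at

    record Thin (M : Memory) (r : ℕ) (t : Tree) : Set c where
      field
        lo ptr : ℕ
        kind≡  : int M (suc r) ≡ 0
        ptr≡   : int M (suc (suc r)) ≡ ptr
        r+2<N  : suc (suc r) < N
        hi<N   : lo + 3 * length (leaves t) < N
        tree   : TreeAt M t lo ptr
        recs   : LeafRecords M lo (leaves t)
        valid  : Valid n t

    -- Trie nodes are lists that grow at the end, whereas queries are about vectors; hence the
    -- quantification over all vectors with the given list.
    Answers : List (Fin σ) → Carrier → Carrier → Set (ℓ₁ ⊔ ℓ₂)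
    Answers Y heavy avg = ∀ {m} (P : Vec (Fin σ) m) → toList P ≡ Y →
      IsHeaviest T z P heavy × avg ≈ averageProb T z P × Occ T z P ≢ []

    NoMatch : List (Fin σ) → Set
    NoMatch Y = ∀ {e} → ¬ Match Y e

    -- The record at r holds a key and a kind (1 for fat, 0 for thin) and points to
    -- a dictionary or to a decision tree; the probabilities in the first two cells
    -- of a fat record are the answers.
    data Node (M : Memory) : List (Fin σ) → ℕ → Set (c ⊔ ℓ₁ ⊔ ℓ₂) where
      fat  : ∀ {Y r heavy avg H} → Answers Y heavy avg →
             prob M r ≡ heavy → int M (suc r) ≡ 1 → prob M (suc r) ≡ avg →
             int M (suc (suc r)) ≡ H → suc (suc r) < N →
             (∀ x → ∃[ b ] ∃[ r′ ] Step M H (toℕ x) b × Step M b (toℕ x) r′ ×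
               (int M r′ ≡ toℕ x → Node M (Y ∷ʳ x) r′) × (int M r′ ≢ toℕ x → NoMatch (Y ∷ʳ x))) →
             Node M Y r
      thin : ∀ {Y r t} → Thin M r t → length (leaves t) ℕ.≤ length Y →
             (∀ {e} → Match Y e → e ∈ leaves t) → Node M Y r

    -- A matching leaf yields an occurrence, so that the maximum and the mean are taken over a
    -- nonempty list. The bounds by 0 and 1 allow both values to be stored.
    answers : ∀ {Y e} → Match Y e → ∃[ heavy ] ∃[ avg ] Answers Y heavy avg ×
              (0# ≤ heavy × heavy ≤ 1#) × (0# ≤ avg × avg ≤ 1#)
    answers {Y} {e} match = Prob T P (proj₁ best) , averageProb T z P , answer ,
      (0≤Prob P (proj₁ best) , Prob≤1 P (proj₁ best)) ,
      mean-∈[0,1] (Prob T P) (0≤Prob P) (Prob≤1 P) (Occ T z P) pos∈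
      where
      P : Vec (Fin σ) (length Y)
      P = fromList Y
      pos∈ : pos e ∈ Occ T z P
      pos∈ = match⇒∈Occ P {e} (subst (λ X → Match X e) (sym (toList∘fromList Y)) match)
      best : ∃[ i ] i ∈ Occ T z P × (∀ {i′} → i′ ∈ Occ T z P → Prob T P i′ ≤ Prob T P i)
      best = maximum (Prob T P) (Occ T z P) pos∈
      Same : ∀ {m} → Vec (Fin σ) m → Set _
      Same P′ = IsHeaviest T z P′ (Prob T P (proj₁ best)) × averageProb T z P ≈ averageProb T z P′ × Occ T z P′ ≢ []
      same : Same P
      same = ((proj₁ best , proj₁ (proj₂ best) , ≈.refl) , (λ i i∈ → proj₂ (proj₂ best) i∈)) , ≈.refl , λ { eq → ∉[] (subst (pos e ∈_) eq pos∈) }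
        where
        ∉[] : ∀ {i : Fin n} → i ∉ []
        ∉[] ()
      -- A vector and `fromList` of its list have types with different lengths, so the property is
      -- carried over by induction instead of by substitution.
      transport : ∀ {m} (P′ : Vec (Fin σ) m) X (Q : ∀ {m} → Vec (Fin σ) m → Set (ℓ₁ ⊔ ℓ₂)) →
                  toList P′ ≡ X → Q (fromList X) → Q P′
      transport Vec.[]       _ Q refl q = q
      transport (x Vec.∷ P′) _ Q refl q = transport P′ (toList P′) (λ P → Q (x Vec.∷ P)) refl q
      answer : Answers Y (Prob T P (proj₁ best)) (averageProb T z P)
      answer P′ eq = transport P′ Y Same eq same

    treeLayout : ∀ t lo → n < N → σ ℕ.≤ N → Valid n t → lo + 3 * length (leaves t) < N →
                 Builder (λ M a → TreeAt M t lo a) 0 (6 * nodes t)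
    treeLayout (group e es) lo n<N σ≤N _ hi<N b b+6<N = record
      { cells  = treeCells (N ∸ 1) 0 0 0 lo (lo + 3 * suc (length es))
      ; root   = b
      ; root<N = ≤-<-trans (m≤m+n b 6) b+6<N
      ; words  = word-ok N∸1<N ∷ word-ok 0<N ∷ word-ok 0<N ∷ word-ok 0<N ∷
                 word-ok (≤-<-trans (m≤m+n lo _) hi<N) ∷ word-ok hi<N ∷ []
      ; fits   = ≤-refl
      ; holds  = λ seg → seg , <-trans (n<1+n (5 + b)) (subst (_< N) (+-comm b 6) b+6<N)
      }
      where
      0<N : 0 < N
      0<N = ≤-<-trans z≤n hi<N
      N∸1<N : N ∸ 1 < N
      N∸1<N = ≤-reflexive (m+[n∸m]≡n 0<N)
    treeLayout (split h x y t) lo n<N σ≤N (split h<n _ _ _ valid-y valid-t) hi<N b b+size<N = record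
      { cells  = Y.cells ++ (T′.cells ++ treeCells h (toℕ x) Y.root T′.root lo hi)
      ; root   = b + length Y.cells + length T′.cells
      ; root<N = ≤-<-trans (m≤n+m _ 6) b′+6<N
      ; words  = All.++⁺ Y.words (All.++⁺ T′.words (word-ok (<-trans h<n n<N) ∷
                   word-ok (<-≤-trans (Fin.toℕ<n x) σ≤N) ∷ word-ok Y.root<N ∷ word-ok T′.root<N ∷
                   word-ok (≤-<-trans (m≤m+n lo _) hi<N) ∷ word-ok hi<N ∷ []))
      ; fits   = fits
      ; holds  = λ seg → Y.root , T′.root ,
                   seg-++⁻ʳ T′.cells (seg-++⁻ʳ Y.cells seg) , <-trans (n<1+n _) b′+6<N ,
                   Y.holds (seg-++⁻ˡ Y.cells seg) , T′.holds (seg-++⁻ˡ T′.cells (seg-++⁻ʳ Y.cells seg))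
      }
      where
      open ≤-Reasoning
      hi : ℕ
      hi = lo + 3 * length (leaves y ++ leaves t)
      size≡ : 6 * nodes (split h x y t) ≡ 6 * nodes y + (6 * nodes t + 6)
      size≡ = trans (*-suc 6 (nodes y + nodes t)) (trans (+-comm 6 _)
        (trans (cong (_+ 6) (*-distribˡ-+ 6 (nodes y) (nodes t))) (+-assoc (6 * nodes y) _ 6)))
      total<N : b + (6 * nodes y + (6 * nodes t + 6)) < N
      total<N = subst (λ k → b + k < N) size≡ b+size<N
      hi≡ : hi ≡ lo + 3 * length (leaves y) + 3 * length (leaves t)
      hi≡ = trans (cong (λ k → lo + 3 * k) (length-++ (leaves y)))
        (trans (cong (lo +_) (*-distribˡ-+ 3 (length (leaves y)) _)) (sym (+-assoc lo _ _)))
      layout-y : Layout (λ M a → TreeAt M y lo a) 0 b (6 * nodes y)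
      layout-y = treeLayout y lo n<N σ≤N valid-y (≤-<-trans (m≤m+n _ _) (subst (_< N) hi≡ hi<N)) b
        (≤-<-trans (+-monoʳ-≤ b (m≤m+n (6 * nodes y) _)) total<N)
      module Y = Layout layout-y
      layout-t : Layout (λ M a → TreeAt M t (lo + 3 * length (leaves y)) a) 0 (b + length Y.cells) (6 * nodes t)
      layout-t = treeLayout t (lo + 3 * length (leaves y)) n<N σ≤N valid-t (subst (_< N) hi≡ hi<N) (b + length Y.cells)
        (begin-strict
          b + length Y.cells + 6 * nodes t          ≡⟨ +-assoc b _ _ ⟩
          b + (length Y.cells + 6 * nodes t)        ≤⟨ +-monoʳ-≤ b (+-mono-≤ Y.fits (m≤m+n (6 * nodes t) 6)) ⟩
          b + (6 * nodes y + (6 * nodes t + 6))     <⟨ total<N ⟩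
          N                                         ∎)
      module T′ = Layout layout-t
      b′+6<N : 6 + (b + length Y.cells + length T′.cells) < N
      b′+6<N = begin-strict
        6 + (b + length Y.cells + length T′.cells)      ≡⟨ +-comm 6 _ ⟩
        b + length Y.cells + length T′.cells + 6        ≡⟨ trans (+-assoc (b + length Y.cells) _ 6) (+-assoc b _ _) ⟩
        b + (length Y.cells + (length T′.cells + 6))    ≤⟨ +-monoʳ-≤ b (+-mono-≤ Y.fits (+-monoˡ-≤ 6 T′.fits)) ⟩
        b + (6 * nodes y + (6 * nodes t + 6))           <⟨ total<N ⟩
        N                                               ∎
      fits : length (Y.cells ++ (T′.cells ++ treeCells h (toℕ x) Y.root T′.root lo hi)) ℕ.≤ 6 * nodes (split h x y t)
      fits = begin
        length (Y.cells ++ (T′.cells ++ treeCells h (toℕ x) Y.root T′.root lo hi))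
          ≡⟨ trans (length-++ Y.cells) (cong (length Y.cells +_) (length-++ T′.cells)) ⟩
        length Y.cells + (length T′.cells + 6)
          ≤⟨ +-mono-≤ Y.fits (+-monoˡ-≤ 6 T′.fits) ⟩
        6 * nodes y + (6 * nodes t + 6)
          ≡⟨ size≡ ⟨
        6 * nodes (split h x y t) ∎

    thinSize : Tree → ℕ
    thinSize t = 3 * length (leaves t) + 6 * nodes t + 3

    module Nodes (n<N : n < N) (σ≤N : σ ℕ.≤ N) (strings<N : ∀ j → stringAt j n < N) where

      leaf-words : ∀ E → All Word (concatMap leafCells E)
      leaf-words []      = []
      leaf-words (e ∷ E) =
        word-ok (<-trans (Fin.toℕ<n (pos e)) n<N) ∷
        word-ok (≤-<-trans (+-monoʳ-≤ stringBase (+-monoʳ-≤ (toℕ (proj₁ e) * suc n) (<⇒≤ (Fin.toℕ<n (pos e))))) (strings<N (proj₁ e))) ∷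
        word-ok (≤-<-trans (len≤n e) n<N) ∷ leaf-words E

      thinLayout : ∀ t key → key < N → Valid n t → Builder (λ M r → Thin M r t × int M r ≡ key) 0 (thinSize t)
      thinLayout t key key<N valid b b+size<N = record
        { cells  = recs ++ (R.cells ++ record-cells)
        ; root   = b + length recs + length R.cells
        ; root<N = ≤-<-trans (m≤n+m _ 2) r+2<N
        ; words  = All.++⁺ (leaf-words (leaves t)) (All.++⁺ R.words
                     (word-ok key<N ∷ word-ok (≤-<-trans z≤n key<N) ∷ word-ok R.root<N ∷ []))
        ; fits   = fits
        ; holds  = λ seg → thin-holds (seg-++⁻ʳ R.cells (seg-++⁻ʳ recs seg)) (seg-++⁻ˡ recs seg)
                             (R.holds (seg-++⁻ˡ R.cells (seg-++⁻ʳ recs seg))) {r+2<N}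
        }
        where
        open ≤-Reasoning
        L : ℕ
        L = length (leaves t)
        recs : List Cell
        recs = concatMap leafCells (leaves t)
        recs≡ : length recs ≡ 3 * L
        recs≡ = length-leafCells (leaves t)
        total<N : b + (3 * L + 6 * nodes t + 3) < N
        total<N = b+size<N
        hi<N : b + 3 * L < N
        hi<N = ≤-<-trans (+-monoʳ-≤ b (≤-trans (m≤m+n (3 * L) (6 * nodes t)) (m≤m+n _ 3))) total<N
        layout : Layout (λ M a → TreeAt M t b a) 0 (b + length recs) (6 * nodes t)
        layout = treeLayout t b n<N σ≤N valid hi<N (b + length recs) (begin-strict
          b + length recs + 6 * nodes t      ≡⟨ trans (cong (λ k → b + k + 6 * nodes t) recs≡) (+-assoc b _ _) ⟩
          b + (3 * L + 6 * nodes t)          ≤⟨ +-monoʳ-≤ b (m≤m+n _ 3) ⟩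
          b + (3 * L + 6 * nodes t + 3)      <⟨ total<N ⟩
          N                                  ∎)
        module R = Layout layout
        record-cells : List Cell
        record-cells = word key ∷ word 0 ∷ word R.root ∷ []
        size≤ : length recs + (length R.cells + 3) ℕ.≤ thinSize t
        size≤ = ≤-trans (+-mono-≤ (≤-reflexive recs≡) (+-monoˡ-≤ 3 R.fits)) (≤-reflexive (sym (+-assoc (3 * L) _ 3)))
        r+2<N : 2 + (b + length recs + length R.cells) < N
        r+2<N = begin-strict
          2 + (b + length recs + length R.cells)      ≤⟨ n≤1+n _ ⟩
          3 + (b + length recs + length R.cells)      ≡⟨ trans (+-comm 3 _) (trans (+-assoc (b + length recs) _ 3) (+-assoc b _ _)) ⟩
          b + (length recs + (length R.cells + 3))    ≤⟨ +-monoʳ-≤ b size≤ ⟩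
          b + thinSize t                              <⟨ b+size<N ⟩
          N                                           ∎
        fits : length (recs ++ (R.cells ++ record-cells)) ℕ.≤ thinSize t
        fits = ≤-trans (≤-reflexive (trans (length-++ recs) (cong (length recs +_) (length-++ R.cells)))) size≤
        thin-holds : ∀ {M r} → Seg M r record-cells → LeafRecords M b (leaves t) → TreeAt M t b R.root →
                     {r+2<N : suc (suc r) < N} → Thin M r t × int M r ≡ key
        thin-holds ((key≡ , _) ∷ (kind≡ , _) ∷ (ptr≡ , _) ∷ []) recs-at tree-at {r+2<N} = record
          { lo = b ; ptr = R.root ; kind≡ = kind≡ ; ptr≡ = ptr≡ ; r+2<N = r+2<N ; hi<N = hi<N
          ; tree = tree-at ; recs = recs-at ; valid = valid } , key≡

      Fail : Memory → Set c
      Fail M = Thin M failAddr (group leaf [])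

      -- A fat node spends 33 cells of its own: 22 reserved for the dictionary of its parent, 8 for
      -- the constant part of its own dictionary and 3 for its record. A thin node with L leaves
      -- uses 3 cells per leaf, at most 12 per leaf for the tree, and 25 for reserve and record, at
      -- most 40 * L altogether.
      nodeSize : List (Fin σ) → List Leaf → ℕ
      nodeSize Y E = 33 * (suc (length E) ∸ length Y) + 40 * length E

      -- Failed lookups below a fat node lead to the one fail record. It is stored outside the cells
      -- of the node, so the node is correct only relative to it.
      NodeAt : List (Fin σ) → ℕ → Memory → ℕ → Set (c ⊔ ℓ₁ ⊔ ℓ₂)
      NodeAt Y key M r = Fail M → Node M Y r × int M r ≡ key

      thinNode : ∀ {Y E key} → key < N → (∀ {e} → Match Y e → e ∈ E) → 0 < length E → length E ℕ.≤ length Y →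
                 Builder (NodeAt Y key) 22 (nodeSize Y E)
      thinNode {Y} {E} {key} key<N complete 0<E E≤Y b b+size<N = from-tree (nonempty E 0<E)
        where
        nonempty : ∀ E → 0 < length E → ∃[ e ] e ∈ E
        nonempty (e ∷ _) _ = e , here refl
        from-tree : ∃[ e ] e ∈ E → Layout (NodeAt Y key) 22 b (nodeSize Y E)
        from-tree (_ , e∈) = finish (build len≤n (length E) E e∈ ≤-refl)
          where
          finish : ∃[ t ] Valid n t × leaves t ↭ E → Layout (NodeAt Y key) 22 b (nodeSize Y E)
          finish (t , valid , perm) = record
            { cells = R.cells ; root = R.root ; root<N = R.root<N ; words = R.words
            ; fits  = ≤-trans (+-monoʳ-≤ 22 R.fits) size≤
            ; holds = λ seg _ → thin (proj₁ (R.holds seg)) (subst (ℕ._≤ length Y) (sym L≡) E≤Y)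
                                  (λ m → ∈-resp-↭ (↭-sym perm) (complete m)) , proj₂ (R.holds seg) }
            where
            open ≤-Reasoning
            L≡ : length (leaves t) ≡ length E
            L≡ = ↭-length perm
            arith : ∀ L → 22 + (3 * L + 6 * (2 * L) + 3) ≡ 15 * L + 25
            arith = solve 1 (λ L → con 22 :+ (con 3 :* L :+ con 6 :* (con 2 :* L) :+ con 3) := con 15 :* L :+ con 25) refl
              where open +-*-Solver
            size≤ : 22 + thinSize t ℕ.≤ nodeSize Y E
            size≤ = begin
              22 + (3 * length (leaves t) + 6 * nodes t + 3)
                ≤⟨ +-monoʳ-≤ 22 (+-monoˡ-≤ 3 (+-monoʳ-≤ (3 * length (leaves t)) (*-monoʳ-≤ 6 (<⇒≤ (nodes≤ t))))) ⟩
              22 + (3 * length (leaves t) + 6 * (2 * length (leaves t)) + 3)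
                ≡⟨ trans (arith (length (leaves t))) (cong (λ L → 15 * L + 25) L≡) ⟩
              15 * length E + 25
                ≤⟨ +-monoʳ-≤ (15 * length E) (*-monoʳ-≤ 25 0<E) ⟩
              15 * length E + 25 * length E
                ≡⟨ *-distribʳ-+ (length E) 15 25 ⟨
              40 * length E
                ≤⟨ m≤n+m _ (33 * (suc (length E) ∸ length Y)) ⟩
              nodeSize Y E ∎
            module R = Layout (thinLayout t key key<N valid b (≤-<-trans (+-monoʳ-≤ b (≤-trans (m≤n+m _ 22) size≤)) b+size<N))

      letterAt? : ∀ d a e → Dec (letter e d ≡ just a)
      letterAt? d a e = letter e d ≟ᴹ just a

      module FatNode (Y : List (Fin σ)) (E : List Leaf) where

        d : ℕ
        d = length Y

        child : Fin σ → List Leaf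
        child a = filter (letterAt? d a) E

        letters : List (Fin σ)
        letters = filter (λ a → Any.any? (letterAt? d a) E) (allFin σ)

        childSize : Fin σ → ℕ
        childSize a = nodeSize (Y ∷ʳ a) (child a)

        ∈-letters : ∀ {a e} → e ∈ E → letter e d ≡ just a → a ∈ letters
        ∈-letters {a} e∈ eq = ∈-filter⁺ (λ a → Any.any? (letterAt? d a) E) (∈-allFin a) (lose e∈ eq)

        letters-unique : Unique letters
        letters-unique = Unique-filter⁺ (λ a → Any.any? (letterAt? d a) E) (allFin⁺ σ)

        child-nonempty : ∀ {a} → a ∈ letters → 0 < length (child a)
        child-nonempty {a} a∈ = nonempty (find (proj₂ (∈-filter⁻ (λ a → Any.any? (letterAt? d a) E) {xs = allFin σ} a∈)))
          where
          nonempty : ∃[ e ] e ∈ E × letter e d ≡ just a → 0 < length (child a)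
          nonempty (e , e∈ , eq) = ∈-length (∈-filter⁺ (letterAt? d a) e∈ eq)

        -- A node with k leaves at depth d ≤ k has at most 1 + k ∸ d fat
        -- descendants, itself included; nodeSize charges 33 cells to each.
        children-size : d ℕ.≤ length E → ∑ letters childSize + 33 ℕ.≤ nodeSize Y E
        children-size d≤k = begin
          ∑ letters childSize + 33
            ≡⟨ cong (_+ 33) (trans (∑-cong letters (λ {a} _ → cong (λ m → 33 * (suc (k a) ∸ m) + 40 * k a) (length-∷ʳ Y)))
                 (trans (∑-+ letters (λ a → 33 * (k a ∸ d)) (λ a → 40 * k a))
                        (cong₂ _+_ (∑-*ˡ letters 33 (λ a → k a ∸ d)) (∑-*ˡ letters 40 k)))) ⟩
          33 * ∑ letters (λ a → k a ∸ d) + 40 * ∑ letters k + 33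
            ≤⟨ +-monoˡ-≤ 33 (+-mono-≤ (*-monoʳ-≤ 33 (≤-trans (∑-∸ letters k d) (∸-monoˡ-≤ d ∑k≤))) (*-monoʳ-≤ 40 ∑k≤)) ⟩
          33 * (length E ∸ d) + 40 * length E + 33
            ≡⟨ arith (length E ∸ d) (40 * length E) ⟩
          33 * suc (length E ∸ d) + 40 * length E
            ≡⟨ cong (λ m → 33 * m + 40 * length E) (sym (+-∸-assoc 1 d≤k)) ⟩
          nodeSize Y E ∎
          where
          open ≤-Reasoning
          k : Fin σ → ℕ
          k a = length (child a)
          ∑k≤ : ∑ letters k ℕ.≤ length E
          ∑k≤ = ∑-fibres≤ (λ a → letterAt? d a) letters-unique (λ p q → just-inj (trans (sym p) q)) E
            where
            just-inj : ∀ {a b : Fin σ} → just a ≡ just b → a ≡ b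
            just-inj refl = refl
          arith : ∀ x y → 33 * x + y + 33 ≡ 33 * suc x + y
          arith = solve 2 (λ x y → con 33 :* x :+ y :+ con 33 := con 33 :* (con 1 :+ x) :+ y) refl
            where open +-*-Solver

        module Assemble {key : ℕ} (key<N : key < N) (complete : ∀ {e} → Match Y e → e ∈ E) (d≤k : d ℕ.≤ length E)
                        (heavy avg : Carrier) (answer : Answers Y heavy avg)
                        (heavy∈ : 0# ≤ heavy × heavy ≤ 1#) (avg∈ : 0# ≤ avg × avg ≤ 1#)
                        (b : ℕ) (b+size<N : b + nodeSize Y E < N)
                        (children : Layouts (λ a → NodeAt (Y ∷ʳ a) (toℕ a)) letters 22 b (∑ letters childSize)) where

          open ≤-Reasoning

          private module C = Layouts children

          entry : Fin σ × ℕ → ℕ × ℕ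
          entry (a , r) = toℕ a , r

          entries : List (ℕ × ℕ)
          entries = map entry C.entries

          keys≡ : map proj₁ entries ≡ map toℕ letters
          keys≡ = trans (sym (map-∘ C.entries)) (trans (map-∘ C.entries) (cong (map toℕ) C.keys))

          entries-length : length entries ≡ length letters
          entries-length = trans (length-map entry C.entries)
            (trans (sym (length-map proj₁ C.entries)) (cong length C.keys))

          keys<N : ∀ {k} → k ∈ map proj₁ entries → k < N
          keys<N k∈ = from (∈-map⁻ toℕ (subst (_ ∈_) keys≡ k∈))
            where
            from : ∀ {k} → ∃[ a ] a ∈ letters × k ≡ toℕ a → k < N
            from (a , _ , refl) = <-≤-trans (Fin.toℕ<n a) σ≤N

          values<N : ∀ {e} → e ∈ entries → proj₂ e < N
          values<N e∈ = from (∈-map⁻ entry e∈)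
            where
            from : ∀ {e} → ∃[ x ] x ∈ C.entries × e ≡ entry x → proj₂ e < N
            from (x , x∈ , refl) = C.roots<N x∈

          unique : Unique (map proj₁ entries)
          unique = subst Unique (sym keys≡) (Unique-map⁺ Fin.toℕ-injective letters-unique)

          size≤ : length C.cells + ((22 * length entries + 8) + 3) ℕ.≤ ∑ letters childSize + 11
          size≤ = begin
            length C.cells + ((22 * length entries + 8) + 3)
              ≡⟨ cong (λ m → length C.cells + ((22 * m + 8) + 3)) entries-length ⟩
            length C.cells + ((22 * length letters + 8) + 3)
              ≡⟨ arith (length C.cells) (length letters) ⟩
            (length letters * 22 + length C.cells) + 11
              ≤⟨ +-monoˡ-≤ 11 C.fits ⟩
            ∑ letters childSize + 11 ∎
            where
            arith : ∀ x y → x + ((22 * y + 8) + 3) ≡ (y * 22 + x) + 11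
            arith = solve 2 (λ x y → x :+ ((con 22 :* y :+ con 8) :+ con 3) := (y :* con 22 :+ x) :+ con 11) refl
              where open +-*-Solver

          total≤ : 22 + (length C.cells + ((22 * length entries + 8) + 3)) ℕ.≤ nodeSize Y E
          total≤ = begin
            22 + (length C.cells + ((22 * length entries + 8) + 3))   ≤⟨ +-monoʳ-≤ 22 size≤ ⟩
            22 + (∑ letters childSize + 11)                           ≡⟨ arith (∑ letters childSize) ⟩
            ∑ letters childSize + 33                                  ≤⟨ children-size d≤k ⟩
            nodeSize Y E                                              ∎
            where
            arith : ∀ x → 22 + (x + 11) ≡ x + 33
            arith = solve 1 (λ x → con 22 :+ (x :+ con 11) := x :+ con 33) refl
              where open +-*-Solver

          total<N : b + (length C.cells + ((22 * length entries + 8) + 3)) < N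
          total<N = ≤-<-trans (+-monoʳ-≤ b (≤-trans (m≤n+m _ 22) total≤)) b+size<N

          DictLayout : Set (c ⊔ ℓ₂)
          DictLayout = Layout (Dict entries failAddr) 0 (b + length C.cells) (22 * length entries + 8)

          dict : failAddr < N → DictLayout
          dict fail<N = dictionary fail<N entries keys<N values<N unique (b + length C.cells) (begin-strict
            b + length C.cells + (22 * length entries + 8)     ≡⟨ +-assoc b _ _ ⟩
            b + (length C.cells + (22 * length entries + 8))   ≤⟨ +-monoʳ-≤ b (+-monoʳ-≤ (length C.cells) (m≤m+n _ 3)) ⟩
            b + (length C.cells + ((22 * length entries + 8) + 3)) <⟨ total<N ⟩
            N                                                  ∎)

          match⇒key : ∀ {x e} → Match (Y ∷ʳ x) e → toℕ x ∈ map proj₁ entries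
          match⇒key {x} {e} m = subst (toℕ x ∈_) (sym keys≡) (∈-map⁺ toℕ
            (∈-letters {x} {e} (complete (proj₁ (match-snoc⁻ {Y} {x} {e} m))) (proj₂ (match-snoc⁻ {Y} {x} {e} m))))

          Child : Memory → Fin σ → ℕ → Set (c ⊔ ℓ₁ ⊔ ℓ₂)
          Child M x r′ = (int M r′ ≡ toℕ x → Node M (Y ∷ʳ x) r′) × (int M r′ ≢ toℕ x → NoMatch (Y ∷ʳ x))

          -- The key of the fail record is 0 and may coincide with the letter looked up, so this
          -- record must be able to pass for a child. It does so as a thin node: it has one leaf at
          -- positive depth, and no leaf matches.
          fail-node : ∀ {M x} → Fail M → NoMatch (Y ∷ʳ x) → Node M (Y ∷ʳ x) failAddr
          fail-node {x = x} fail unmatched =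
            thin fail (subst (1 ℕ.≤_) (sym (length-∷ʳ Y)) (s≤s z≤n)) (λ {e} m → ⊥-elim (unmatched {e} m))

          -- If x continues Y in some leaf, it is among the keys and the dictionary returns its own
          -- record. A record with a different key thus proves that x leads nowhere.
          lookup⇒child : ∀ {M x r′} → Fail M →
                         (∀ {e} → e ∈ C.entries → NodeAt (Y ∷ʳ proj₁ e) (toℕ (proj₁ e)) M (proj₂ e)) →
                         Lookup entries failAddr (toℕ x) r′ → Child M x r′
          lookup⇒child {M} {x} {r′} fail nodes-hold (inj₁ (k , k∈ , only)) = from (∈-map⁻ entry k∈)
            where
            from : ∃[ y ] y ∈ C.entries × (k , r′) ≡ entry y → Child M x r′
            from ((a , r″) , y∈ , refl) =
              (λ eq → subst (λ a → Node M (Y ∷ʳ a) r′) (Fin.toℕ-injective (trans (sym (proj₂ node)) eq)) (proj₁ node)) ,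
              (λ ≢ {e} m → ≢ (trans (proj₂ node) (only (match⇒key {x} {e} m))))
              where
              node : Node M (Y ∷ʳ a) r′ × int M r′ ≡ toℕ a
              node = nodes-hold y∈ fail
          lookup⇒child {M} {x} fail nodes-hold (inj₂ (x∉ , refl)) = (λ _ → fail-node fail unmatched) , (λ _ {e} → unmatched {e})
            where
            unmatched : NoMatch (Y ∷ʳ x)
            unmatched {e} m = x∉ (match⇒key {x} {e} m)

          module Finish (dict : DictLayout) where

            private module D = Layout dict

            record-cells : List Cell
            record-cells = (key , heavy) ∷ (1 , avg) ∷ word D.root ∷ []

            r : ℕ
            r = b + length C.cells + length D.cells

            r+2<N : suc (suc r) < N
            r+2<N = begin-strict
              2 + r                                                ≤⟨ n≤1+n _ ⟩
              3 + r                                                ≡⟨ trans (+-comm 3 _) (trans (+-assoc (b + length C.cells) _ 3) (+-assoc b _ _)) ⟩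
              b + (length C.cells + (length D.cells + 3))          ≤⟨ +-monoʳ-≤ b (+-monoʳ-≤ (length C.cells) (+-monoˡ-≤ 3 D.fits)) ⟩
              b + (length C.cells + ((22 * length entries + 8) + 3)) <⟨ total<N ⟩
              N                                                    ∎

            fits : 22 + length (C.cells ++ (D.cells ++ record-cells)) ℕ.≤ nodeSize Y E
            fits = begin
              22 + length (C.cells ++ (D.cells ++ record-cells))
                ≡⟨ cong (22 +_) (trans (length-++ C.cells) (cong (length C.cells +_) (length-++ D.cells))) ⟩
              22 + (length C.cells + (length D.cells + 3))
                ≤⟨ +-monoʳ-≤ 22 (+-monoʳ-≤ (length C.cells) (+-monoˡ-≤ 3 D.fits)) ⟩
              22 + (length C.cells + ((22 * length entries + 8) + 3))
                ≤⟨ total≤ ⟩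
              nodeSize Y E ∎

            fat-layout : Layout (NodeAt Y key) 22 b (nodeSize Y E)
            fat-layout = record
              { cells  = C.cells ++ (D.cells ++ record-cells)
              ; root   = r
              ; root<N = ≤-<-trans (m≤n+m r 2) r+2<N
              ; words  = All.++⁺ C.words (All.++⁺ D.words
                  ((key<N , heavy∈) ∷
                   (≤-<-trans (s≤s z≤n) r+2<N , avg∈) ∷ word-ok D.root<N ∷ []))
              ; fits   = fits
              ; holds  = λ seg fail → fat-holds fail (C.holds (seg-++⁻ˡ C.cells seg))
                  (D.holds (seg-++⁻ˡ D.cells (seg-++⁻ʳ C.cells seg))) (seg-++⁻ʳ D.cells (seg-++⁻ʳ C.cells seg))
              }
              where
              fat-holds : ∀ {M} → Fail M →
                          (∀ {e} → e ∈ C.entries → NodeAt (Y ∷ʳ proj₁ e) (toℕ (proj₁ e)) M (proj₂ e)) →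
                          Dict entries failAddr M D.root → Seg M r record-cells →
                          Node M Y r × int M r ≡ key
              fat-holds {M} fail nodes-hold dict-holds ((key≡ , heavy≡) ∷ (kind≡ , avg≡) ∷ (ptr≡ , _) ∷ []) =
                fat (answer) heavy≡ kind≡ avg≡ ptr≡ r+2<N
                  (λ x → lookup-child x (dict-holds (toℕ x))) , key≡
                where
                lookup-child : ∀ x → ∃[ b ] ∃[ r′ ] Step M D.root (toℕ x) b × Step M b (toℕ x) r′ × Lookup entries failAddr (toℕ x) r′ →
                               ∃[ b ] ∃[ r′ ] Step M D.root (toℕ x) b × Step M b (toℕ x) r′ × Child M x r′
                lookup-child x (b , r′ , s₁ , s₂ , lk) = b , r′ , s₁ , s₂ , lookup⇒child fail nodes-hold lk

      -- The measure 1 + |E| ∸ |Y| is positive at a fat node and falls with every letter, as Y grows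
      -- while E does not. The fuel is thus exhausted only where the node is thin.
      node : ∀ fuel Y E {key} → key < N → failAddr < N → (∀ {e} → Match Y e → e ∈ E) → (∀ {e} → e ∈ E → Match Y e) →
             0 < length E → suc (length E) ∸ length Y ℕ.≤ fuel → Builder (NodeAt Y key) 22 (nodeSize Y E)
      node fuel Y E {key} key<N fail<N complete sound 0<E enough = by-size fuel enough (length Y ≤? length E)
        where
        head : ∀ E → 0 < length E → ∃[ e ] e ∈ E
        head (e ∷ _) _ = e , here refl
        by-size : ∀ fuel → suc (length E) ∸ length Y ℕ.≤ fuel → Dec (length Y ℕ.≤ length E) →
                  Builder (NodeAt Y key) 22 (nodeSize Y E)
        by-size fuel enough (no Y≰E) = thinNode key<N complete 0<E (<⇒≤ (≰⇒> Y≰E))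
        by-size zero enough (yes Y≤E) = ⊥-elim (<⇒≱ (m<n⇒0<n∸m (s≤s Y≤E)) enough)
        by-size (suc fuel) enough (yes Y≤E) =
          fatNode (answers (sound (proj₂ (head E 0<E))))
          where
          open FatNode Y E
          fatNode : ∃[ heavy ] ∃[ avg ] Answers Y heavy avg × (0# ≤ heavy × heavy ≤ 1#) × (0# ≤ avg × avg ≤ 1#) →
                    Builder (NodeAt Y key) 22 (nodeSize Y E)
          children-of : ∀ {a} → a ∈ letters → Builder (NodeAt (Y ∷ʳ a) (toℕ a)) 22 (childSize a)
          children-of {a} a∈ = node fuel (Y ∷ʳ a) (child a) (<-≤-trans (Fin.toℕ<n a) σ≤N) fail<N
            (λ {e} m → ∈-filter⁺ (letterAt? d a) (complete (proj₁ (match-snoc⁻ {Y} {a} {e} m))) (proj₂ (match-snoc⁻ {Y} {a} {e} m)))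
            (λ {e} e∈ → match-snoc⁺ {Y} {a} {e} (sound (proj₁ (∈-filter⁻ (letterAt? d a) {xs = E} e∈)))
                          (proj₂ (∈-filter⁻ (letterAt? d a) {xs = E} e∈)))
            (child-nonempty a∈) enough′
            where
            enough′ : suc (length (child a)) ∸ length (Y ∷ʳ a) ℕ.≤ fuel
            enough′ = ≤-trans (≤-reflexive (cong (suc (length (child a)) ∸_) (length-∷ʳ Y)))
              (≤-trans (∸-monoˡ-≤ d (length-filter (letterAt? d a) E))
                       (≤-pred (≤-trans (≤-reflexive (sym (+-∸-assoc 1 Y≤E))) enough)))
          fatNode (heavy , avg , answer , heavy∈ , avg∈) b b+size<N = A.Finish.fat-layout (A.dict fail<N)
            where
            module A = Assemble key<N complete Y≤E heavy avg answer heavy∈ avg∈ b b+size<N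
              (sequence {A = λ a → NodeAt (Y ∷ʳ a) (toℕ a)} letters {22} {childSize} children-of b
                (≤-<-trans (+-monoʳ-≤ b (≤-trans (m≤m+n _ 33) (children-size Y≤E))) b+size<N))

-- The query programs and rules for reasoning about their runs.

module Machine where

  open import Data.Bool.Base using (true; false; T)
  open import Data.Empty using (⊥-elim)
  open import Data.Fin.Base using (Fin; toℕ; fromℕ<)
  import Data.Fin.Properties as Fin
  open import Data.List.Base using (List; []; _∷_; _++_; length; map; lookup)
  open import Data.Nat.Base hiding (_⊔_)
  open import Data.Nat.DivMod using (m<n⇒m%n≡m)
  open import Data.Nat.Properties hiding (_≤?_)
  open import Data.Vec.Base using (Vec; toList)
  open import Defs
  open import Level as Level using (_⊔_)
  open Memory
  open import Relation.Binary.PropositionalEquality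
  open import Relation.Nullary using (¬_)
  open import Relation.Nullary.Decidable using (dec-true; dec-false; isYes≗does)

  -- Every branch must contain an instruction; this one overwrites register 13, which is never read.
  noop : Program
  noop = instr (dataI 13 10)

  step walkBody walk descendBody descend verifyBody verify gatherBody gather : Program

  -- Register 6 holds the key and register 11 the table; register 11 becomes the
  -- entry found.
  step = instr (dataI 7 11) ⨾ instr (opI add 8 11 1) ⨾ instr (dataI 9 8) ⨾ instr (opI add 8 8 1) ⨾
         instr (dataI 12 8) ⨾ instr (opI mul 7 7 6) ⨾ instr (opI shr 7 7 9) ⨾ instr (opI add 7 12 7) ⨾
         instr (dataI 11 7)

  -- Register 3 is the depth, 4 the address of the current record and 5 the bound of the loop.
  -- Multiplying the bound by the kind of the record reached turns it into 0 at a thin node, and the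
  -- loop stops there.
  walkBody = instr (patternLetter 6 3) ⨾ instr (opI add 7 4 1) ⨾ instr (opI add 7 7 1) ⨾ instr (dataI 11 7) ⨾
             step ⨾ step ⨾ instr (dataI 7 11) ⨾
             (if eqI 7 6 then instr (opI add 4 11 10) else instr (constI 4 10)) ⨾
             instr (opI add 3 3 1) ⨾ instr (opI add 7 4 1) ⨾ instr (dataI 8 7) ⨾ instr (opI mul 5 5 8)

  walk = while ltI 3 5 loop walkBody

  -- Register 9 is the address of the tree node and 6 its depth. The pointers for yes and no are at
  -- offsets 2 and 3.
  descendBody = instr (patternLetter 7 6) ⨾ instr (opI add 8 9 1) ⨾ instr (dataI 12 8) ⨾ instr (opI add 8 8 1) ⨾
                (if eqI 7 12 then instr (dataI 9 8) else (instr (opI add 8 8 1) ⨾ instr (dataI 9 8))) ⨾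
                instr (dataI 6 9)

  descend = while ltI 6 2 loop descendBody

  -- A mismatch sets the bound to 0 and leaves the count in register 3 below m; comparing this
  -- register with m afterwards tells whether the candidate matches.
  verifyBody = instr (patternLetter 6 3) ⨾ instr (opI add 7 14 3) ⨾ instr (dataI 8 7) ⨾
               (if eqI 6 8 then instr (opI add 3 3 1) else instr (opI add 5 10 10))

  verify = while ltI 3 5 loop verifyBody

  -- The maximum may be updated for every leaf, but sum and number only if the position in register
  -- 6 is still unmarked. With no move between probability registers, a new maximum is obtained by
  -- repeating the division.
  gatherBody = instr (dataI 6 11) ⨾ instr (opI add 7 11 1) ⨾ instr (dataI 8 7) ⨾ instr (opI add 7 7 1) ⨾
               instr (dataP 3 8) ⨾ instr (opI add 9 8 2) ⨾ instr (dataP 4 9) ⨾ instr (opP div 5 4 3) ⨾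
               (if leP 0 5 then instr (opP div 0 4 3) else noop) ⨾
               instr (loadI 9 6) ⨾
               (if eqI 9 10 then (instr (storeI 6 1) ⨾ instr (opP add 1 5 1) ⨾ instr (oneP 6) ⨾ instr (opP add 2 6 2))
                else noop) ⨾
               instr (opI add 11 7 1)

  gather = while ltI 11 12 loop gatherBody

  fatOutput thinOutput search : Program

  -- The stored mean is presented as a sum over a single occurrence, so that both kinds of node end
  -- with the same division.
  fatOutput = instr (dataP 0 4) ⨾ instr (dataP 1 7) ⨾ instr (oneP 2) ⨾ instr (constI 0 1)

  thinOutput = instr (opI add 7 7 1) ⨾ instr (dataI 9 7) ⨾ instr (dataI 6 9) ⨾ descend ⨾
               instr (opI add 8 9 1) ⨾ instr (opI add 8 8 1) ⨾ instr (opI add 8 8 1) ⨾ instr (opI add 8 8 1) ⨾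
               instr (dataI 11 8) ⨾ instr (opI add 8 8 1) ⨾ instr (dataI 12 8) ⨾
               instr (opI add 8 11 1) ⨾ instr (dataI 14 8) ⨾ instr (opI add 8 8 1) ⨾ instr (dataI 15 8) ⨾
               instr (opI add 3 10 10) ⨾
               -- A candidate shorter than the pattern gets the bound 0, so no letter is compared
               -- and the check fails.
               (if ltI 15 2 then instr (opI add 5 10 10) else instr (patternLength 5)) ⨾
               verify ⨾
               (if eqI 3 2 then (instr (constI 0 1) ⨾ gather) else noop)

  search = instr (patternLength 5) ⨾ walk ⨾ instr (opI add 7 4 1) ⨾ instr (dataI 8 7) ⨾
           (if eqI 8 1 then fatOutput else thinOutput)

  -- Probability registers 0, 1 and 2 hold the maximum, the sum and the number of
  -- the occurrence probabilities; integer register 10 stays 0.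
  finish program : Query → Program

  finish heaviest = noop
  finish average  = instr (opP div 0 1 2)

  program q = instr (constI 1 1) ⨾ instr (patternLength 2) ⨾ instr (dataI 4 10) ⨾
              (if eqI 4 10 then noop else (search ⨾ finish q))

  module Execution {c ℓ₁ ℓ₂} (F : ArchimedeanField c ℓ₁ ℓ₂) {w σ m : ℕ}
                   (D : WordRAM.DataStructure F w) (P : Vec (Fin σ) m) (σ≤N : σ ≤ 2 ^ w) (m<N : m < 2 ^ w) where
    open ArchimedeanField F using (Carrier; 0#; 1#; _≤?_) renaming (_≤_ to _≤ᶠ_)
    open WordRAM F public
    open Cells F using (Memory; int; prob)
    open WordArithmetic w
    open DataStructure D

    N : ℕ
    N = 2 ^ w

    M : Memory
    M = record { int = read 0 (map toℕ ints) ; prob = read 0# probs }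

    -- None of the programs stores a probability, so the probability memory keeps its initial
    -- content and need not be tracked.
    state : (ℕ → ℕ) → (ℕ → Carrier) → (ℕ → ℕ) → State
    state ir pr im = record { intReg = ir ; probReg = pr ; intMem = im ; probMem = λ _ → 0# }

    Post : ∀ q → Set (Level.suc q ⊔ c)
    Post q = (ℕ → ℕ) → (ℕ → Carrier) → (ℕ → ℕ) → Set q

    -- A total-correctness triple with a bound on the running time. The exact time stays
    -- existential, because different branches take different numbers of steps.
    record Run {q} (p : Program) (ir : ℕ → ℕ) (pr : ℕ → Carrier) (im : ℕ → ℕ) (k : ℕ) (Q : Post q) : Set (c ⊔ q) where
      constructor running
      field
        time     : ℕ
        ir′      : ℕ → ℕ
        pr′      : ℕ → Carrier
        im′      : ℕ → ℕ
        halts    : D , P ⊢⟨ p , state ir pr im ⟩⇓[ time ] state ir′ pr′ im′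
        in-time  : time ≤ k
        post     : Q ir′ pr′ im′

    -- As a data type this determines the instruction, register and value by unification; the bare
    -- equation between computed states would not reveal the instruction.
    data Assigns (ι : Instr) (ir : ℕ → ℕ) (pr : ℕ → Carrier) (im : ℕ → ℕ) (r v : ℕ) : Set c where
      assigns : exec D P ι (state ir pr im) ≡ state (update ir r v) pr im → Assigns ι ir pr im r v

    data AssignsP (ι : Instr) (ir : ℕ → ℕ) (pr : ℕ → Carrier) (im : ℕ → ℕ) (r : ℕ) (v : Carrier) : Set c where
      assigns : exec D P ι (state ir pr im) ≡ state ir (update pr r v) im → AssignsP ι ir pr im r v

    module _ {q} {Q : Post q} {ir : ℕ → ℕ} {pr : ℕ → Carrier} {im : ℕ → ℕ} where

      private
        first : ∀ {ι s p k ir′ pr′ im′} → exec D P ι s ≡ state ir′ pr′ im′ → s ≡ state ir pr im →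
                Run p ir′ pr′ im′ k Q → Run (instr ι ⨾ p) ir pr im (suc k) Q
        first {ι} {p = p} eq refl (running t _ _ _ halts t≤k post) =
          running (suc t) _ _ _ (seq instr (subst (λ s → D , P ⊢⟨ p , s ⟩⇓[ t ] _) (sym eq) halts)) (s≤s t≤k) post

        only : ∀ {ι ir′ pr′ im′} → exec D P ι (state ir pr im) ≡ state ir′ pr′ im′ → Q ir′ pr′ im′ →
               Run (instr ι) ir pr im 1 Q
        only {ι} eq post = running 1 _ _ _ (subst (λ s → D , P ⊢⟨ instr ι , state ir pr im ⟩⇓[ 1 ] s) eq instr) ≤-refl post

      infixr 4 _▸_ _▹_
      _▸_ : ∀ {ι r v p k} → Assigns ι ir pr im r v → Run p (update ir r v) pr im k Q → Run (instr ι ⨾ p) ir pr im (suc k) Q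
      assigns eq ▸ run = first eq refl run

      _▹_ : ∀ {ι r v p k} → AssignsP ι ir pr im r v → Run p ir (update pr r v) im k Q → Run (instr ι ⨾ p) ir pr im (suc k) Q
      assigns eq ▹ run = first eq refl run

      store : ∀ {a r x v p k} → ir a ≡ x → ir r ≡ v → Run p ir pr (update im x v) k Q →
              Run (instr (storeI a r) ⨾ p) ir pr im (suc k) Q
      store refl refl run = first refl refl run

      last : ∀ {ι r v} → Assigns ι ir pr im r v → Q (update ir r v) pr im → Run (instr ι) ir pr im 1 Q
      last (assigns eq) post = only eq post

      lastP : ∀ {ι r v} → AssignsP ι ir pr im r v → Q ir (update pr r v) im → Run (instr ι) ir pr im 1 Q
      lastP (assigns eq) post = only eq post

      infixr 4 _then_
      _then_ : ∀ {r} {R : Post r} {p p′ k k′} → Run p ir pr im k R →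
               (∀ {ir′ pr′ im′} → R ir′ pr′ im′ → Run p′ ir′ pr′ im′ k′ Q) → Run (p ⨾ p′) ir pr im (k + k′) Q
      running t _ _ _ halts t≤k post then cont with cont post
      ... | running t′ _ _ _ halts′ t′≤k′ post′ = running (t + t′) _ _ _ (seq halts halts′) (+-mono-≤ t≤k t′≤k′) post′

      if-yes : ∀ {b p p′ k} → test b (state ir pr im) ≡ true → Run p ir pr im k Q → Run (if b then p else p′) ir pr im (suc k) Q
      if-yes eq (running t _ _ _ halts t≤k post) = running (suc t) _ _ _ (if-true eq halts) (s≤s t≤k) post

      if-no : ∀ {b p p′ k} → test b (state ir pr im) ≡ false → Run p′ ir pr im k Q → Run (if b then p else p′) ir pr im (suc k) Q
      if-no eq (running t _ _ _ halts t≤k post) = running (suc t) _ _ _ (if-false eq halts) (s≤s t≤k) post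

      while-step : ∀ {r} {R : Post r} {b p k k′} → test b (state ir pr im) ≡ true → Run p ir pr im k R →
                   (∀ {ir′ pr′ im′} → R ir′ pr′ im′ → Run (while b loop p) ir′ pr′ im′ k′ Q) →
                   Run (while b loop p) ir pr im (suc (k + k′)) Q
      while-step eq (running t _ _ _ halts t≤k post) cont with cont post
      ... | running t′ _ _ _ halts′ t′≤k′ post′ =
        running (suc (t + t′)) _ _ _ (while-true eq halts halts′) (s≤s (+-mono-≤ t≤k t′≤k′)) post′

      while-stop : ∀ {b p} → test b (state ir pr im) ≡ false → Q ir pr im → Run (while b loop p) ir pr im 1 Q
      while-stop eq post = running 1 _ _ _ (while-false eq) ≤-refl post

      within : ∀ {p k k′} → k ≤ k′ → Run p ir pr im k Q → Run p ir pr im k′ Q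
      within k≤k′ (running t _ _ _ halts t≤k post) = running t _ _ _ halts (≤-trans t≤k k≤k′) post

    truncate-< : ∀ {x} → x < N → truncate x ≡ x
    truncate-< = m<n⇒m%n≡m {{m^n≢0 2 w}}

    module _ {ir : ℕ → ℕ} {pr : ℕ → Carrier} {im : ℕ → ℕ} {r : IntReg} where

      private
        value : ∀ {ι v v′} → exec D P ι (state ir pr im) ≡ state (update ir r v) pr im → v ≡ v′ → Assigns ι ir pr im r v′
        value eq refl = assigns eq

      op≡ : ∀ {o a b x y} → ir a ≡ x → ir b ≡ y → Assigns (opI o r a b) ir pr im r (⟦ o ⟧ᴵ x y)
      op≡ refl refl = assigns refl

      op≡′ : ∀ {o a b x y v} → ir a ≡ x → ir b ≡ y → ⟦ o ⟧ᴵ x y ≡ v → Assigns (opI o r a b) ir pr im r v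
      op≡′ refl refl eq = value refl eq

      add≡ : ∀ {a b x y} → ir a ≡ x → ir b ≡ y → x + y < N → Assigns (opI add r a b) ir pr im r (x + y)
      add≡ refl refl x+y<N = value refl (truncate-< x+y<N)

      inc≡ : ∀ {a x} → ir a ≡ x → ir 1 ≡ 1 → suc x < N → Assigns (opI add r a 1) ir pr im r (suc x)
      inc≡ {a} {x} refl one lt = value refl
        (trans (cong (λ y → truncate (x + y)) one) (trans (truncate-< (subst (_< N) (+-comm 1 x) lt)) (+-comm x 1)))

      copy≡ : ∀ {a x} → ir a ≡ x → ir 10 ≡ 0 → x < N → Assigns (opI add r a 10) ir pr im r x
      copy≡ {a} {x} refl ten lt = value refl
        (trans (cong (λ y → truncate (x + y)) ten) (trans (cong truncate (+-identityʳ x)) (truncate-< lt)))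

      data≡ : ∀ {a x v} → ir a ≡ x → int M x ≡ v → Assigns (dataI r a) ir pr im r v
      data≡ refl refl = assigns refl

      load≡ : ∀ {a x v} → ir a ≡ x → im x ≡ v → Assigns (loadI r a) ir pr im r v
      load≡ refl refl = assigns refl

      const≡ : ∀ {k} → k < N → Assigns (constI r k) ir pr im r k
      const≡ k<N = value refl (truncate-< k<N)

      length≡ : Assigns (patternLength r) ir pr im r m
      length≡ = value refl (truncate-< m<N)

      letter≡ : ∀ {a} Y {x Z} → ir a ≡ length Y → toList P ≡ Y ++ x ∷ Z → Assigns (patternLetter r a) ir pr im r (toℕ x)
      letter≡ Y {x} {Z} ea split = value refl
        (trans (cong truncate (trans (cong₂ (λ X k → read 0 (map toℕ X) k) split ea) (read-middle Y)))
               (truncate-< (<-≤-trans (Fin.toℕ<n x) σ≤N)))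
        where
        read-middle : ∀ Y → read 0 (map toℕ (Y ++ x ∷ Z)) (length Y) ≡ toℕ x
        read-middle []      = refl
        read-middle (y ∷ Y) = read-middle Y

      letterAt≡ : ∀ {a h} → ir a ≡ h → (h<m : h < length (toList P)) →
                  Assigns (patternLetter r a) ir pr im r (toℕ (lookup (toList P) (fromℕ< h<m)))
      letterAt≡ {h = h} refl h<m = value refl
        (trans (cong truncate (read-lookup (toList P) h<m)) (truncate-< (<-≤-trans (Fin.toℕ<n _) σ≤N)))
        where
        read-lookup : ∀ (Y : List (Fin σ)) {h} (h< : h < length Y) → read 0 (map toℕ Y) h ≡ toℕ (lookup Y (fromℕ< h<))
        read-lookup (y ∷ Y) {zero}  _        = refl
        read-lookup (y ∷ Y) {suc h} (s≤s h<) = read-lookup Y h<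

    module _ {ir : ℕ → ℕ} {pr : ℕ → Carrier} {im : ℕ → ℕ} {r : ProbReg} where

      dataP≡ : ∀ {a x v} → ir a ≡ x → prob M x ≡ v → AssignsP (dataP r a) ir pr im r v
      dataP≡ refl refl = assigns refl

      one≡ : AssignsP (oneP r) ir pr im r 1#
      one≡ = assigns refl

      opP≡ : ∀ {o a b} → AssignsP (opP o r a b) ir pr im r (⟦ o ⟧ᴾ (pr a) (pr b))
      opP≡ = assigns refl

    T⇒true : ∀ {b} → T b → b ≡ true
    T⇒true {true} _ = refl

    ¬T⇒false : ∀ {b} → ¬ T b → b ≡ false
    ¬T⇒false {true}  ¬t = ⊥-elim (¬t _)
    ¬T⇒false {false} _  = refl

    module _ {q} {Q : Post q} {ir : ℕ → ℕ} {pr : ℕ → Carrier} {im : ℕ → ℕ} {a b : IntReg} {x y : ℕ}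
             (ea : ir a ≡ x) (eb : ir b ≡ y) where

      if-≡ : ∀ {p p′ k} → x ≡ y → Run p ir pr im k Q → Run (if eqI a b then p else p′) ir pr im (suc k) Q
      if-≡ x≡y = if-yes (T⇒true (≡⇒≡ᵇ _ _ (trans ea (trans x≡y (sym eb)))))

      if-≢ : ∀ {p p′ k} → x ≢ y → Run p′ ir pr im k Q → Run (if eqI a b then p else p′) ir pr im (suc k) Q
      if-≢ x≢y = if-no (¬T⇒false (λ t → x≢y (trans (sym ea) (trans (≡ᵇ⇒≡ _ _ t) eb))))

      if-< : ∀ {p p′ k} → x < y → Run p ir pr im k Q → Run (if ltI a b then p else p′) ir pr im (suc k) Q
      if-< x<y = if-yes (T⇒true (<⇒<ᵇ (subst₂ _<_ (sym ea) (sym eb) x<y)))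

      if-≥ : ∀ {p p′ k} → y ≤ x → Run p′ ir pr im k Q → Run (if ltI a b then p else p′) ir pr im (suc k) Q
      if-≥ y≤x = if-no (¬T⇒false (λ t → ≤⇒≯ y≤x (subst₂ _<_ ea eb (<ᵇ⇒< _ _ t))))

      while-< : ∀ {r} {R : Post r} {p k k′} → x < y → Run p ir pr im k R →
                (∀ {ir′ pr′ im′} → R ir′ pr′ im′ → Run (while ltI a b loop p) ir′ pr′ im′ k′ Q) →
                Run (while ltI a b loop p) ir pr im (suc (k + k′)) Q
      while-< x<y = while-step (T⇒true (<⇒<ᵇ (subst₂ _<_ (sym ea) (sym eb) x<y)))

      while-≥ : ∀ {p} → y ≤ x → Q ir pr im → Run (while ltI a b loop p) ir pr im 1 Q
      while-≥ y≤x = while-stop (¬T⇒false (λ t → ≤⇒≯ y≤x (subst₂ _<_ ea eb (<ᵇ⇒< _ _ t))))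

    module _ {q} {Q : Post q} {ir : ℕ → ℕ} {pr : ℕ → Carrier} {im : ℕ → ℕ} {a b : ProbReg} where

      if-≤ᶠ : ∀ {p p′ k} → pr a ≤ᶠ pr b → Run p ir pr im k Q → Run (if leP a b then p else p′) ir pr im (suc k) Q
      if-≤ᶠ le = if-yes (trans (isYes≗does (pr a ≤? pr b)) (dec-true (pr a ≤? pr b) le))

      if-≰ᶠ : ∀ {p p′ k} → ¬ (pr a ≤ᶠ pr b) → Run p′ ir pr im k Q → Run (if leP a b then p else p′) ir pr im (suc k) Q
      if-≰ᶠ ¬le = if-no (trans (isYes≗does (pr a ≤? pr b)) (dec-false (pr a ≤? pr b) ¬le))

-- Correctness and cost of walking through the fat nodes and descending a tree.

module Walk where

  open Colouring using (Agree)
  open import Data.Empty using (⊥-elim)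
  open import Data.Fin.Base using (Fin; toℕ; fromℕ<)
  import Data.Fin.Properties as Fin
  open import Data.List.Base using (List; []; _∷_; _++_; _∷ʳ_; length; lookup; concatMap)
  open import Data.List.Membership.Propositional using (_∈_)
  open import Data.List.Membership.Propositional.Properties using (∈-++⁻)
  open import Data.List.Properties using (++-assoc; ++-identityʳ; length-++; concatMap-++)
  open import Data.Maybe.Base using (just)
  open import Data.Maybe.Properties using (just-injective)
  open import Data.Nat.Base
  open import Data.Nat.Properties
  open import Data.Product.Base using (_×_; _,_; proj₁; proj₂; ∃-syntax)
  open import Data.Sum.Base using (_⊎_; inj₁; inj₂)
  open import Data.Unit.Base using (tt)
  open import Data.Vec.Base using (Vec; toList)
  open import Data.Vec.Properties using (length-toList)
  open import Defs
  open Index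
  open import Level using () renaming (_⊔_ to _⊔ˡ_)
  open Machine
  open import Relation.Binary.PropositionalEquality
  open import Relation.Nullary using (Dec; yes; no)

  agree-++⁻ˡ : ∀ {σ} (Y : List (Fin σ)) {Z f} → Agree (Y ++ Z) f → Agree Y f
  agree-++⁻ˡ []      _          = tt
  agree-++⁻ˡ (y ∷ Y) (eq , agr) = eq , agree-++⁻ˡ Y agr

  module Walking {c ℓ₁ ℓ₂} (F : ArchimedeanField c ℓ₁ ℓ₂) {n σ : ℕ} (T : WeightedSequences.WeightedSequence F n σ)
                 (z : ArchimedeanField.Carrier F) (sys : LeafSystem F T z) {w m : ℕ}
                 (D : WordRAM.DataStructure F w) (P : Vec (Fin σ) m) (σ≤N : σ ≤ 2 ^ w) (m<N : m < 2 ^ w) where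
    open ArchimedeanField F using (Carrier; 0#)
    open Indexing F T z sys w
    open Execution F D P σ≤N m<N hiding (N)

    match-++⁻ˡ : ∀ Y {Z e} → Match (Y ++ Z) e → Match Y e
    match-++⁻ˡ Y (le , agr) = ≤-trans (≤-trans (m≤m+n (length Y) _) (≤-reflexive (sym (length-++ Y)))) le , agree-++⁻ˡ Y agr

    record Base (ir : ℕ → ℕ) (pr : ℕ → Carrier) (im : ℕ → ℕ) : Set c where
      field
        flag : ir 0 ≡ 0
        one  : ir 1 ≡ 1
        two  : ir 2 ≡ m
        ten  : ir 10 ≡ 0
        mem  : ∀ k → im k ≡ 0
        max0 : pr 0 ≡ 0#
        sum0 : pr 1 ≡ 0#
        num0 : pr 2 ≡ 0#

    frame : ∀ {ir ir′ pr im} → Base ir pr im → ir′ 0 ≡ ir 0 → ir′ 1 ≡ ir 1 → ir′ 2 ≡ ir 2 → ir′ 10 ≡ ir 10 → Base ir′ pr im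
    frame b e0 e1 e2 e10 = record { flag = trans e0 flag ; one = trans e1 one ; two = trans e2 two ; ten = trans e10 ten
                                  ; mem = mem ; max0 = max0 ; sum0 = sum0 ; num0 = num0 }
      where open Base b

    record At (d r v : ℕ) (ir : ℕ → ℕ) (pr : ℕ → Carrier) (im : ℕ → ℕ) : Set c where
      field
        base  : Base ir pr im
        three : ir 3 ≡ d
        four  : ir 4 ≡ r
        five  : ir 5 ≡ v
      open Base base public

    module _ {H x r} (st : Step M H x r) where
      open Step st

      -- The register file is written out in full, so that later reads of any register hold by
      -- computation.
      stepRegs : (ℕ → ℕ) → ℕ → ℕ
      stepRegs ir = update (update (update (update (update (update (update (update (update ir 7 mult) 8 (suc H)) 9 shift)
        8 (suc (suc H))) 12 table) 7 (WordArithmetic.⟦_⟧ᴵ w mul mult x)) 7 (hash mult shift x))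
        7 (table + hash mult shift x)) 11 r

      step-run : ∀ {ir pr im} → ir 11 ≡ H → ir 6 ≡ x → ir 1 ≡ 1 →
                 Run step ir pr im 9 (λ ir′ pr′ im′ → ir′ ≡ stepRegs ir × pr′ ≡ pr × im′ ≡ im)
      step-run e11 e6 e1 =
        data≡ e11 mult≡ ▸ inc≡ e11 e1 (<⇒≤ H+2<N) ▸ data≡ refl shift≡ ▸ inc≡ refl e1 H+2<N ▸ data≡ refl table≡ ▸
        op≡ refl e6 ▸ op≡ refl refl ▸ add≡ refl refl inside ▸ last (data≡ refl value) (refl , refl , refl)

    -- The loop bound in force at a node: m lets the walk continue to the end of the pattern, 0 ends
    -- it at once.
    stop : ∀ {M Y r} → Node M Y r → ℕ
    stop (fat _ _ _ _ _ _ _) = m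
    stop (thin _ _ _)        = 0

    kind : ∀ {M Y r} → Node M Y r → ℕ
    kind (fat _ _ _ _ _ _ _) = 1
    kind (thin _ _ _)        = 0

    kind≡ : ∀ {M Y r} (nd : Node M Y r) → int M (suc r) ≡ kind nd
    kind≡ (fat _ _ k≡ _ _ _ _) = k≡
    kind≡ (thin th _ _)        = Thin.kind≡ th

    node-r+2<N : ∀ {M Y r} → Node M Y r → suc (suc r) < N
    node-r+2<N (fat _ _ _ _ _ r+2<N _) = r+2<N
    node-r+2<N (thin th _ _)           = Thin.r+2<N th

    stop≡ : ∀ {M Y r} (nd : Node M Y r) → WordArithmetic.⟦_⟧ᴵ w mul m (kind nd) ≡ stop nd
    stop≡ (fat _ _ _ _ _ _ _) = trans (truncate-< (subst (_< N) (sym (*-identityʳ m)) m<N)) (*-identityʳ m)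
    stop≡ (thin _ _ _)        = trans (cong (WordArithmetic.truncate w) (*-zeroʳ m)) (truncate-< (≤-<-trans z≤n m<N))

    data Exit (ir : ℕ → ℕ) (pr : ℕ → Carrier) (im : ℕ → ℕ) : Set (c ⊔ˡ ℓ₁ ⊔ˡ ℓ₂) where
      fat-exit  : ∀ {d r v heavy avg} → At d r v ir pr im → Answers (toList P) heavy avg →
                  prob M r ≡ heavy → int M (suc r) ≡ 1 → prob M (suc r) ≡ avg → suc (suc r) < N → Exit ir pr im
      thin-exit : ∀ {d r v t} → At d r v ir pr im → Thin M r t → length (leaves t) ≤ m →
                  (∀ {e} → Match (toList P) e → e ∈ leaves t) → Exit ir pr im

    length-split : ∀ Y {Z} → toList P ≡ Y ++ Z → m ≡ length Y + length Z
    length-split Y P≡ = trans (sym (length-toList P)) (trans (cong length P≡) (length-++ Y))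

    split-< : ∀ Y {x Z} → toList P ≡ Y ++ x ∷ Z → length Y < m
    split-< Y {x} {Z} P≡ = subst (length Y <_) (sym (length-split Y P≡)) (m<m+n (length Y) z<s)

    module _ (fail : Thin M failAddr (group leaf [])) where

      private
        fail<N : failAddr < N
        fail<N = <-trans (n<1+n _) (<-trans (n<1+n _) (Thin.r+2<N fail))

      Child : List (Fin σ) → Fin σ → ℕ → Set (c ⊔ˡ ℓ₁ ⊔ˡ ℓ₂)
      Child Y x r = (int M r ≡ toℕ x → Node M (Y ∷ʳ x) r) × (int M r ≢ toℕ x → NoMatch (Y ∷ʳ x))

      Enter : List (Fin σ) → Fin σ → Post (c ⊔ˡ ℓ₁ ⊔ˡ ℓ₂)
      Enter Y x ir pr im = ∃[ r ] Node M (Y ∷ʳ x) r × At (length Y) r m ir pr im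

      -- On a wrong key the walk moves to the fail record instead of leaving the loop. A mismatch
      -- thereby becomes the case of a thin node in which nothing matches.
      enter-run : ∀ {ir pr im r r′} Y x → At (length Y) r m ir pr im → ir 6 ≡ toℕ x → ir 7 ≡ int M r′ →
                  ir 11 ≡ r′ → Child Y x r′ →
                  Run (if eqI 7 6 then instr (opI add 4 11 10) else instr (constI 4 10)) ir pr im 2 (Enter Y x)
      enter-run {ir} {pr} {im} {r′ = r′} Y x at e6 e7 e11 (found , absent) = by (int M r′ ≟ toℕ x)
        where
        open At at
        at′ : ∀ r″ → At (length Y) r″ m (update ir 4 r″) pr im
        at′ r″ = record { base = frame base refl refl refl refl
                        ; three = three ; four = refl ; five = five }
        by : Dec (int M r′ ≡ toℕ x) →
             Run (if eqI 7 6 then instr (opI add 4 11 10) else instr (constI 4 10)) ir pr im 2 (Enter Y x)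
        by (yes eq) = if-≡ e7 e6 eq
          (last (copy≡ e11 ten (<-trans (n<1+n _) (<-trans (n<1+n _) (node-r+2<N (found eq))))) (r′ , found eq , at′ r′))
        by (no key≢) = if-≢ e7 e6 key≢
          (last (const≡ fail<N)
                (failAddr , thin fail (subst (1 ≤_) (sym (length-∷ʳ Y)) (s≤s z≤n)) (λ {e} mt → ⊥-elim (absent key≢ {e} mt)) , at′ failAddr))

      Next : List (Fin σ) → Fin σ → Post (c ⊔ˡ ℓ₁ ⊔ˡ ℓ₂)
      Next Y x ir pr im = ∃[ r ] ∃[ nd ] At (length (Y ∷ʳ x)) r (stop {M} {Y ∷ʳ x} {r} nd) ir pr im

      advance-run : ∀ {ir pr im} Y x {Z} → toList P ≡ Y ++ x ∷ Z → Enter Y x ir pr im →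
                    Run (instr (opI add 3 3 1) ⨾ instr (opI add 7 4 1) ⨾ instr (dataI 8 7) ⨾ instr (opI mul 5 5 8))
                        ir pr im 4 (Next Y x)
      advance-run Y x P≡ (r , nd , at) =
        inc≡ three one (≤-<-trans (split-< Y P≡) m<N) ▸ inc≡ four one (<-trans (n<1+n _) (node-r+2<N nd)) ▸
        data≡ refl (kind≡ nd) ▸ last (op≡′ five refl (stop≡ nd))
          (r , nd , record
            { base = frame base refl refl refl refl
            ; three = sym (length-∷ʳ Y) ; four = four ; five = refl })
        where open At at

      body-run : ∀ {ir pr im r H b r′} Y x {Z} → toList P ≡ Y ++ x ∷ Z → At (length Y) r m ir pr im →
                 int M (suc (suc r)) ≡ H → suc (suc r) < N → Step M H (toℕ x) b → Step M b (toℕ x) r′ →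
                 Child Y x r′ → Run walkBody ir pr im 29 (Next Y x)
      body-run Y x P≡ at ptr≡ r+2<N st₁ st₂ child =
        letter≡ Y three P≡ ▸ inc≡ four one (<-trans (n<1+n _) r+2<N) ▸ inc≡ refl one r+2<N ▸ data≡ refl ptr≡ ▸
        step-run st₁ refl refl one then λ { (refl , refl , refl) →
        step-run st₂ refl refl one then λ { (refl , refl , refl) →
        data≡ refl refl ▸
        enter-run Y x (record
          { base = frame base refl refl refl refl
          ; three = three ; four = four ; five = five }) refl refl refl child then λ entered →
        advance-run Y x P≡ entered } }
        where open At at

      -- Y has been read and Z remains; each letter costs 29 steps and one test. At a thin node the
      -- candidates for Y also contain those for the whole pattern, since a match of the pattern
      -- matches its prefix Y.
      walk-run : ∀ Z Y {ir pr im r} → toList P ≡ Y ++ Z → (nd : Node M Y r) → At (length Y) r (stop nd) ir pr im →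
                 Run walk ir pr im (1 + length Z * 30) Exit
      walk-run Z Y P≡ (thin th small complete) at = within (s≤s z≤n)
        (while-≥ three five z≤n
          (thin-exit at th (≤-trans small (subst (length Y ≤_) (sym (length-split Y P≡)) (m≤m+n _ _)))
            (λ {e} mt → complete (match-++⁻ˡ Y {Z} {e} (subst (λ X → Match X e) P≡ mt)))))
        where open At at
      walk-run [] Y P≡ (fat answers heavy≡ k≡ avg≡ ptr≡ r+2<N children) at =
        while-≥ three five (≤-reflexive (trans (length-split Y P≡) (+-identityʳ _)))
          (fat-exit at (subst (λ X → Answers X _ _) (sym (trans P≡ (++-identityʳ Y))) answers) heavy≡ k≡ avg≡ r+2<N)
        where open At at
      walk-run (x ∷ Z) Y P≡ (fat answers heavy≡ k≡ avg≡ ptr≡ r+2<N children) at = go (children x)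
        where
        open At at
        go : _ → Run walk _ _ _ (1 + length (x ∷ Z) * 30) Exit
        go (b , r′ , st₁ , st₂ , found , absent) = within (≤-reflexive (cong (30 +_) (sym (+-suc 0 (length Z * 30)))))
          (while-< three five (split-< Y P≡)
            (body-run Y x P≡ at ptr≡ r+2<N st₁ st₂ (found , absent))
            (λ { (r″ , nd , at′) → walk-run Z (Y ∷ʳ x) (trans P≡ (sym (++-assoc Y (x ∷ []) Z))) nd at′ }))

    treeHead : Tree → ℕ
    treeHead (group _ _)     = N ∸ 1
    treeHead (split h _ _ _) = h

    treeHead≡ : ∀ {M} t {lo a} → TreeAt M t lo a → int M a ≡ treeHead t
    treeHead≡ (group _ _)     ((h≡ , _) ∷ _ , _)         = h≡
    treeHead≡ (split _ _ _ _) (_ , _ , (h≡ , _) ∷ _ , _) = h≡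

    record Descending (t : Tree) (lo a : ℕ) (ir : ℕ → ℕ) (pr : ℕ → Carrier) (im : ℕ → ℕ) : Set c where
      field
        base  : Base ir pr im
        six   : ir 6 ≡ treeHead t
        nine  : ir 9 ≡ a
        tree  : TreeAt M t lo a
        recs  : LeafRecords M lo (leaves t)
        hi<N  : lo + 3 * length (leaves t) < N
        complete : ∀ {e} → Match (toList P) e → e ∈ leaves t
      open Base base public

    Found : ℕ → Post c
    Found k ir pr im = ∃[ t ] ∃[ lo ] ∃[ a ] Descending t lo a ir pr im × Coherent m (leaves t) × length (leaves t) ≤ k

    leafRecords-++ : ∀ {M lo} A {B} → LeafRecords M lo (A ++ B) →
                     LeafRecords M lo A × LeafRecords M (lo + 3 * length A) B
    leafRecords-++ {M} {lo} A {B} recs =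
      seg-++⁻ˡ (concatMap leafCells A) recs′ ,
      subst (λ k → LeafRecords M (lo + k) B) (length-leafCells A) (seg-++⁻ʳ (concatMap leafCells A) recs′)
      where
      recs′ : Seg M lo (concatMap leafCells A ++ concatMap leafCells B)
      recs′ = subst (Seg M lo) (concatMap-++ leafCells A B) recs

    module _ {h x y t lo a ir pr im} (valid : Valid n (split h x y t))
             (st : Descending (split h x y t) lo a ir pr im) (h<m : h < m) where
      open Descending st

      private
        h<P : h < length (toList P)
        h<P = subst (h <_) (sym (length-toList P)) h<m

        p : Fin σ
        p = lookup (toList P) (fromℕ< h<P)

        letter≡p : ∀ {e} → Match (toList P) e → letter e h ≡ just p
        letter≡p {e} mt = subst (λ k → letter e k ≡ just p) (Fin.toℕ-fromℕ< h<P) (match⇒letter {toList P} {e} mt (fromℕ< h<P))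

        lo′ : ℕ
        lo′ = lo + 3 * length (leaves y)

        hi≡ : lo + 3 * length (leaves y ++ leaves t) ≡ lo′ + 3 * length (leaves t)
        hi≡ = trans (cong (λ k → lo + 3 * k) (length-++ (leaves y)))
          (trans (cong (lo +_) (*-distribˡ-+ 3 (length (leaves y)) _)) (sym (+-assoc lo _ _)))

      Branched : Post c
      Branched ir pr im = (p ≡ x × ∃[ a ] Descending y lo a ir pr im) ⊎ (p ≢ x × ∃[ a ] Descending t lo′ a ir pr im)

      Chosen : ℕ → Post c
      Chosen a ir pr im = Base ir pr im × ir 9 ≡ a

      -- Every leaf that matches the pattern has the letter p at depth h, so all of them are on the
      -- side taken, and the candidates remain complete.
      branch-run : ∀ {ir pr im ay at} → Base ir pr im → ir 7 ≡ toℕ p → ir 12 ≡ toℕ x → ir 8 ≡ suc (suc a) →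
                   int M (suc (suc a)) ≡ ay → int M (suc (suc (suc a))) ≡ at → suc (suc (suc a)) < N →
                   TreeAt M y lo ay → TreeAt M t lo′ at →
                   Run ((if eqI 7 12 then instr (dataI 9 8) else (instr (opI add 8 8 1) ⨾ instr (dataI 9 8))) ⨾ instr (dataI 6 9))
                       ir pr im 4 Branched
      branch-run {ir} {pr} {im} {ay} {at} base e7 e12 e8 ay≡ at≡ a+3<N tree-y tree-t = by valid (p Fin.≟ x)
        where
        by : Valid n (split h x y t) → Dec (p ≡ x) →
             Run ((if eqI 7 12 then instr (dataI 9 8) else (instr (opI add 8 8 1) ⨾ instr (dataI 9 8))) ⨾ instr (dataI 6 9))
                 ir pr im 4 Branched
        by (split _ _ all-y none-t _ _) (yes p≡x) = within (s≤s (s≤s (s≤s z≤n)))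
          (_then_ {R = Chosen ay} (if-≡ e7 e12 (cong toℕ p≡x) (last (data≡ e8 ay≡) (base′ , refl))) λ (b , nine) →
           last (data≡ nine (treeHead≡ y tree-y)) (inj₁ (p≡x , ay , record
             { base = frame b refl refl refl refl
             ; six = refl ; nine = nine ; tree = tree-y ; recs = proj₁ (leafRecords-++ (leaves y) recs)
             ; hi<N = ≤-<-trans (m≤m+n (lo + 3 * length (leaves y)) _) (subst (_< N) hi≡ hi<N)
             ; complete = λ {e} mt → in-y {e} mt (∈-++⁻ (leaves y) (complete {e} mt)) })))
          where
          base′ : Base (update ir 9 ay) pr im
          base′ = frame base refl refl refl refl
          in-y : ∀ {e} → Match (toList P) e → e ∈ leaves y ⊎ e ∈ leaves t → e ∈ leaves y
          in-y mt (inj₁ e∈) = e∈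
          in-y {e} mt (inj₂ e∈) = ⊥-elim (none-t e∈ (trans (letter≡p {e} mt) (cong just p≡x)))
        by (split _ _ all-y none-t _ _) (no p≢x) =
          _then_ {R = Chosen at} (if-≢ e7 e12 (λ eq → p≢x (Fin.toℕ-injective eq))
            (inc≡ e8 (Base.one base) a+3<N ▸ last (data≡ refl at≡) (base′ , refl))) λ (b , nine) →
           last (data≡ nine (treeHead≡ t tree-t)) (inj₂ (p≢x , at , record
             { base = frame b refl refl refl refl
             ; six = refl ; nine = nine ; tree = tree-t ; recs = proj₂ (leafRecords-++ (leaves y) recs)
             ; hi<N = subst (_< N) hi≡ hi<N
             ; complete = λ {e} mt → in-t {e} mt (∈-++⁻ (leaves y) (complete {e} mt)) }))
          where
          base′ : Base (update (update ir 8 (suc (suc (suc a)))) 9 at) pr im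
          base′ = frame base refl refl refl refl
          in-t : ∀ {e} → Match (toList P) e → e ∈ leaves y ⊎ e ∈ leaves t → e ∈ leaves t
          in-t {e} mt (inj₁ e∈) = ⊥-elim (p≢x (just-injective (trans (sym (letter≡p {e} mt)) (all-y e∈))))
          in-t mt (inj₂ e∈) = e∈

      descendBody-run : Run descendBody ir pr im 8 Branched
      descendBody-run = go tree
        where
        go : TreeAt M (split h x y t) lo a → Run descendBody ir pr im 8 Branched
        go (ay , at , (_ ∷ (x≡ , _) ∷ (ay≡ , _) ∷ (at≡ , _) ∷ _) , 5+a<N , tree-y , tree-t) =
          letterAt≡ six h<P ▸ inc≡ nine one (≤-<-trans (m≤n+m (suc a) 4) 5+a<N) ▸ data≡ refl x≡ ▸
          inc≡ refl one (≤-<-trans (m≤n+m (suc (suc a)) 3) 5+a<N) ▸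
          branch-run (frame base refl refl refl refl)
            refl refl refl ay≡ at≡ (≤-<-trans (m≤n+m (suc (suc (suc a))) 2) 5+a<N) tree-y tree-t

    coherent-≤ : ∀ {k E} → m ≤ k → Coherent k E → Coherent m E
    coherent-≤ m≤k coherent e∈ e′∈ t<m = coherent e∈ e′∈ (<-≤-trans t<m m≤k)

    -- Both subtrees of a split are nonempty, so each round of nine steps discards a leaf and ten
    -- steps per leaf pay for a path of any shape. The descent stops at a depth not below m, where
    -- all remaining leaves agree on the first m letters.
    descend-run : ∀ t {lo a ir pr im} → Valid n t → Descending t lo a ir pr im →
                  Run descend ir pr im (length (leaves t) * 10) (Found (length (leaves t)))
    descend-run (group e es) (group coherent) st = within (s≤s z≤n)
      (while-≥ six two (∸-monoˡ-≤ 1 m<N) (_ , _ , _ , st , coherent m , ≤-refl))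
      where open Descending st
    descend-run (split h x y t) valid@(split _ coherent _ _ valid-y valid-t) st = by (h <? m)
      where
      open Descending st
      open ≤-Reasoning
      L R : ℕ
      L = length (leaves y)
      R = length (leaves t)
      total≡ : length (leaves y ++ leaves t) ≡ L + R
      total≡ = length-++ (leaves y)
      ten≤ : ∀ a b → 1 ≤ b → suc (8 + a * 10) ≤ (a + b) * 10
      ten≤ a b 1≤b = begin
        9 + a * 10       ≤⟨ +-monoˡ-≤ (a * 10) (n≤1+n 9) ⟩
        10 + a * 10      ≤⟨ +-monoˡ-≤ (a * 10) (*-monoˡ-≤ 10 1≤b) ⟩
        b * 10 + a * 10  ≡⟨ trans (+-comm (b * 10) (a * 10)) (sym (*-distribʳ-+ 10 a b)) ⟩
        (a + b) * 10     ∎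
      widen : ∀ {k ir pr im} → k ≤ L + R → Found k ir pr im → Found (length (leaves y ++ leaves t)) ir pr im
      widen k≤ (t′ , lo′ , a′ , st′ , coh , le) = t′ , lo′ , a′ , st′ , coh , ≤-trans le (≤-trans k≤ (≤-reflexive (sym total≡)))
      by : Dec (h < m) → Run descend _ _ _ (length (leaves y ++ leaves t) * 10) (Found (length (leaves y ++ leaves t)))
      by (no h≮m) = within (≤-trans (s≤s z≤n) (≤-trans (ten≤ L R (0<leaves t)) (≤-reflexive (cong (_* 10) (sym total≡)))))
        (while-≥ six two (≮⇒≥ h≮m) (_ , _ , _ , st , coherent-≤ (≮⇒≥ h≮m) coherent , ≤-refl))
      by (yes h<m) = within bound (while-< six two h<m (descendBody-run valid st h<m) λ
        { (inj₁ (_ , _ , st′)) → within (*-monoˡ-≤ 10 (m≤m⊔n L R)) (weaken (m≤m+n L R) (descend-run y valid-y st′))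
        ; (inj₂ (_ , _ , st′)) → within (*-monoˡ-≤ 10 (m≤n⊔m L R)) (weaken (m≤n+m R L) (descend-run t valid-t st′)) })
        where
        weaken : ∀ {k i ir pr im} → k ≤ L + R → Run descend ir pr im i (Found k) →
                 Run descend ir pr im i (Found (length (leaves y ++ leaves t)))
        weaken k≤ (running t _ _ _ halts t≤ post) = running t _ _ _ halts t≤ (widen k≤ post)
        bound : suc (8 + (L ⊔ R) * 10) ≤ length (leaves y ++ leaves t) * 10
        bound = ≤-trans (max-case (≤-total L R)) (≤-reflexive (cong (_* 10) (sym total≡)))
          where
          max-case : L ≤ R ⊎ R ≤ L → suc (8 + (L ⊔ R) * 10) ≤ (L + R) * 10
          max-case (inj₁ L≤R) = subst₂ (λ a b → suc (8 + a * 10) ≤ b * 10) (sym (m≤n⇒m⊔n≡n L≤R)) (+-comm R L) (ten≤ R L (0<leaves y))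
          max-case (inj₂ R≤L) = subst (λ a → suc (8 + a * 10) ≤ (L + R) * 10) (sym (m≥n⇒m⊔n≡m R≤L)) (ten≤ L R (0<leaves t))

-- Verification, aggregation and the complete query.

module Report where

  open Colouring using (Agree)
  open import Data.Empty using (⊥-elim)
  open import Data.Fin.Base using (Fin; toℕ)
  import Data.Fin.Properties as Fin
  open import Data.List.Base as List using (List; []; _∷_; _++_; _∷ʳ_; length)
  open import Data.List.Membership.Propositional using (_∈_; _∉_)
  open import Data.List.Membership.Propositional.Properties using (∈-∃++)
  open import Data.List.Properties using (++-assoc; ++-identityʳ)
  open import Data.List.Relation.Binary.Permutation.Propositional as ↭ using (_↭_; ↭-refl; ↭-trans; ↭-sym; prep; swap)
  open import Data.List.Relation.Binary.Permutation.Propositional.Properties using (shift; ∈-resp-↭; ↭-length)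
  open import Data.List.Relation.Unary.All as All using (All; []; _∷_)
  open import Data.List.Relation.Unary.All.Properties using (¬Any⇒All¬)
  open import Data.List.Relation.Unary.AllPairs using ([]; _∷_)
  open import Data.List.Relation.Unary.Any using (here; there; any?)
  open import Data.List.Relation.Unary.Unique.Propositional using (Unique)
  open import Data.List.Relation.Unary.Unique.Propositional.Properties using (allFin⁺) renaming (filter⁺ to Unique-filter⁺)
  open import Data.Nat.Base
  open import Data.Nat.Properties hiding (≰⇒≥; _≤?_)
  open import Data.Nat.Solver using (module +-*-Solver)
  open import Data.Product.Base using (_×_; _,_; proj₁; proj₂; ∃-syntax)
  open import Data.Sum.Base using (_⊎_; inj₁; inj₂)
  open import Data.Unit.Base using (tt)
  open import Data.Vec.Base using (Vec; toList)
  open import Data.Vec.Properties using (length-toList)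
  open import Defs
  open Estimation using (agree-snoc⁺; agree-snoc⁻)
  open import Function.Base using (_∘_)
  open Index
  open import Level using () renaming (_⊔_ to _⊔ˡ_)
  open Machine
  open OrderedField
  open import Relation.Binary.PropositionalEquality
  open import Relation.Nullary using (Dec; yes; no; ¬_)
  open Walk

  module _ {a} {A : Set a} where

    -- Positions are gathered in the order of the tree, while `Occ` lists them in increasing order.
    -- Having the same members without repetition, the two lists give the same sum and the same
    -- length.
    unique⇒↭ : ∀ {xs ys : List A} → Unique xs → Unique ys → (∀ {x} → x ∈ xs → x ∈ ys) → (∀ {x} → x ∈ ys → x ∈ xs) → xs ↭ ys
    unique⇒↭ {[]}     {[]}     _ _ _ _ = ↭-refl
    unique⇒↭ {[]}     {y ∷ ys} _ _ _ ⊇ with ⊇ (here refl)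
    ... | ()
    unique⇒↭ {x ∷ xs} {ys} (x∉xs ∷ xs!) ys! ⊆ ⊇ with ∈-∃++ (⊆ (here refl))
    ... | us , vs , refl = ↭-trans (prep x (unique⇒↭ xs! rest! ⊆′ ⊇′)) (↭-sym (shift x us vs))
      where
      shifted! : Unique (x ∷ us ++ vs)
      shifted! = unique-resp us ys!
        where
        unique-resp : ∀ us → Unique (us ++ x ∷ vs) → Unique (x ∷ us ++ vs)
        unique-resp []       u       = u
        unique-resp (y ∷ us) (y∉ ∷ u) with unique-resp us u
        ... | x∉ ∷ u′ = ((λ { refl → All.lookup y∉ (∈-resp-↭ (↭-sym (shift x us vs)) (here refl)) refl }) ∷ x∉)
                        ∷ (All.tabulate (λ v∈ → All.lookup y∉ (∈-resp-↭ (↭-sym (shift x us vs)) (there v∈))) ∷ u′)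
      rest! : Unique (us ++ vs)
      rest! with shifted!
      ... | _ ∷ u = u
      ⊆′ : ∀ {y} → y ∈ xs → y ∈ us ++ vs
      ⊆′ y∈ with ∈-resp-↭ (shift x us vs) (⊆ (there y∈))
      ... | here refl = ⊥-elim (All.lookup x∉xs y∈ refl)
      ... | there y∈′ = y∈′
      ⊇′ : ∀ {y} → y ∈ us ++ vs → y ∈ xs
      ⊇′ y∈ with ⊇ (∈-resp-↭ (↭-sym (shift x us vs)) (there y∈))
      ... | there y∈′ = y∈′
      ... | here refl with shifted!
      ...   | x∉ ∷ _ = ⊥-elim (All.lookup x∉ y∈ refl)

    none⇒[] : ∀ {xs : List A} → (∀ {x} → x ∉ xs) → xs ≡ []
    none⇒[] {[]}    _    = refl
    none⇒[] {x ∷ _} none = ⊥-elim (none (here refl))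

  module Reporting {c ℓ₁ ℓ₂} (F : ArchimedeanField c ℓ₁ ℓ₂) {n σ : ℕ} (T : WeightedSequences.WeightedSequence F n σ)
                   (z : ArchimedeanField.Carrier F) (sys : LeafSystem F T z) {w m : ℕ}
                   (D : WordRAM.DataStructure F w) (P : Vec (Fin σ) m) (σ≤N : σ ≤ 2 ^ w) (m<N : m < 2 ^ w) where
    open ArchimedeanField F using (Carrier; 0#; _≈_; _⁻¹; fromℕ; _≤?_) renaming (_≤_ to _≤ᶠ_; _+_ to _+ᶠ_; _*_ to _*ᶠ_)
    open WeightedSequences F hiding (none)
    open OrderedFieldProperties F hiding (*-monoˡ-≤; *-monoʳ-≤; +-mono-≤)
    open Indexing F T z sys w hiding (fat; thin)
    open Execution F D P σ≤N m<N hiding (N; seq)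
    open Walking F T z sys D P σ≤N m<N

    prob-at : Fin n → Carrier
    prob-at = Prob T P

    occ : List (Fin n)
    occ = Occ T z P

    ∑ᴸ-↭ : ∀ {xs ys} → xs ↭ ys → ∑ᴸ (List.map prob-at xs) ≈ ∑ᴸ (List.map prob-at ys)
    ∑ᴸ-↭ ↭.refl        = ≈.refl
    ∑ᴸ-↭ (prep x p)    = ≈.+-congˡ (∑ᴸ-↭ p)
    ∑ᴸ-↭ (swap x y p)  = ≈.trans (≈.+-congˡ (≈.+-congˡ (∑ᴸ-↭ p)))
      (≈.trans (≈.sym (≈.+-assoc _ _ _)) (≈.trans (≈.+-congʳ (≈.+-comm _ _)) (≈.+-assoc _ _ _)))
    ∑ᴸ-↭ (↭.trans p q) = ≈.trans (∑ᴸ-↭ p) (∑ᴸ-↭ q)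

    record StringTable : Set c where
      field
        letters≡  : ∀ j {t} → t ≤ n → int M (stringAt j t) ≡ toℕ (str j t)
        prefixes≡ : ∀ j {t} → t ≤ n → prob M (stringAt j t) ≡ prefix j t
        strings<N : ∀ j {t} → t ≤ n → stringAt j t < N

    stringAt-+ : ∀ j s t → stringAt j s + t ≡ stringAt j (s + t)
    stringAt-+ j s t = trans (+-assoc stringBase _ t) (cong (stringBase +_) (+-assoc (toℕ j * suc n) s t))

    module _ (table : StringTable) where
      open StringTable table

      record Verifying (e : Leaf) (lo hi d v : ℕ) (ir : ℕ → ℕ) (pr : ℕ → Carrier) (im : ℕ → ℕ) : Set c where
        field
          base     : Base ir pr im
          three    : ir 3 ≡ d
          five     : ir 5 ≡ v
          eleven   : ir 11 ≡ lo
          twelve   : ir 12 ≡ hi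
          fourteen : ir 14 ≡ stringAt (proj₁ e) (start e)
        open Base base public

      record Verified (e : Leaf) (lo hi : ℕ) (ir : ℕ → ℕ) (pr : ℕ → Carrier) (im : ℕ → ℕ) : Set c where
        field
          base   : Base ir pr im
          eleven : ir 11 ≡ lo
          twelve : ir 12 ≡ hi
          result : (ir 3 ≡ m × Match (toList P) e) ⊎ (ir 3 ≢ m × ¬ Match (toList P) e)

      module _ {e : Leaf} {lo hi : ℕ} (m≤len : m ≤ len e) where

        Compared : List (Fin σ) → Fin σ → Post c
        Compared Y x ir pr im = (seq e (length Y) ≡ x × Verifying e lo hi (length (Y ∷ʳ x)) m ir pr im) ⊎
                                (seq e (length Y) ≢ x × Verifying e lo hi (length Y) 0 ir pr im)

        compare-run : ∀ {ir pr im} Y x {Z} → toList P ≡ Y ++ x ∷ Z → Verifying e lo hi (length Y) m ir pr im →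
                      Run verifyBody ir pr im 5 (Compared Y x)
        compare-run Y x P≡ st =
          letter≡ Y three P≡ ▸ add≡ fourteen three (subst (_< N) (sym at≡) (strings<N (proj₁ e) inside)) ▸
          data≡ refl (trans (cong (int M) at≡) (letters≡ (proj₁ e) inside)) ▸ by (seq e (length Y) Fin.≟ x)
          where
          open Verifying st
          at≡ : stringAt (proj₁ e) (start e) + length Y ≡ stringAt (proj₁ e) (start e + length Y)
          at≡ = stringAt-+ (proj₁ e) (start e) (length Y)
          inside : start e + length Y ≤ n
          inside = ≤-trans (+-monoʳ-≤ (start e) (≤-trans (<⇒≤ (split-< Y P≡)) m≤len)) (start+len≤n e)
          by : Dec (seq e (length Y) ≡ x) → Run _ _ _ _ 2 (Compared Y x)
          by (yes eq) = if-≡ refl refl (cong toℕ (sym eq))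
            (last (inc≡ three one (≤-<-trans (split-< Y P≡) m<N))
              (inj₁ (eq , record { base = frame base refl refl refl refl ; three = sym (length-∷ʳ Y) ; five = five
                                 ; eleven = eleven ; twelve = twelve ; fourteen = fourteen })))
          by (no seq≢) = if-≢ refl refl (λ eq → seq≢ (sym (Fin.toℕ-injective eq)))
            (last (copy≡ ten ten (≤-<-trans z≤n m<N))
              (inj₂ (seq≢ , record { base = frame base refl refl refl refl ; three = three ; five = refl
                                ; eleven = eleven ; twelve = twelve ; fourteen = fourteen })))

        -- The loop invariant is agreement on Y. As the candidate has at least m letters, every
        -- address read stays within the row of its string.
        verify-run : ∀ Z Y {ir pr im} → toList P ≡ Y ++ Z → Agree Y (seq e) → Verifying e lo hi (length Y) m ir pr im →
                     Run verify ir pr im (1 + length Z * 10) (Verified e lo hi)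
        verify-run [] Y P≡ agr st = while-≥ three five (≤-reflexive m≡) (record
          { base = base ; eleven = eleven ; twelve = twelve
          ; result = inj₁ (trans three (sym m≡) , ≤-trans (≤-reflexive (length-toList P)) m≤len ,
              subst (λ X → Agree X (seq e)) (sym (trans P≡ (++-identityʳ Y))) agr) })
          where
          open Verifying st
          m≡ : m ≡ length Y
          m≡ = trans (length-split Y P≡) (+-identityʳ _)
        verify-run (x ∷ Z) Y P≡ agr st = within (+-monoʳ-≤ 1 (+-monoˡ-≤ (1 + length Z * 10) (m≤m+n 5 4)) )
          (while-< three five (split-< Y P≡) (compare-run Y x P≡ st) λ
            { (inj₁ (eq , st′)) → verify-run Z (Y ∷ʳ x) P≡′ (agree-snoc⁺ agr eq) st′
            ; (inj₂ (seq≢ , st′)) → within (s≤s z≤n) (while-≥ (Verifying.three st′) (Verifying.five st′) z≤n (record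
                { base = Verifying.base st′ ; eleven = Verifying.eleven st′ ; twelve = Verifying.twelve st′
                ; result = inj₂ ((λ eq → <⇒≢ (split-< Y P≡) (trans (sym (Verifying.three st′)) eq)) ,
                    λ mt → seq≢ (proj₂ (agree-snoc⁻ {Y = Y} (agree-++⁻ˡ (Y ∷ʳ x) (subst (λ X → Agree X (seq e)) P≡′ (proj₂ mt)))))) })) })
          where
          open Verifying st
          P≡′ : toList P ≡ (Y ∷ʳ x) ++ Z
          P≡′ = trans P≡ (sym (++-assoc Y (x ∷ []) Z))

      -- The list `seen` exists in the proof only. The machine knows it through the marks in memory,
      -- the sum and the number.
      record Core (seen : List (Fin n)) (ir : ℕ → ℕ) (pr : ℕ → Carrier) (im : ℕ → ℕ) : Set (c ⊔ˡ ℓ₁ ⊔ˡ ℓ₂) where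
        field
          flag     : ir 0 ≡ 1
          one      : ir 1 ≡ 1
          two      : ir 2 ≡ m
          ten      : ir 10 ≡ 0
          marked   : ∀ {i} → i ∈ seen → im (toℕ i) ≡ 1
          unmarked : ∀ {i} → i ∉ seen → im (toℕ i) ≡ 0
          seen!    : Unique seen
          seen⊆    : ∀ {i} → i ∈ seen → i ∈ occ
          total    : pr 1 ≈ ∑ᴸ (List.map prob-at seen)
          number   : pr 2 ≈ fromℕ (length seen)

      core-frame : ∀ {seen ir ir′ pr pr′ im} → Core seen ir pr im → ir′ 0 ≡ ir 0 → ir′ 1 ≡ ir 1 → ir′ 2 ≡ ir 2 → ir′ 10 ≡ ir 10 →
                   pr′ 1 ≡ pr 1 → pr′ 2 ≡ pr 2 → Core seen ir′ pr′ im
      core-frame core e0 e1 e2 e10 p1 p2 = record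
        { flag = trans e0 flag ; one = trans e1 one ; two = trans e2 two ; ten = trans e10 ten
        ; marked = marked ; unmarked = unmarked ; seen! = seen! ; seen⊆ = seen⊆
        ; total = ≈.trans (≈.reflexive p1) total ; number = ≈.trans (≈.reflexive p2) number }
        where open Core core

      -- While nothing has been seen, the maximum is the initial 0. Probabilities are not negative,
      -- so the first candidate always replaces it and the value attained is genuine from then on.
      Best : List (Fin n) → Carrier → Set (ℓ₁ ⊔ˡ ℓ₂)
      Best seen x = (∀ {i} → i ∈ seen → prob-at i ≤ᶠ x) × ((seen ≡ [] × x ≈ 0#) ⊎ (∃[ i ] i ∈ seen × x ≈ prob-at i))

      best-raise : ∀ {seen x y i} → Best seen x → y ≈ prob-at i → x ≤ᶠ y → Best (i ∷ seen) y
      best-raise (upper , _) y≈ x≤y = (λ { (here refl) → ≤.reflexive (≈.sym y≈) ; (there i∈) → ≤.trans (upper i∈) x≤y }) ,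
        inj₂ (_ , here refl , y≈)

      best-keep : ∀ {seen x y i} → Best seen x → y ≈ prob-at i → 0# ≤ᶠ y → ¬ (x ≤ᶠ y) → Best (i ∷ seen) x
      best-keep (upper , attained) y≈ 0≤y x≰y =
        (λ { (here refl) → ≤-respˡ y≈ (≰⇒≥ x≰y) ; (there i∈) → upper i∈ }) , by attained
        where
        by : _ → _
        by (inj₁ (_ , x≈0))       = ⊥-elim (x≰y (≤-respˡ (≈.sym x≈0) 0≤y))
        by (inj₂ (i , i∈ , x≈i)) = inj₂ (i , there i∈ , x≈i)

      -- The maximum is updated before the mark is examined, so it accounts for the current position
      -- even if this was seen earlier. The second copy is dropped here.
      best-forget : ∀ {seen x i} → i ∈ seen → Best (i ∷ seen) x → Best seen x
      best-forget i∈ (upper , attained) = upper ∘ there , by attained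
        where
        by : _ → _
        by (inj₂ (_ , here refl , x≈)) = inj₂ (_ , i∈ , x≈)
        by (inj₂ (j , there j∈ , x≈)) = inj₂ (j , j∈ , x≈)

      update-same : ∀ (f : ℕ → ℕ) k v → update f k v k ≡ v
      update-same f k v rewrite T⇒true (≡⇒≡ᵇ k k refl) = refl

      update-other : ∀ (f : ℕ → ℕ) {k j} v → j ≢ k → update f k v j ≡ f j
      update-other f {k} {j} v j≢k rewrite ¬T⇒false {j ≡ᵇ k} (λ t → j≢k (≡ᵇ⇒≡ j k t)) = refl

      record Marked (i : Fin n) (seen : List (Fin n)) (ir₀ : ℕ → ℕ) (pr₀ : ℕ → Carrier)
                    (ir : ℕ → ℕ) (pr : ℕ → Carrier) (im : ℕ → ℕ) : Set (c ⊔ˡ ℓ₁ ⊔ˡ ℓ₂) where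
        field
          seen′  : List (Fin n)
          core   : Core seen′ ir pr im
          ⊇seen  : ∀ {j} → j ∈ seen → j ∈ seen′
          i∈     : i ∈ seen′
          best   : ∀ {x} → Best (i ∷ seen) x → Best seen′ x
          seven  : ir 7 ≡ ir₀ 7
          twelve : ir 12 ≡ ir₀ 12
          max≡   : pr 0 ≡ pr₀ 0

      mark-run : ∀ {i seen ir pr im} → Core seen ir pr im → i ∈ occ → ir 6 ≡ toℕ i → ir 9 ≡ im (toℕ i) → pr 5 ≈ prob-at i →
                 Run (if eqI 9 10 then (instr (storeI 6 1) ⨾ instr (opP add 1 5 1) ⨾ instr (oneP 6) ⨾ instr (opP add 2 6 2)) else noop)
                     ir pr im 5 (Marked i seen ir pr)
      mark-run {i} {seen} {ir} {pr} {im} core i∈occ e6 e9 p5 = by (any? (i Fin.≟_) seen)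
        where
        open Core core
        by : Dec (i ∈ seen) → Run _ ir pr im 5 (Marked i seen ir pr)
        by (yes i∈) = within (s≤s (s≤s z≤n)) (if-≢ (trans e9 (marked i∈)) ten (λ ()) (last (data≡ refl refl) (record
          { seen′ = seen ; core = core-frame core refl refl refl refl refl refl ; ⊇seen = λ j∈ → j∈ ; i∈ = i∈
          ; best = best-forget i∈ ; seven = refl ; twelve = refl ; max≡ = refl })))
        by (no i∉) = if-≡ (trans e9 (unmarked i∉)) ten refl (store e6 one (opP≡ ▹ one≡ ▹ lastP opP≡ (record
          { seen′ = i ∷ seen
          ; core = record
            { flag = flag ; one = one ; two = two ; ten = ten
            ; marked = λ { (here refl) → update-same im (toℕ i) 1
                         ; (there j∈) → mark-there j∈ }
            ; unmarked = λ j∉ → trans (update-other im 1 (λ eq → j∉ (here (Fin.toℕ-injective eq)))) (unmarked (j∉ ∘ there))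
            ; seen! = ¬Any⇒All¬ seen i∉ ∷ seen! ; seen⊆ = λ { (here refl) → i∈occ ; (there j∈) → seen⊆ j∈ }
            ; total = ≈.+-cong p5 total ; number = ≈.+-congˡ number }
          ; ⊇seen = there ; i∈ = here refl ; best = λ b → b ; seven = refl ; twelve = refl ; max≡ = refl })))
          where
          mark-there : ∀ {j} → j ∈ seen → update im (toℕ i) 1 (toℕ j) ≡ 1
          mark-there {j} j∈ = trans (update-other im 1 (λ eq → i∉ (subst (_∈ seen) (Fin.toℕ-injective eq) j∈))) (marked j∈)

      -- By `covered` each occurrence is seen or still has a leaf ahead. When no leaf remains,
      -- `seen` contains every occurrence.
      record Gathering (E : List Leaf) (seen : List (Fin n)) (lo hi : ℕ)
                       (ir : ℕ → ℕ) (pr : ℕ → Carrier) (im : ℕ → ℕ) : Set (c ⊔ˡ ℓ₁ ⊔ˡ ℓ₂) where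
        field
          core    : Core seen ir pr im
          eleven  : ir 11 ≡ lo
          twelve  : ir 12 ≡ hi
          best    : Best seen (pr 0)
          covered : ∀ {i} → i ∈ occ → i ∈ seen ⊎ (∃[ j ] (j , i) ∈ E)
        open Core core public

      gatherBody-run : ∀ {e E seen lo hi ir pr im} → LeafRecords M lo (e ∷ E) → 3 + lo < N → Match (toList P) e →
                       Gathering (e ∷ E) seen lo hi ir pr im →
                       Run gatherBody ir pr im 17 (λ ir′ pr′ im′ → ∃[ seen′ ] Gathering E seen′ (3 + lo) hi ir′ pr′ im′)
      gatherBody-run {e} {E} {seen} {lo} {hi} {ir} {pr} {im} ((start≡ , _) ∷ (addr≡ , _) ∷ _) 3+lo<N match st =
        data≡ eleven start≡ ▸ inc≡ eleven one (≤-<-trans (m≤n+m (suc lo) 2) 3+lo<N) ▸ data≡ refl addr≡ ▸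
        inc≡ refl one (≤-<-trans (m≤n+m (suc (suc lo)) 1) 3+lo<N) ▸
        dataP≡ refl (prefixes≡ (proj₁ e) (<⇒≤ (Fin.toℕ<n (pos e)))) ▹
        add≡ refl two (subst (_< N) (sym at≡) (strings<N (proj₁ e) inside)) ▸
        dataP≡ refl (trans (cong (prob M) at≡) (prefixes≡ (proj₁ e) inside)) ▹ opP≡ ▹
        _then_ {R = Maxed} (max-by (pr 0 ≤? q)) λ mx →
        load≡ (Maxed.six mx) refl ▸
        mark-run (core-frame (Maxed.core mx) refl refl refl refl refl refl) (match⇒∈Occ P {e} match) (Maxed.six mx) refl
          (≈.trans (≈.reflexive (Maxed.five mx)) q≈) then λ mk →
        last (inc≡ (trans (Marked.seven mk) (Maxed.seven mx)) (Core.one (Marked.core mk)) 3+lo<N)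
          (Marked.seen′ mk , record
            { core = core-frame (Marked.core mk) refl refl refl refl refl refl
            ; eleven = refl
            ; twelve = trans (Marked.twelve mk) (Maxed.twelve mx)
            ; best = subst (Best (Marked.seen′ mk)) (sym (Marked.max≡ mk)) (Marked.best mk (Maxed.best mx))
            ; covered = λ i∈ → cover mk (covered i∈) })
        where
        open Gathering st
        q : Carrier
        q = prefix (proj₁ e) (start e + m) *ᶠ prefix (proj₁ e) (start e) ⁻¹
        q≈ : q ≈ prob-at (pos e)
        q≈ = ≈.sym (Prob≈window P {e} match)
        m≤len : m ≤ len e
        m≤len = ≤-trans (≤-reflexive (sym (length-toList P))) (proj₁ match)
        inside : start e + m ≤ n
        inside = ≤-trans (+-monoʳ-≤ (start e) m≤len) (start+len≤n e)
        at≡ : stringAt (proj₁ e) (start e) + m ≡ stringAt (proj₁ e) (start e + m)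
        at≡ = stringAt-+ (proj₁ e) (start e) m
        record Maxed (ir : ℕ → ℕ) (pr : ℕ → Carrier) (im : ℕ → ℕ) : Set (c ⊔ˡ ℓ₁ ⊔ˡ ℓ₂) where
          field
            core   : Core seen ir pr im
            six    : ir 6 ≡ toℕ (pos e)
            seven  : ir 7 ≡ suc (suc lo)
            twelve : ir 12 ≡ hi
            five   : pr 5 ≡ q
            best   : Best (pos e ∷ seen) (pr 0)
        ir₁ : ℕ → ℕ
        ir₁ = update (update (update (update (update ir 6 (start e)) 7 (suc lo)) 8 (stringAt (proj₁ e) (start e))) 7 (suc (suc lo)))
                9 (stringAt (proj₁ e) (start e) + m)
        pr₁ : ℕ → Carrier
        pr₁ = update (update (update pr 3 (prefix (proj₁ e) (start e))) 4 (prefix (proj₁ e) (start e + m))) 5 q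
        max-by : Dec (pr 0 ≤ᶠ q) → Run (if leP 0 5 then instr (opP div 0 4 3) else noop) ir₁ pr₁ im 2 Maxed
        max-by (yes le) = if-≤ᶠ le (lastP opP≡ (record
          { core = core-frame core refl refl refl refl refl refl ; six = refl ; seven = refl ; twelve = twelve ; five = refl
          ; best = best-raise best q≈ le }))
        max-by (no max≰q) = if-≰ᶠ max≰q (last (data≡ refl refl) (record
          { core = core-frame core refl refl refl refl refl refl ; six = refl ; seven = refl ; twelve = twelve ; five = refl
          ; best = best-keep best q≈ (≤-respʳ (≈.sym q≈) (0≤Prob P (pos e))) max≰q }))
        cover : ∀ {ir₀ pr₀ ir pr im i} → (mk : Marked (pos e) seen ir₀ pr₀ ir pr im) → i ∈ seen ⊎ (∃[ j ] (j , i) ∈ e ∷ E) →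
                i ∈ Marked.seen′ mk ⊎ (∃[ j ] (j , i) ∈ E)
        cover mk (inj₁ i∈)              = inj₁ (Marked.⊇seen mk i∈)
        cover mk (inj₂ (_ , here refl)) = inj₁ (Marked.i∈ mk)
        cover mk (inj₂ (j , there e∈))  = inj₂ (j , e∈)

      Gathered : Post (c ⊔ˡ ℓ₁ ⊔ˡ ℓ₂)
      Gathered ir pr im = ∃[ seen ] Core seen ir pr im × Best seen (pr 0) × (∀ {i} → i ∈ occ → i ∈ seen)

      gather-run : ∀ E {seen lo hi ir pr im} → LeafRecords M lo E → lo + 3 * length E ≡ hi → hi < N →
                   (∀ {e} → e ∈ E → Match (toList P) e) → Gathering E seen lo hi ir pr im →
                   Run gather ir pr im (1 + length E * 20) Gathered
      gather-run [] {lo = lo} recs hi≡ hi<N matches st =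
        while-≥ eleven twelve (≤-reflexive (trans (sym hi≡) (+-identityʳ lo)))
          (_ , core , best , λ i∈ → seen-all (covered i∈))
        where
        open Gathering st
        seen-all : ∀ {i seen} → i ∈ seen ⊎ (∃[ j ] (j , i) ∈ []) → i ∈ seen
        seen-all (inj₁ i∈) = i∈
      gather-run (e ∷ E) {lo = lo} {hi} recs hi≡ hi<N matches st =
        within (+-monoʳ-≤ 1 (+-monoˡ-≤ (1 + length E * 20) (m≤m+n 17 2)))
          (while-< eleven twelve (≤-trans (m≤n+m (suc lo) 2) 3+lo≤hi)
            (gatherBody-run recs (≤-<-trans 3+lo≤hi hi<N) (matches (here refl)) st)
            λ (seen′ , st′) → gather-run E (rest recs) hi≡′ hi<N (λ e∈ → matches (there e∈)) st′)
        where
        open Gathering st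
        hi≡′ : 3 + lo + 3 * length E ≡ hi
        hi≡′ = trans (cong (_+ 3 * length E) (+-comm 3 lo)) (trans (+-assoc lo 3 _)
          (trans (cong (lo +_) (sym (*-suc 3 (length E)))) hi≡))
        3+lo≤hi : 3 + lo ≤ hi
        3+lo≤hi = ≤-trans (m≤m+n (3 + lo) _) (≤-reflexive hi≡′)
        rest : ∀ {e} → LeafRecords M lo (e ∷ E) → LeafRecords M (3 + lo) E
        rest (_ ∷ _ ∷ _ ∷ seg) = seg

      Result : Post (ℓ₁ ⊔ˡ ℓ₂)
      Result ir pr im = (ir 0 ≡ 0 × occ ≡ []) ⊎
        (ir 0 ≡ 1 × IsHeaviest T z P (pr 0) × occ ≢ [] × pr 1 *ᶠ pr 2 ⁻¹ ≈ averageProb T z P)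

      ∈⇒≢[] : ∀ {i} → i ∈ occ → occ ≢ []
      ∈⇒≢[] {i} i∈ eq = absurd (subst (i ∈_) eq i∈)
        where
        absurd : ¬ (i ∈ [])
        absurd ()

      gathered⇒result : ∀ {i ir pr im} → i ∈ occ → Gathered ir pr im → Result ir pr im
      gathered⇒result {i} {ir} {pr} i∈ (seen , core , (upper , attained) , all) =
        inj₂ (flag , (attained′ attained , λ j j∈ → upper (all j∈)) , ∈⇒≢[] i∈ ,
          ≈.*-cong (≈.trans total (∑ᴸ-↭ perm))
                   (ArchimedeanField.⁻¹-cong F (≈.trans number (≈.reflexive (cong fromℕ (↭-length perm))))))
        where
        open Core core
        perm : seen ↭ occ
        perm = unique⇒↭ seen! (Unique-filter⁺ (λ i → z ⁻¹ ≤? Prob T P i) (allFin⁺ n)) seen⊆ all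
        attained′ : (seen ≡ [] × pr 0 ≈ 0#) ⊎ (∃[ i ] i ∈ seen × pr 0 ≈ prob-at i) → ∃[ i ] i ∈ occ × pr 0 ≈ prob-at i
        attained′ (inj₁ (seen≡[] , _)) = ⊥-elim (absurd (subst (i ∈_) seen≡[] (all i∈)))
          where
          absurd : ¬ (i ∈ [])
          absurd ()
        attained′ (inj₂ (j , j∈ , x≈)) = j , seen⊆ j∈ , x≈

      treeTail : ∀ t {lo a} → TreeAt M t lo a →
                 int M (4 + a) ≡ lo × int M (5 + a) ≡ lo + 3 * length (leaves t) × 5 + a < N
      treeTail (group _ _)     ((_ ∷ _ ∷ _ ∷ _ ∷ (lo≡ , _) ∷ (hi≡ , _) ∷ _) , lt)                 = lo≡ , hi≡ , lt
      treeTail (split _ _ _ _) (_ , _ , (_ ∷ _ ∷ _ ∷ _ ∷ (lo≡ , _) ∷ (hi≡ , _) ∷ _) , lt , _ , _) = lo≡ , hi≡ , lt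

      uncons : ∀ t → ∃[ e ] ∃[ E ] leaves t ≡ e ∷ E
      uncons (group e E)     = e , E , refl
      uncons (split _ _ y t) with uncons y
      ... | e , E , eq = e , E ++ leaves t , cong (_++ leaves t) eq

      Started : Leaf → ℕ → ℕ → Post c
      Started e lo hi ir pr im = (Verifying e lo hi 0 0 ir pr im × len e < m) ⊎ (Verifying e lo hi 0 m ir pr im × m ≤ len e)

      check-run : ∀ {e lo hi ir pr im} → 0 < m → Started e lo hi ir pr im → Run verify ir pr im (1 + m * 10) (Verified e lo hi)
      check-run {e} 0<m (inj₁ (st , len<m)) = within (s≤s z≤n) (while-≥ three five z≤n (record
        { base = base ; eleven = eleven ; twelve = twelve
        ; result = inj₂ ((λ eq → <⇒≢ 0<m (trans (sym three) eq)) ,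
                         λ mt → <⇒≱ len<m (≤-trans (≤-reflexive (sym (length-toList P))) (proj₁ mt))) }))
        where open Verifying st
      check-run {e} 0<m (inj₂ (st , m≤len)) = within (≤-reflexive (cong (λ k → 1 + k * 10) (length-toList P)))
        (verify-run m≤len (toList P) [] refl tt st)

      -- The remaining leaves agree on their first m letters, so the verdict on the first of them
      -- holds for all. Either all match and are gathered, or none does; since they include every
      -- matching leaf, there is then no occurrence.
      report-run : ∀ {t lo a ir₀ pr₀ im₀ ir pr im} → 0 < m → Descending t lo a ir₀ pr₀ im₀ → Coherent m (leaves t) →
                   ∀ {e E} → leaves t ≡ e ∷ E → Verified e lo (lo + 3 * length (leaves t)) ir pr im →
                   Run (if eqI 3 2 then (instr (constI 0 1) ⨾ gather) else noop) ir pr im (3 + length (leaves t) * 20) Result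
      report-run {t} {lo} {ir = ir} {pr} {im} 0<m st coherent {e} {E} leaves≡ vf = by (Verified.result vf)
        where
        open Base (Verified.base vf)
        complete : ∀ {e} → Match (toList P) e → e ∈ leaves t
        complete {e} = Descending.complete st {e}
        e∈ : e ∈ leaves t
        e∈ = subst (e ∈_) (sym leaves≡) (here refl)
        same : ∀ {e₁ e₂} → e₁ ∈ leaves t → e₂ ∈ leaves t → Match (toList P) e₁ → Match (toList P) e₂
        same {e₁} {e₂} e₁∈ e₂∈ = match-resp {toList P} {e₁} {e₂} (λ t< → coherent e₁∈ e₂∈ (subst (_ <_) (length-toList P) t<))
        by : _ → Run (if eqI 3 2 then (instr (constI 0 1) ⨾ gather) else noop) ir pr im (3 + length (leaves t) * 20) Result
        by (inj₁ (three , match)) = if-≡ three two refl (const≡ (≤-<-trans 0<m m<N) ▸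
          strengthen (gather-run (leaves t) {seen = []} (Descending.recs st) refl (Descending.hi<N st) (λ e′∈ → same e∈ e′∈ match) (record
            { core = record
              { flag = refl ; one = one ; two = two ; ten = ten ; marked = λ () ; unmarked = λ _ → mem _
              ; seen! = [] ; seen⊆ = λ () ; total = ≈.reflexive sum0 ; number = ≈.reflexive num0 }
            ; eleven = Verified.eleven vf ; twelve = Verified.twelve vf
            ; best = (λ ()) , inj₁ (refl , ≈.reflexive max0)
            ; covered = λ i∈ → inj₂ (proj₁ (∈Occ⇒match P i∈) , complete (proj₂ (∈Occ⇒match P i∈))) })))
          where
          strengthen : ∀ {ir k} → Run gather ir pr im k Gathered → Run gather ir pr im k Result
          strengthen (running t _ _ _ halts t≤ post) =
            running t _ _ _ halts t≤ (gathered⇒result (match⇒∈Occ P {e} match) post)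
        by (inj₂ (three≢ , unmatched)) = within (s≤s (s≤s z≤n)) (if-≢ refl two three≢ (last (data≡ refl refl)
          (inj₁ (flag , none⇒[] (λ i∈ → unmatched (same (complete (proj₂ (∈Occ⇒match P i∈))) e∈ (proj₂ (∈Occ⇒match P i∈))))))))

      candidate-run : ∀ {t lo a ir pr im} → 0 < m → Descending t lo a ir pr im → Coherent m (leaves t) →
                      Run (instr (opI add 8 9 1) ⨾ instr (opI add 8 8 1) ⨾ instr (opI add 8 8 1) ⨾ instr (opI add 8 8 1) ⨾
                           instr (dataI 11 8) ⨾ instr (opI add 8 8 1) ⨾ instr (dataI 12 8) ⨾
                           instr (opI add 8 11 1) ⨾ instr (dataI 14 8) ⨾ instr (opI add 8 8 1) ⨾ instr (dataI 15 8) ⨾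
                           instr (opI add 3 10 10) ⨾
                           (if ltI 15 2 then instr (opI add 5 10 10) else instr (patternLength 5)) ⨾
                           verify ⨾
                           (if eqI 3 2 then (instr (constI 0 1) ⨾ gather) else noop))
                          ir pr im (14 + ((1 + m * 10) + (3 + length (leaves t) * 20))) Result
      candidate-run {t} {lo} {a} {ir} {pr} {im} 0<m st coherent = from (treeTail t tree) (uncons t)
        where
        open Descending st
        from : int M (4 + a) ≡ lo × int M (5 + a) ≡ lo + 3 * length (leaves t) × 5 + a < N → ∃[ e ] ∃[ E ] leaves t ≡ e ∷ E → Run _ ir pr im _ Result
        from (lo≡ , hi≡ , 5+a<N) (e , E , leaves≡) = with-record (subst (LeafRecords M lo) leaves≡ recs)
          where
          lo+2<N : suc (suc lo) < N
          lo+2<N = ≤-<-trans (≤-trans (≤-reflexive (+-comm 2 lo)) (+-monoʳ-≤ lo (≤-trans (m≤m+n 2 1) (*-monoʳ-≤ 3 (0<leaves t))))) hi<N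
          with-record : LeafRecords M lo (e ∷ E) → Run _ ir pr im _ Result
          with-record (_ ∷ (addr≡ , _) ∷ (len≡ , _) ∷ _) =
            inc≡ nine one (≤-<-trans (m≤n+m (1 + a) 4) 5+a<N) ▸ inc≡ refl one (≤-<-trans (m≤n+m (2 + a) 3) 5+a<N) ▸
            inc≡ refl one (≤-<-trans (m≤n+m (3 + a) 2) 5+a<N) ▸ inc≡ refl one (≤-<-trans (m≤n+m (4 + a) 1) 5+a<N) ▸
            data≡ refl lo≡ ▸ inc≡ refl one 5+a<N ▸ data≡ refl hi≡ ▸
            inc≡ refl one (<⇒≤ lo+2<N) ▸ data≡ refl addr≡ ▸ inc≡ refl one lo+2<N ▸ data≡ refl len≡ ▸
            copy≡ ten ten (≤-<-trans z≤n m<N) ▸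
            _then_ {R = Started e lo (lo + 3 * length (leaves t))} (start-by (len e <? m)) λ started →
            check-run 0<m started then λ verified →
            report-run 0<m st coherent leaves≡ verified
            where
            start-by : Dec (len e < m) → Run (if ltI 15 2 then instr (opI add 5 10 10) else instr (patternLength 5)) _ pr im 2
                                             (Started e lo (lo + 3 * length (leaves t)))
            start-by (yes len<m) = if-< refl two len<m (last (copy≡ ten ten (≤-<-trans z≤n m<N))
              (inj₁ (record { base = frame base refl refl refl refl ; three = refl ; five = refl
                            ; eleven = refl ; twelve = refl ; fourteen = refl } , len<m)))
            start-by (no len≮m) = if-≥ refl two (≮⇒≥ len≮m) (last length≡
              (inj₂ (record { base = frame base refl refl refl refl ; three = refl ; five = refl
                            ; eleven = refl ; twelve = refl ; fourteen = refl } , ≮⇒≥ len≮m)))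

      thinOutput-run : ∀ {r t ir pr im} → Base ir pr im → ir 7 ≡ suc r → Thin M r t → length (leaves t) ≤ m →
                       (∀ {e} → Match (toList P) e → e ∈ leaves t) →
                       Run thinOutput ir pr im (3 + (m * 10 + (14 + ((1 + m * 10) + (3 + m * 20))))) Result
      thinOutput-run {t = t} base seven th small complete =
        inc≡ seven one r+2<N ▸ data≡ refl ptr≡ ▸ data≡ refl (treeHead≡ t tree) ▸
        _then_ {R = Found (length (leaves t))} (within (*-monoˡ-≤ 10 small) (descend-run t valid (record
          { base = frame base refl refl refl refl ; six = refl ; nine = refl ; tree = tree ; recs = recs ; hi<N = hi<N
          ; complete = λ {e} → complete {e} })))
        λ (t′ , lo′ , a′ , st , coherent , t′≤t) →
        within (+-monoʳ-≤ 14 (+-monoʳ-≤ (1 + m * 10) (+-monoʳ-≤ 3 (*-monoˡ-≤ 20 (≤-trans t′≤t small)))))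
               -- A tree has at least one leaf and a thin one at most m here, so m is positive.
               -- Hence a count left at 0 by a failed check differs from m.
               (candidate-run (<-≤-trans (0<leaves t) small) st coherent)
        where
        open Base base using (one)
        open Thin th

      fatOutput-run : ∀ {r heavy avg ir pr im} → ir 4 ≡ r → ir 7 ≡ suc r → Answers (toList P) heavy avg →
                      prob M r ≡ heavy → prob M (suc r) ≡ avg → 1 < N → Run fatOutput ir pr im 4 Result
      fatOutput-run {avg = avg} four seven answers heavy≡ avg≡ 1<N with answers P refl
      ... | heavy-is , avg≈ , occ≢[] = dataP≡ four heavy≡ ▹ dataP≡ seven avg≡ ▹ one≡ ▹ last (const≡ 1<N)
        (inj₂ (refl , heavy-is , occ≢[] , ≈.trans (≈.trans (≈.*-congˡ 1⁻¹≈1) (≈.*-identityʳ avg)) avg≈))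

      module _ (fail : Thin M failAddr (group leaf [])) {root : ℕ} (root-node : Node M [] root)
               (root≡ : int M 0 ≡ root) (root≢0 : root ≢ 0) where

        private
          1<N : 1 < N
          1<N = ≤-<-trans (s≤s z≤n) (Thin.r+2<N fail)

        select-run : ∀ {ir pr im} → Exit ir pr im →
                     Run (instr (opI add 7 4 1) ⨾ instr (dataI 8 7) ⨾ (if eqI 8 1 then fatOutput else thinOutput)) ir pr im
                         (24 + m * 40) Result
        select-run (fat-exit at answers heavy≡ k≡ avg≡ r+2<N) = within (m≤m+n 7 _)
          (inc≡ four one (<⇒≤ r+2<N) ▸ data≡ refl k≡ ▸ if-≡ refl one refl
            (fatOutput-run four refl answers heavy≡ avg≡ 1<N))
          where open At at
        select-run (thin-exit at th small complete) = within (≤-reflexive arith)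
          (inc≡ four one (<⇒≤ (Thin.r+2<N th)) ▸ data≡ refl (Thin.kind≡ th) ▸ if-≢ refl one (λ ())
            (thinOutput-run (frame base refl refl refl refl) refl th small (λ {e} → complete {e})))
          where
          open At at
          arith : 3 + (3 + (m * 10 + (14 + ((1 + m * 10) + (3 + m * 20))))) ≡ 24 + m * 40
          arith = solve 1 (λ m → con 3 :+ (con 3 :+ (m :* con 10 :+ (con 14 :+ ((con 1 :+ m :* con 10) :+ (con 3 :+ m :* con 20)))))
                              := con 24 :+ m :* con 40) refl m
            where open +-*-Solver

        search-run : ∀ {ir pr im} → Base ir pr im → ir 3 ≡ 0 → ir 4 ≡ root → Run search ir pr im (26 + m * 70) Result
        search-run {ir} {pr} {im} base three four = by root-node
          where
          arith : 1 + ((1 + m * 30) + (24 + m * 40)) ≡ 26 + m * 70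
          arith = solve 1 (λ m → con 1 :+ ((con 1 :+ m :* con 30) :+ (con 24 :+ m :* con 40)) := con 26 :+ m :* con 70) refl m
            where open +-*-Solver
          by : Node M [] root → Run search ir pr im (26 + m * 70) Result
          -- The root has depth 0 and so cannot be thin, as its tree would have no leaves. The walk
          -- thus starts at a fat node, which also covers the empty pattern.
          by (Node.thin {t = t} _ small _) = ⊥-elim (<⇒≱ (0<leaves t) small)
          by nd@(Node.fat _ _ _ _ _ _ _) = within (≤-reflexive arith) (length≡ ▸
            (within (≤-reflexive (cong (λ k → 1 + k * 30) (length-toList P)))
              (walk-run fail (toList P) [] refl nd (record
                { base = frame base refl refl refl refl ; three = three ; four = four ; five = refl }))) then select-run)

        finish-run : ∀ q {ir pr im} → Result ir pr im →
                     Run (finish q) ir pr im 1 (λ ir pr im → IsAnswer T z P q (output (state ir pr im)))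
        finish-run heaviest {ir} {pr} {im} (inj₁ (flag , occ≡[])) =
          last (data≡ refl refl) (answer flag)
          where
          answer : ∀ {k} → ir 0 ≡ 0 → IsAnswer T z P heaviest (output (state (update ir 13 k) pr im))
          answer flag rewrite flag = WeightedSequences.none occ≡[]
        finish-run heaviest {ir} {pr} {im} (inj₂ (flag , heavy , _ , _)) = last (data≡ refl refl) (answer flag)
          where
          answer : ∀ {k} → ir 0 ≡ 1 → IsAnswer T z P heaviest (output (state (update ir 13 k) pr im))
          answer flag rewrite flag = heaviest-is heavy
        finish-run average {ir} {pr} {im} (inj₁ (flag , occ≡[])) = lastP opP≡ (answer flag)
          where
          answer : ∀ {x} → ir 0 ≡ 0 → IsAnswer T z P average (output (state ir (update pr 0 x) im))
          answer flag rewrite flag = WeightedSequences.none occ≡[]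
        finish-run average {ir} {pr} {im} (inj₂ (flag , _ , occ≢[] , avg≈)) = lastP opP≡ (answer flag)
          where
          answer : ir 0 ≡ 1 → IsAnswer T z P average (output (state ir (update pr 0 (pr 1 *ᶠ pr 2 ⁻¹)) im))
          answer flag rewrite flag = average-is occ≢[] avg≈

        program-run : ∀ q → Run (program q) (λ _ → 0) (λ _ → 0#) (λ _ → 0) (31 + m * 70)
                                (λ ir pr im → IsAnswer T z P q (output (state ir pr im)))
        program-run q = within (≤-reflexive arith) (const≡ 1<N ▸ length≡ ▸ data≡ refl root≡ ▸ if-≢ refl refl root≢0
          (search-run (record { flag = refl ; one = refl ; two = refl ; ten = refl ; mem = λ _ → refl
                              ; max0 = refl ; sum0 = refl ; num0 = refl }) refl refl then finish-run q))
          where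
          arith : 4 + ((26 + m * 70) + 1) ≡ 31 + m * 70
          arith = solve 1 (λ m → con 4 :+ ((con 26 :+ m :* con 70) :+ con 1) := con 31 :+ m :* con 70) refl m
            where open +-*-Solver

-- Assembling the data structure and bounding its space.

module Databases where

  open import Data.Fin.Base as Fin using (Fin; zero; suc; toℕ; fromℕ<)
  import Data.Fin.Properties as Fin
  open import Data.List.Base using (List; []; _∷_; _++_; allFin; length; map; applyUpTo; cartesianProduct)
  open import Data.List.Membership.Propositional.Properties using (∈-allFin; ∈-cartesianProduct⁺)
  open import Data.List.Properties using (++-assoc; length-++; length-applyUpTo; length-map; length-tabulate)
  open import Data.List.Relation.Unary.All as All using (All; []; _∷_)
  import Data.List.Relation.Unary.All.Properties as All
  open import Data.Nat.Base as ℕ using (ℕ; zero; suc; z≤n; s≤s; _+_; _*_; _^_; _<_)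
  open import Data.Nat.Properties
  open import Data.Nat.Solver using (module +-*-Solver)
  open import Data.Product.Base using (_×_; _,_; proj₁; proj₂)
  open import Data.Unit.Base using (tt)
  open import Data.Vec.Base using (Vec)
  open import Defs
  open import Function.Base using (_∘_)
  open Index
  open Leaves using (length-cartesianProduct)
  open Machine using (program; module Execution)
  open Memory
  open import Relation.Binary.PropositionalEquality
  open Report

  module Database {c ℓ₁ ℓ₂} (F : ArchimedeanField c ℓ₁ ℓ₂) {n σ : ℕ} (T : WeightedSequences.WeightedSequence F n σ)
                  (z : ArchimedeanField.Carrier F) (sys : LeafSystem F T z) (w : ℕ) (σ≤N : σ ℕ.≤ 2 ^ w) where
    open ArchimedeanField F using (Carrier; _≤_; 0#; 1#)
    open WordRAM F using (DataStructure; read)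
    open Indexing F T z sys w

    E : List Leaf
    E = cartesianProduct (allFin K) (allFin n)

    k : ℕ
    k = K * n

    length-E : length E ≡ k
    length-E = trans (length-cartesianProduct (allFin K) (allFin n))
      (cong₂ _*_ (length-tabulate {n = K} (λ j → j)) (length-tabulate {n = n} (λ i → i)))

    0<K : 0 < K
    0<K = ≤-<-trans z≤n (Fin.toℕ<n (proj₁ leaf))

    0<n : 0 < n
    0<n = ≤-<-trans z≤n (Fin.toℕ<n (proj₂ leaf))

    0<k : 0 < k
    0<k = *-mono-≤ 0<K 0<n

    n≤k : n ℕ.≤ k
    n≤k = ≤-trans (≤-reflexive (sym (*-identityˡ n))) (*-monoˡ-≤ n 0<K)

    strings-size : K * suc n ℕ.≤ 2 * k
    strings-size = ≤-trans (≤-reflexive (*-suc K n)) (≤-trans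
      (+-monoˡ-≤ k (≤-trans (≤-reflexive (sym (*-identityʳ K))) (*-monoʳ-≤ K 0<n)))
      (≤-reflexive (cong (k +_) (sym (+-identityʳ k)))))

    -- One cell for the root pointer and twelve for the fail structure, then the string table with n
    -- + 1 entries per row because of the final prefix product, then the trie, whose root has depth
    -- 0 and k leaves. As k is positive, the constants are absorbed.
    total-size : 13 + (K * suc n + (33 * suc k + 40 * k)) ℕ.≤ 121 * k
    total-size = begin
      13 + (K * suc n + (33 * suc k + 40 * k))      ≤⟨ +-monoʳ-≤ 13 (+-monoˡ-≤ _ strings-size) ⟩
      13 + (2 * k + (33 * suc k + 40 * k))          ≡⟨ arith k ⟩
      46 + 75 * k                                   ≤⟨ +-monoˡ-≤ (75 * k) (*-monoʳ-≤ 46 0<k) ⟩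
      46 * k + 75 * k                               ≡⟨ *-distribʳ-+ k 46 75 ⟨
      121 * k                                       ∎
      where
      open ≤-Reasoning
      arith : ∀ k → 13 + (2 * k + (33 * suc k + 40 * k)) ≡ 46 + 75 * k
      arith = solve 1 (λ k → con 13 :+ (con 2 :* k :+ (con 33 :* (con 1 :+ k) :+ con 40 :* k)) := con 46 :+ con 75 :* k) refl
        where open +-*-Solver

    rows : ∀ {K} → (Fin K → ℕ → Cell) → ℕ → List Cell
    rows {zero}  f m = []
    rows {suc K} f m = applyUpTo (f zero) m ++ rows (f ∘ suc) m

    length-rows : ∀ {K} (f : Fin K → ℕ → Cell) m → length (rows f m) ≡ K * m
    length-rows {zero}  f m = refl
    length-rows {suc K} f m = trans (length-++ (applyUpTo (f zero) m))
      (cong₂ _+_ (length-applyUpTo (f zero) m) (length-rows (f ∘ suc) m))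

    rows-word : ∀ {K} (f : Fin K → ℕ → Cell) m → (∀ j t → Word (f j t)) → All Word (rows f m)
    rows-word {zero}  f m ok = []
    rows-word {suc K} f m ok = All.++⁺ (All.applyUpTo⁺₂ (f zero) m (ok zero)) (rows-word (f ∘ suc) m (ok ∘ suc))

    seg-rows : ∀ {M K b} (f : Fin K → ℕ → Cell) {m} → Seg M b (rows f m) → ∀ j {t} → t < m →
               int M (b + (toℕ j * m + t)) ≡ proj₁ (f j t) × prob M (b + (toℕ j * m + t)) ≡ proj₂ (f j t)
    seg-rows f {m} seg zero    t<m = seg-applyUpTo (f zero) (seg-++⁻ˡ (applyUpTo (f zero) m) seg) t<m
    seg-rows {M} {b = b} f {m} seg (suc j) {t} t<m = subst
      (λ a → int M a ≡ proj₁ (f (suc j) t) × prob M a ≡ proj₂ (f (suc j) t))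
      (trans (+-assoc b m _) (cong (b +_) (sym (+-assoc m (toℕ j * m) t))))
      (seg-rows (f ∘ suc) (subst (λ l → Seg M (b + l) (rows (f ∘ suc) m)) (length-applyUpTo (f zero) m)
        (seg-++⁻ʳ (applyUpTo (f zero) m) seg)) j t<m)

    memory : List Cell → Memory
    memory cells = record { int = read 0 (map proj₁ cells) ; prob = read 0# (map proj₂ cells) }

    seg-memory : ∀ pre cells → Seg (memory (pre ++ cells)) (length pre) cells
    seg-memory pre []             = []
    seg-memory pre (cell ∷ cells) = (read-at proj₁ pre , read-at proj₂ pre) ∷
      subst₂ (λ b xs → Seg (memory xs) b cells) (trans (length-++ pre) (+-comm (length pre) 1)) (++-assoc pre (cell ∷ []) cells)
        (seg-memory (pre ++ cell ∷ []) cells)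
      where
      read-at : ∀ {a} {A : Set a} {d : A} (f : Cell → A) pre → read d (map f (pre ++ cell ∷ cells)) (length pre) ≡ f cell
      read-at f []        = refl
      read-at f (_ ∷ pre) = read-at f pre

    toInts : ∀ {cells} → All Word cells → List (Fin N)
    toInts []             = []
    toInts (word ∷ words) = fromℕ< (proj₁ word) ∷ toInts words

    toInts≡ : ∀ {cells} (words : All Word cells) → map toℕ (toInts words) ≡ map proj₁ cells
    toInts≡ []             = refl
    toInts≡ (word ∷ words) = cong₂ _∷_ (Fin.toℕ-fromℕ< (proj₁ word)) (toInts≡ words)

    probs-word : ∀ {cells} → All Word cells → All (λ x → 0# ≤ x × x ≤ 1#) (map proj₂ cells)
    probs-word []             = []
    probs-word (word ∷ words) = proj₂ word ∷ probs-word words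

    fromCells : ∀ {cells} → All Word cells → DataStructure w
    fromCells {cells} words = record
      { ints = toInts words ; probs = map proj₂ cells ; probs-∈[0,1] = probs-word words }

    space≡ : ∀ {cells} (words : All Word cells) → DataStructure.space (fromCells words) ≡ 2 * length cells
    space≡ {cells} words = cong₂ _+_
      (trans (sym (length-map toℕ (toInts words))) (trans (cong length (toInts≡ words)) (length-map proj₁ cells)))
      (trans (length-map proj₂ cells) (sym (+-identityʳ _)))

    module _ (roomy : 250 * k ℕ.≤ N) where

      121k<N : 121 * k < N
      121k<N = <-≤-trans (*-monoˡ-< k {{ℕ.>-nonZero 0<k}} (m≤m+n 122 128)) roomy

      below : ∀ {x} → x ℕ.≤ 121 * k → x < N
      below x≤ = ≤-<-trans x≤ 121k<N

      n<N : n < N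
      n<N = below (≤-trans n≤k (m≤m+n k (120 * k)))

      13≤121k : 13 ℕ.≤ 121 * k
      13≤121k = ≤-trans (m≤m+n 13 _) total-size

      strings<N : ∀ j {t} → t ℕ.≤ n → stringAt j t < N
      strings<N j {t} t≤n = below (begin
        13 + (toℕ j * suc n + t)                      ≤⟨ +-monoʳ-≤ 13 (+-monoʳ-≤ (toℕ j * suc n) (≤-trans t≤n (n≤1+n n))) ⟩
        13 + (toℕ j * suc n + suc n)                  ≡⟨ cong (13 +_) (+-comm (toℕ j * suc n) (suc n)) ⟩
        13 + suc (toℕ j) * suc n                      ≤⟨ +-monoʳ-≤ 13 (*-monoˡ-≤ (suc n) (Fin.toℕ<n j)) ⟩
        13 + K * suc n                                ≤⟨ +-monoʳ-≤ 13 (m≤m+n (K * suc n) (33 * suc k + 40 * k)) ⟩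
        13 + (K * suc n + (33 * suc k + 40 * k))      ≤⟨ total-size ⟩
        121 * k                                       ∎)
        where open ≤-Reasoning

      open Nodes n<N σ≤N (λ j → strings<N j ≤-refl)

      FailLayout NodeLayout : Set _
      FailLayout = Layout (λ M r → Thin M r (group leaf []) × int M r ≡ 0) 0 1 12
      NodeLayout = Layout (NodeAt [] 1) 22 (13 + K * suc n) (nodeSize [] E)

      failLayout : FailLayout
      failLayout = thinLayout (group leaf []) 0 (below z≤n) (group single) 1 (below 13≤121k)
        where
        open import Data.List.Relation.Unary.Any using (here)
        single : ∀ m → Coherent m (leaf ∷ [])
        single m (here refl) (here refl) _ = refl

      nodeLayout : NodeLayout
      nodeLayout = node (suc (length E)) [] E (below (≤-trans (m≤m+n 1 12) 13≤121k)) (below (≤-trans (m≤m+n 10 3) 13≤121k))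
        (λ { {j , i} _ → ∈-cartesianProduct⁺ (∈-allFin j) (∈-allFin i) }) (λ _ → z≤n , tt)
        (subst (0 <_) (sym length-E) 0<k) ≤-refl (13 + K * suc n)
        (below (≤-trans (≤-reflexive (trans (+-assoc 13 (K * suc n) _)
          (cong (λ l → 13 + (K * suc n + (33 * suc l + 40 * l))) length-E))) total-size))

      -- Besides their interface, the root address and the length of the fail layout are all that is
      -- used of the two layouts, which can thus stay variables.
      module Assembled (fl : FailLayout) (fail-root : Layout.root fl ≡ failAddr) (fail-length : length (Layout.cells fl) ≡ 12)
                       (nl : NodeLayout) where

        private
          module FL = Layout fl
          module NL = Layout nl

        stringCell : Fin K → ℕ → Cell
        stringCell j t = toℕ (str j t) , prefix j t

        body cells : List Cell
        body  = FL.cells ++ (rows stringCell (suc n) ++ NL.cells)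
        cells = word NL.root ∷ body

        words : All Word cells
        words = word-ok NL.root<N ∷ All.++⁺ FL.words (All.++⁺
          (rows-word stringCell (suc n) (λ j t → <-≤-trans (Fin.toℕ<n (str j t)) σ≤N , prefix∈[0,1] j t)) NL.words)

        D : DataStructure w
        D = fromCells words

        cells-length : length cells ℕ.≤ 121 * k
        cells-length = ≤-trans (begin
          length cells
            ≡⟨ cong suc (trans (length-++ FL.cells) (cong (length FL.cells +_)
                 (trans (length-++ (rows stringCell (suc n))) (cong (_+ length NL.cells) (length-rows stringCell (suc n)))))) ⟩
          1 + (length FL.cells + (K * suc n + length NL.cells))
            ≤⟨ +-monoʳ-≤ 1 (+-mono-≤ FL.fits (+-monoʳ-≤ (K * suc n) (≤-trans (m≤n+m _ 22) NL.fits))) ⟩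
          13 + (K * suc n + nodeSize [] E)
            ≡⟨ cong (λ l → 13 + (K * suc n + (33 * suc l + 40 * l))) length-E ⟩
          13 + (K * suc n + (33 * suc k + 40 * k)) ∎) total-size
          where open ≤-Reasoning

        space≤ : DataStructure.space D ℕ.≤ 250 * k
        space≤ = begin
          DataStructure.space D     ≡⟨ space≡ words ⟩
          2 * length cells          ≤⟨ *-monoʳ-≤ 2 cells-length ⟩
          2 * (121 * k)             ≡⟨ *-assoc 2 121 k ⟨
          242 * k                   ≤⟨ *-monoˡ-≤ k (m≤m+n 242 8) ⟩
          250 * k                   ∎
          where open ≤-Reasoning

        module _ {m : ℕ} (P : Vec (Fin σ) m) (m<N : m < N) where

          private
            module X = Execution F D P σ≤N m<N
            module R = Reporting F T z sys D P σ≤N m<N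

            M≡ : memory cells ≡ X.M
            M≡ = cong (λ xs → record { int = read 0 xs ; prob = read 0# (map proj₂ cells) }) (sym (toInts≡ words))

            seg : Seg X.M 0 cells
            seg = subst (λ M → Seg M 0 cells) M≡ (seg-memory [] cells)

            root≡ : int X.M 0 ≡ NL.root
            root≡ = first seg
              where
              first : ∀ {M xs} → Seg M 0 (word NL.root ∷ xs) → int M 0 ≡ NL.root
              first ((eq , _) ∷ _) = eq

            seg-body : Seg X.M 1 body
            seg-body = rest seg
              where
              rest : ∀ {M x xs} → Seg M 0 (x ∷ xs) → Seg M 1 xs
              rest (_ ∷ s) = s

            fail : Thin X.M failAddr (group leaf [])
            fail = subst (λ r → Thin X.M r (group leaf [])) fail-root (proj₁ (FL.holds (seg-++⁻ˡ FL.cells seg-body)))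

            seg-tail : Seg X.M 13 (rows stringCell (suc n) ++ NL.cells)
            seg-tail = subst (λ l → Seg X.M (1 + l) (rows stringCell (suc n) ++ NL.cells)) fail-length (seg-++⁻ʳ FL.cells seg-body)

            table : R.StringTable
            table = record
              { letters≡  = λ j t≤n → proj₁ (seg-rows stringCell (seg-++⁻ˡ (rows stringCell (suc n)) seg-tail) j (s≤s t≤n))
              ; prefixes≡ = λ j t≤n → proj₂ (seg-rows stringCell (seg-++⁻ˡ (rows stringCell (suc n)) seg-tail) j (s≤s t≤n))
              ; strings<N = strings<N }

            root-node : Node X.M [] NL.root × int X.M NL.root ≡ 1
            root-node = NL.holds (subst (λ l → Seg X.M (13 + l) NL.cells) (length-rows stringCell (suc n))
              (seg-++⁻ʳ (rows stringCell (suc n)) seg-tail)) fail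

            -- The program takes the pointer 0 for an empty structure. Cell 0 holds the pointer
            -- itself; were it 0, this cell would also be the record of the root, whose key was
            -- chosen to be 1.
            root≢0 : NL.root ≢ 0
            root≢0 root≡0 = absurd (trans (sym (proj₂ root-node)) (trans (cong (int X.M) root≡0) (trans root≡ root≡0)))
              where
              absurd : 1 ≢ 0
              absurd ()

          answer-run : ∀ q → X.Run (program q) (λ _ → 0) (λ _ → 0#) (λ _ → 0) (31 + m * 70)
                                   (λ ir pr im → WeightedSequences.IsAnswer F T z P q (X.output (X.state ir pr im)))
          answer-run = R.program-run table fail (proj₁ root-node) root≡ root≢0

-- The data structure for every weighted sequence, and the theorem.

open import Data.Empty using (⊥-elim)
open import Data.Fin.Base using (Fin; zero)
open import Data.List.Relation.Unary.All using ([])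
open import Data.Nat.Base as ℕ using (ℕ; zero; suc; z≤n; s≤s)
import Data.Nat.Properties as ℕ
open import Data.Product.Base using (_×_; _,_; proj₁; proj₂; ∃-syntax; Σ-syntax)
open import Data.Vec.Base using (Vec)
open import Defs
open Estimation using (module Strings)
open Index
open Leaves using (module LeafStrings)
open Machine using (program; module Execution)
open Databases using (module Database)
open OrderedField using (module OrderedFieldProperties)
open import Relation.Binary.PropositionalEquality as ≡ using (_≡_; refl)

module _ {c ℓ₁ ℓ₂} (F : ArchimedeanField c ℓ₁ ℓ₂) where
  open ArchimedeanField F
  open WeightedSequences F
  open WordRAM F
  open OrderedFieldProperties F

  Solves : (n σ : ℕ) → WeightedSequence n σ → Carrier → ℕ → Set _
  Solves n σ T z w = Σ[ D ∈ DataStructure w ]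
    fromℕ (DataStructure.space D) ≤ fromℕ 250 * (fromℕ n * z) ×
    (∀ (q : Query) (m : ℕ) (P : Vec (Fin σ) m) → m ℕ.< 2 ℕ.^ w →
      ∃[ t ] ∃[ s ] (D , P ⊢⟨ program q , initial ⟩⇓[ t ] s) × t ℕ.≤ 250 ℕ.* suc m × IsAnswer T z P q (output s))

  -- Length 0 allows no space at all, not even a root pointer. Reading past the end of the empty
  -- arrays gives 0, and the program answers that there is no occurrence.
  solve-empty : ∀ {σ} (T : WeightedSequence 0 σ) z w → σ ℕ.≤ 2 ℕ.^ w → Solves 0 σ T z w
  solve-empty T z w σ≤N = D , ≤.reflexive (≈.sym (≈.trans (≈.*-congˡ (≈.zeroˡ z)) (≈.zeroʳ (fromℕ 250)))) , answer
    where
    D : DataStructure w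
    D = record { ints = List.[] ; probs = List.[] ; probs-∈[0,1] = [] }
      where import Data.List.Base as List
    answer : ∀ q m P → m ℕ.< 2 ℕ.^ w →
             ∃[ t ] ∃[ s ] (D , P ⊢⟨ program q , initial ⟩⇓[ t ] s) × t ℕ.≤ 250 ℕ.* suc m × IsAnswer T z P q (output s)
    answer q m P m<N = Run.time run , _ , Run.halts run , ℕ.≤-trans (Run.in-time run)
        (ℕ.≤-trans (ℕ.m≤m+n 5 245) (ℕ.≤-trans (ℕ.≤-reflexive (≡.sym (ℕ.*-identityʳ 250))) (ℕ.*-monoʳ-≤ 250 (s≤s {n = m} z≤n)))) ,
        Run.post run
      where
      open Execution F D P σ≤N m<N using (Run; module Run; state; assigns; _▸_; length≡; data≡; if-≡; last)
      run : Run (program q) (λ _ → 0) (λ _ → 0#) (λ _ → 0) 5 (λ ir pr im → IsAnswer T z P q (output (state ir pr im)))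
      run = assigns refl ▸ length≡ ▸ data≡ refl refl ▸ if-≡ refl refl refl (last (data≡ refl refl) (none refl))

  module _ {n σ : ℕ} (T : WeightedSequence (suc n) σ) (z : Carrier) (1≤z : 1# ≤ z) where
    open Strings F T z 1≤z using (K; 0≤z)

    private
      -- The probabilities of a position sum to 1, which excludes the empty alphabet.
      letter₀ : ∀ {σ} (f : Fin σ → Carrier) → sum f ≈ 1# → Fin σ
      letter₀ {zero}  f 0≈1 = ⊥-elim (0≉1 0≈1)
      letter₀ {suc _} f _   = zero

      a₀ : Fin σ
      a₀ = letter₀ (WeightedSequence.p T zero) (WeightedSequence.p-sum T zero)

      module L = LeafStrings F T z 1≤z a₀

    0<K : 0 ℕ.< K
    0<K = ≤⌊⌋ (≤-respˡ (≈.sym (≈.+-identityʳ 1#)) 1≤z)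

    system : LeafSystem F T z
    system = record
      { K = K ; str = L.str ; len = L.len ; prefix = L.prefix ; start+len≤n = L.start+len≤n
      ; match⇒∈Occ = L.match⇒∈Occ ; ∈Occ⇒match = L.∈Occ⇒match ; 0≤Prob = L.0≤Prob ; Prob≤1 = L.Prob≤1
      ; prefix∈[0,1] = L.prefix∈[0,1] ; Prob≈window = L.Prob≈window ; leaf = Data.Fin.Base.fromℕ< 0<K , zero }
      where import Data.Fin.Base

    space-bound : fromℕ (250 ℕ.* (K ℕ.* suc n)) ≤ fromℕ 250 * (fromℕ (suc n) * z)
    space-bound = ≤-respˡ (≈.sym (fromℕ-* 250 (K ℕ.* suc n))) (*-monoˡ-≤ (0≤fromℕ 250)
      (≤-respˡ (≈.sym (≈.trans (fromℕ-* K (suc n)) (≈.*-comm _ _))) (*-monoˡ-≤ (0≤fromℕ (suc n)) (fromℕ⌊⌋≤ 0≤z))))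

    solve-nonempty : ∀ w → σ ℕ.≤ 2 ℕ.^ w → fromℕ 250 * (fromℕ (suc n) * z) ≤ fromℕ (2 ℕ.^ w) → Solves (suc n) σ T z w
    solve-nonempty w σ≤N size≤N = D , ≤.trans (fromℕ-mono space≤) space-bound , answer
      where
      open Database F T z system w σ≤N
      -- The hypothesis on the word length bounds a field element. Because K is a floor of z and the
      -- order of the field reflects that of the natural numbers, it bounds the integer 250 * k as
      -- well.
      roomy : 250 ℕ.* (K ℕ.* suc n) ℕ.≤ 2 ℕ.^ w
      roomy = fromℕ-cancel (≤.trans space-bound size≤N)
      open Assembled roomy (failLayout roomy) refl refl (nodeLayout roomy)
      answer : ∀ q m P → m ℕ.< 2 ℕ.^ w →
               ∃[ t ] ∃[ s ] (D , P ⊢⟨ program q , initial ⟩⇓[ t ] s) × t ℕ.≤ 250 ℕ.* suc m × IsAnswer T z P q (output s)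
      answer q m P m<N = Run.time run , _ , Run.halts run , ℕ.≤-trans (Run.in-time run) bound , Run.post run
        where
        open Execution F D P σ≤N m<N using (Run; module Run; state)
        run : Run (program q) (λ _ → 0) (λ _ → 0#) (λ _ → 0) (31 ℕ.+ m ℕ.* 70) (λ ir pr im → IsAnswer T z P q (output (state ir pr im)))
        run = answer-run P m<N q
        bound : 31 ℕ.+ m ℕ.* 70 ℕ.≤ 250 ℕ.* suc m
        bound = ℕ.≤-trans (ℕ.+-mono-≤ (ℕ.m≤m+n 31 219)
          (ℕ.≤-trans (ℕ.≤-reflexive (ℕ.*-comm m 70)) (ℕ.*-monoˡ-≤ m (ℕ.m≤m+n 70 180)))) (ℕ.≤-reflexive (≡.sym (ℕ.*-suc 250 m)))

  solve : ∀ (n σ : ℕ) (T : WeightedSequence n σ) (z : Carrier) → 1# ≤ z → ∀ w → σ ℕ.≤ 2 ℕ.^ w →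
          fromℕ 250 * (fromℕ n * z) ≤ fromℕ (2 ℕ.^ w) → Solves n σ T z w
  solve zero    σ T z 1≤z w σ≤N _      = solve-empty T z w σ≤N
  solve (suc n) σ T z 1≤z w σ≤N size≤N = solve-nonempty T z 1≤z w σ≤N size≤N

theorem4p4 : ∀ {c ℓ₁ ℓ₂} (F : ArchimedeanField c ℓ₁ ℓ₂) →
    let open ArchimedeanField F
        open WeightedSequences F
        open WordRAM F
    in
    Σ[ C ∈ ℕ ] Σ[ program ∈ (Query → Program) ]
      (∀ (n σ : ℕ) (T : WeightedSequence n σ) (z : Carrier) → 1# ≤ z →
       ∀ (w : ℕ) → σ ℕ.≤ 2 ℕ.^ w → fromℕ C * (fromℕ n * z) ≤ fromℕ (2 ℕ.^ w) →
       Σ[ D ∈ DataStructure w ]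
         fromℕ (DataStructure.space D) ≤ fromℕ C * (fromℕ n * z) ×
         (∀ (q : Query) (m : ℕ) (P : Vec (Fin σ) m) → m ℕ.< 2 ℕ.^ w →
           ∃[ t ] ∃[ s ]
             (D , P ⊢⟨ program q , initial ⟩⇓[ t ] s) ×
             t ℕ.≤ C ℕ.* ℕ.suc m ×
             IsAnswer T z P q (output s)))
-- Space: at most 121 * K * n cells, each an integer and a probability, hence 242 words per leaf.
-- Time: 31 + 70 * m steps. The constant 250 covers both and also leaves the addresses room below 2
-- ^ w.
theorem4p4 F = 250 , program , solve F
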